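{- For every integer $c\ge 1$ there is a constant $\delta(c)$ such that for every integer $\ell\ge 1$ \[ k^*(P_\ell,P_c)=(\delta(c)-o(1))\cdot \ell, \] where $o(1)$ stands for a non-negative function of $c$ and $\ell$ that tends to $0$ for $c$ fixed and $\ell\to\infty$.
   Context: For a positive integer $k$ and forests $F_1,F_2$, the $(F_1,F_2)$-avoidance game with tree size restriction $k$ is played by Builder and Painter on a vertex-colored graph (the board), initially empty. In each step Builder adds one new vertex with edges from some previously present vertices to it, so that the board always remains a forest all of whose components have at most $k$ vertices; Painter immediately and irrevocably colors the new vertex with color $1$ or $2$. Painter loses as soon as the board contains a copy (subgraph isomorphic) of $F_1$ all of whose vertices have color $1$ or a copy of $F_2$ all of whose vertices have color $2$. Builder has a winning strategy if he can force this within finitely many steps. $k^*(F_1,F_2)$ is the smallest $k$ for which Builder has a winning strategy. $P_\ell$ denotes the path on $\ell$ vertices. -}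

module Defs where

open import Data.Nat using (ℕ; zero; suc; _≤_; _≡ᵇ_)
open import Data.Bool using (Bool; true; false; _∨_)
open import Data.Fin using (Fin; zero; suc; toℕ; inject₁; fromℕ)
open import Data.Integer using (+_)
open import Data.Rational using (ℚ; 0ℚ; _/_; ∣_∣) renaming (_≤_ to _≤ℚ_; _<_ to _<ℚ_; _+_ to _+ℚ_; _-_ to _-ℚ_)
open import Data.Product using (Σ; ∃; _×_; _,_)
open import Data.Sum using (_⊎_)
open import Relation.Nullary using (¬_)
open import Relation.Binary.PropositionalEquality using (_≡_)
open import Function.Definitions using (Injective)

record Graph : Set where
  field
    size : ℕ
    adj  : Fin size → Fin size → Bool
open Graph public

record CopyWith (H G : Graph) (P : Fin (size G) → Set) : Set where
  field
    φ      : Fin (size H) → Fin (size G)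
    φ-inj  : Injective _≡_ _≡_ φ
    φ-edge : ∀ i j → adj H i j ≡ true → adj G (φ i) (φ j) ≡ true
    φ-prop : ∀ i → P (φ i)

Path : ℕ → Graph
Path ℓ = record { size = ℓ ; adj = λ i j → (suc (toℕ i) ≡ᵇ toℕ j) ∨ (suc (toℕ j) ≡ᵇ toℕ i) }

data Colour : Set where
  c1 c2 : Colour

record Board : Set where
  field
    graph : Graph
    col   : Fin (size graph) → Colour
open Board public

emptyBoard : Board
emptyBoard = record { graph = record { size = 0 ; adj = λ () } ; col = λ () }

-- Builder's move: a new vertex (index zero in the new board) joined to the
-- set S of previously present vertices; Painter gives it colour c.
extendGraph : (G : Graph) → (Fin (size G) → Bool) → Graph
extendGraph G S = record { size = suc (size G) ; adj = a }
  where
  a : Fin (suc (size G)) → Fin (suc (size G)) → Bool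
  a zero    zero    = false
  a zero    (suc j) = S j
  a (suc i) zero    = S i
  a (suc i) (suc j) = adj G i j

extend : (B : Board) → (Fin (size (graph B)) → Bool) → Colour → Board
extend B S c = record { graph = extendGraph (graph B) S ; col = cl }
  where
  cl : Fin (suc (size (graph B))) → Colour
  cl zero    = c
  cl (suc i) = col B i

data Reach (G : Graph) : Fin (size G) → Fin (size G) → Set where
  here  : ∀ {u} → Reach G u u
  there : ∀ {u w v} → adj G u w ≡ true → Reach G w v → Reach G u v

record Cycle (G : Graph) : Set where
  field
    m     : ℕ
    v     : Fin (suc (suc (suc m))) → Fin (size G)
    v-inj : Injective _≡_ _≡_ v
    v-con : ∀ (i : Fin (suc (suc m))) → adj G (v (inject₁ i)) (v (suc i)) ≡ true
    v-cls : adj G (v (fromℕ (suc (suc m)))) (v zero) ≡ true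

IsForest : Graph → Set
IsForest G = ¬ Cycle G

ComponentsAtMost : ℕ → Graph → Set
ComponentsAtMost k G =
  ∀ (u : Fin (size G)) (m : ℕ) (f : Fin m → Fin (size G)) →
  Injective _≡_ _≡_ f → (∀ i → Reach G u (f i)) → m ≤ k

Legal : ℕ → (B : Board) → (Fin (size (graph B)) → Bool) → Set
Legal k B S = IsForest (extendGraph (graph B) S) × ComponentsAtMost k (extendGraph (graph B) S)

Lost : Graph → Graph → Board → Set
Lost F₁ F₂ B = CopyWith F₁ (graph B) (λ x → col B x ≡ c1)
             ⊎ CopyWith F₂ (graph B) (λ x → col B x ≡ c2)

data BuilderWins (k : ℕ) (F₁ F₂ : Graph) : Board → Set where
  lost : ∀ {B} → Lost F₁ F₂ B → BuilderWins k F₁ F₂ B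
  move : ∀ {B} (S : Fin (size (graph B)) → Bool) → Legal k B S →
         (∀ c → BuilderWins k F₁ F₂ (extend B S c)) → BuilderWins k F₁ F₂ B

BuilderHasWinningStrategy : ℕ → Graph → Graph → Set
BuilderHasWinningStrategy k F₁ F₂ = BuilderWins k F₁ F₂ emptyBoard

IsKStar : Graph → Graph → ℕ → Set
IsKStar F₁ F₂ K =
  1 ≤ K × BuilderHasWinningStrategy K F₁ F₂ ×
  (∀ k → 1 ≤ k → BuilderHasWinningStrategy k F₁ F₂ → K ≤ k)

record ℝ : Set where
  field
    seq    : ℕ → ℚ
    cauchy : ∀ ε → 0ℚ <ℚ ε → ∃ λ N → ∀ m n → N ≤ m → N ≤ n →
             ∣ seq m -ℚ seq n ∣ ≤ℚ ε
open ℝ public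

_≤ℚℝ_ : ℚ → ℝ → Set
q ≤ℚℝ x = ∀ ε → 0ℚ <ℚ ε → ∃ λ N → ∀ n → N ≤ n → q ≤ℚ seq x n +ℚ ε

ConvergesTo : (ℕ → ℚ) → ℝ → Set
ConvergesTo a x = ∀ ε → 0ℚ <ℚ ε → ∃ λ L → ∀ ℓ → L ≤ ℓ →
  ∃ λ N → ∀ n → N ≤ n → ∣ a ℓ -ℚ seq x n ∣ ≤ℚ ε

-- (k / ℓ) for ℓ = suc m.
ratio : ℕ → ℕ → ℚ
ratio k m = + k / suc m

{-# OPTIONS --safe #-}
module Submission where

-- A colour-2 path on j vertices has a cost g j, the size of the smallest component
-- containing one; given such a cost function, the cheapest component with a
-- colour-1 path on n vertices is the value of a recursion on binary trees (Build).
-- Painter may fix any g in advance, and Builder either carries out an optimal tree or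
-- sees some entry of g drop, so k* is the maximum over g of the value of the recursion.
--
-- With c fixed, let K(n) = k*(P_n, P_c). Multiplying g by t gives K(tn) ≥ t K(n); the
-- work lies in an upper bound K(n) ≤ (1 + ε)(K(ℓ)/ℓ) n with ℓ computable from ε, which
-- yields a modulus of convergence instead of a mere supremum. To compare a painter g for
-- a long path with some painter for length ℓ, choose a gap in the scales of
-- g 1 ≤ … ≤ g (c - 1). The costs above the gap are divided by a common factor. Those below
-- it only influence the slope of the recursion, and are replaced by a nearly optimal
-- painter of the game for P_{c′}, c′ < c, known by induction on c.

open import Defs
open import Data.Bool using (Bool; true; false; _∨_)
open import Data.Empty using (⊥; ⊥-elim)
open import Data.Fin using (Fin; toℕ; fromℕ<; zero; suc; inject₁; inject≤; fromℕ)
open import Data.Fin.Properties using (any?; toℕ-fromℕ<; toℕ<n)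
open import Data.List using (List; []; _∷_; _++_; map; length; lookup; tabulate; head)
open import Data.List.Membership.Propositional using (_∈_; _∉_)
open import Data.List.Membership.Propositional.Properties using (∈-lookup; ∈-++⁺ˡ; ∈-++⁺ʳ; ∈-++⁻; ∈-map⁺; ∈-map⁻; ∈-tabulate⁻)
open import Data.List.Relation.Binary.Pointwise using (Pointwise; []; _∷_)
open import Data.List.Relation.Unary.All as All using (All; []; _∷_)
open import Data.List.Relation.Unary.AllPairs using ([]; _∷_)
open import Data.List.Relation.Unary.Any using (here; there)
open import Data.List.Relation.Unary.Linked as Linked using (Linked; []; [-]; _∷_)
open import Data.List.Relation.Unary.Unique.Propositional using (Unique)
open import Data.Maybe using (Maybe; just; nothing)
open import Data.Nat
open import Data.Nat.DivMod using (_/_; m/n*n≤m; _%_; m≡m%n+[m/n]*n; m%n<n; m≥n⇒m/n>0)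
open import Data.Nat.Induction using (<-rec)
open import Data.Nat.ListAction using (sum)
open import Data.Nat.ListAction.Properties using (sum-++)
open import Data.Nat.Properties
open import Data.Nat.Tactic.RingSolver using (solve-∀)
open import Data.Product using (Σ; ∃; _×_; _,_; proj₁; proj₂)
open import Data.Rational using (ℚ; mkℚ; 0ℚ; *<*)
open import Data.Sum using (_⊎_; inj₁; inj₂)
open import Data.Vec using (Vec; []; _∷_)
open import Relation.Binary.PropositionalEquality using (_≡_; refl; sym; trans; cong; cong₂; subst; subst₂; module ≡-Reasoning; _≢_)
open import Relation.Nullary using (¬_; Dec; yes; no)
open import Relation.Nullary.Decidable using (_×-dec_; _⊎-dec_; map′; ⌊_⌋)
import Data.Fin.Properties as FinP
import Data.Integer as ℤ
import Data.Integer.Properties as ℤP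
import Data.List.Membership.DecPropositional as DecMembership
import Data.List.Properties as ListP
import Data.List.Relation.Unary.All.Properties as AllP
import Data.List.Relation.Unary.Linked.Properties as LinkedP
import Data.List.Relation.Unary.Unique.Propositional.Properties as UniqueP
import Data.Rational as ℚ
import Data.Rational.Properties as ℚP
import Data.Rational.Unnormalised as ℚᵘ
import Data.Rational.Unnormalised.Properties as ℚᵘP
open import Algebra.Properties.Group ℚP.+-0-group using (⁻¹-involutive)

-- The cost calculus

-- Let `b₀` be the last index below the gap. While a component is lighter than `g (suc b₀)`, a
-- colour-2 path on more than `b₀` vertices is cheaper than announced, so Builder may count it as
-- completed: locally the game is that for the path on `suc b₀` vertices. This is why the costs
-- below the gap enter only through the slope of a smaller game. Dividing them by the common factor
-- would round them away, whereas the costs above the gap are large against the rounding and against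
-- all other errors. The reference length `ℓ` must be fixed before `g`, hence before the position of
-- the gap is known, so the gap ratio and the bounds for the smaller games have to serve all
-- positions at once. Errors must be relative to the length, up to an additive term that a single
-- join can absorb; otherwise they would accumulate along the tree. Under a join it is the length
-- plus one that adds up, hence the many length identities with `suc` on both sides.

Free : ℕ → ℕ → ℕ → ℕ → Set
Free c b x S = c ≤ b ⊎ S < x

free-≤ : ∀ {c b x S S′} → S′ ≤ S → Free c b x S → Free c b x S′
free-≤ le (inj₁ x) = inj₁ x
free-≤ le (inj₂ x) = inj₂ (≤-<-trans le x)

-- In a join, i₁ and i₂ are the colour-1 arms and j₁ and j₂ the colour-2 arms of the new
-- vertex. It is admissible if colour 2 would complete P_c or a colour-2 path cheaper
-- than g announces; lengths 0 encode missing arms, so g 0 ≡ 0 is assumed throughout.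
data Build (c : ℕ) (g : ℕ → ℕ) : ℕ → ℕ → Set where
  nil  : Build c g 0 0
  join : ∀ {i₁ i₂ w₁ w₂} → Build c g i₁ w₁ → Build c g i₂ w₂ →
         ∀ j₁ j₂ → j₁ < c → j₂ < c →
         Free c (suc (j₁ + j₂)) (g (suc (j₁ + j₂))) (suc (w₁ + w₂ + (g j₁ + g j₂))) →
         Build c g (suc (i₁ + i₂)) (suc (w₁ + w₂ + (g j₁ + g j₂)))

length≤weight : ∀ {c g n w} → Build c g n w → n ≤ w
length≤weight nil = z≤n
length≤weight (join B₁ B₂ _ _ _ _ _) =
  s≤s (≤-trans (+-mono-≤ (length≤weight B₁) (length≤weight B₂)) (m≤m+n _ _))

-- Dropping a vertex from an arm lowers the weight of every join above it, and a lighter join stays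
-- admissible; a join without colour-1 arms is dropped altogether. The strict decrease pays for the
-- case without carry in `unscale`.
shorten₁ : ∀ {c g n w} → Build c g (suc n) w → ∃ λ w′ → suc w′ ≤ w × Build c g n w′
shorten₁ (join {zero} {zero} _ _ _ _ _ _ _) = 0 , s≤s z≤n , nil
shorten₁ {g = g} (join {suc i₁} {w₁ = w₁} {w₂} B₁ B₂ j₁ j₂ lt₁ lt₂ fr) with shorten₁ B₁
... | w , w<w₁ , B = suc (w + w₂ + (g j₁ + g j₂)) , s≤s le ,
      join B B₂ j₁ j₂ lt₁ lt₂ (free-≤ (≤-trans le (n≤1+n _)) fr)
  where
  le : suc w + w₂ + (g j₁ + g j₂) ≤ w₁ + w₂ + (g j₁ + g j₂)
  le = +-monoˡ-≤ (g j₁ + g j₂) (+-monoˡ-≤ w₂ w<w₁)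
shorten₁ {g = g} (join {zero} {suc i₂} {w₁} {w₂} B₁ B₂ j₁ j₂ lt₁ lt₂ fr) with shorten₁ B₂
... | w , w<w₂ , B = suc (w₁ + w + (g j₁ + g j₂)) , s≤s le ,
      join B₁ B j₁ j₂ lt₁ lt₂ (free-≤ (≤-trans le (n≤1+n _)) fr)
  where
  le : suc (w₁ + w + (g j₁ + g j₂)) ≤ w₁ + w₂ + (g j₁ + g j₂)
  le = ≤-trans (≤-reflexive (cong (_+ (g j₁ + g j₂)) (sym (+-suc w₁ w))))
         (+-monoˡ-≤ (g j₁ + g j₂) (+-monoʳ-≤ w₁ w<w₂))

shorten-by : ∀ {c g n w} k → Build c g (k + n) w → ∃ λ w′ → w′ ≤ w × Build c g n w′
shorten-by zero B = _ , ≤-refl , B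
shorten-by (suc k) B with shorten₁ B
... | w₁ , lt , B₁ with shorten-by k B₁
... | w₂ , le , B₂ = w₂ , ≤-trans le (<⇒≤ lt) , B₂

shorten : ∀ {c g n m w} → n ≤ m → Build c g m w → ∃ λ w′ → w′ ≤ w × Build c g n w′
shorten {c} {g} {n} {m} {w} n≤m B =
  shorten-by (m ∸ n) (subst (λ x → Build c g x w) (sym (m∸n+n≡m n≤m)) B)

scale-cost : ℕ → (ℕ → ℕ) → ℕ → ℕ
scale-cost t g j = t * g j

private
  scale-free : ∀ {c b x S v} t → t * v ≤ S → Free c b (t * x) S → Free c b x v
  scale-free t le (inj₁ c≤b) = inj₁ c≤b
  scale-free {x = x} {v = v} t le (inj₂ lt) = inj₂ (*-cancelˡ-< t v x (≤-<-trans le lt))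

-- Division with remainder along the tree; it gives K(tp) ≥ t K(p). Spare vertices weigh 1 each. At
-- a join the remainders and the new vertex behave as in addition with carry, and a carry of `t`
-- pays for the joining vertex of the small tree.
unscale : ∀ {c g n w} t .{{_ : NonZero t}} → Build c (scale-cost t g) n w →
          ∃ λ p → ∃ λ r → ∃ λ v → r < t × n ≡ t * p + r × t * v + r ≤ w × Build c g p v
unscale t nil = 0 , 0 , 0 , n≢0⇒n>0 (≢-nonZero⁻¹ t) , e , ≤-reflexive (sym e) , nil
  where e : 0 ≡ t * 0 + 0
        e = sym (trans (+-identityʳ (t * 0)) (*-zeroʳ t))
unscale {c} {g} t (join {w₁ = w₁} {w₂} B₁ B₂ j₁ j₂ lt₁ lt₂ fr)
  with unscale t B₁ | unscale t B₂
... | p₁ , r₁ , v₁ , r₁< , refl , le₁ , C₁ | p₂ , r₂ , v₂ , r₂< , refl , le₂ , C₂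
  with suc (r₁ + r₂) <? t
... | no big = suc (p₁ + p₂) , r , v , r< , en , le ,
      join C₁ C₂ j₁ j₂ lt₁ lt₂ (scale-free t (≤-trans (m≤m+n _ r) le) fr)
  where
  G v r : ℕ
  G = g j₁ + g j₂
  v = suc (v₁ + v₂ + G)
  r = suc (r₁ + r₂) ∸ t
  er : r + t ≡ suc (r₁ + r₂)
  er = m∸n+n≡m (≮⇒≥ big)
  r< : r < t
  r< = +-cancelʳ-< t r t (subst (_< t + t) (sym er) (≤-trans (≤-reflexive (cong suc (sym (+-suc r₁ r₂)))) (+-mono-≤ r₁< r₂<)))
  en : suc (t * p₁ + r₁ + (t * p₂ + r₂)) ≡ t * suc (p₁ + p₂) + r
  en = trans (eq0 t p₁ r₁ p₂ r₂)
       (trans (cong (λ x → t * (p₁ + p₂) + x) (sym er)) (eq t p₁ p₂ r))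
    where eq0 : ∀ t p₁ r₁ p₂ r₂ → suc (t * p₁ + r₁ + (t * p₂ + r₂)) ≡ t * (p₁ + p₂) + suc (r₁ + r₂)
          eq0 = solve-∀
          eq : ∀ t p₁ p₂ r → t * (p₁ + p₂) + (r + t) ≡ t * suc (p₁ + p₂) + r
          eq = solve-∀
  le : t * v + r ≤ suc (w₁ + w₂ + (t * g j₁ + t * g j₂))
  le = ≤-trans (≤-reflexive (eq t v₁ v₂ (g j₁) (g j₂) r))
       (≤-trans (≤-reflexive (cong (λ x → t * v₁ + t * v₂ + (t * g j₁ + t * g j₂) + x) er))
       (≤-trans (≤-reflexive (eq2 (t * v₁) (t * v₂) (t * g j₁ + t * g j₂) r₁ r₂))
        (s≤s (+-monoˡ-≤ (t * g j₁ + t * g j₂) (+-mono-≤ le₁ le₂)))))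
    where eq : ∀ t a b x y r → t * suc (a + b + (x + y)) + r ≡ t * a + t * b + (t * x + t * y) + (r + t)
          eq = solve-∀
          eq2 : ∀ a b x r s → a + b + x + suc (r + s) ≡ suc (a + r + (b + s) + x)
          eq2 = solve-∀
-- Without a carry the joined small tree would be one vertex too long, so the first subtree gives up
-- a vertex; if it has none, the second alone has the right length.
... | yes small with p₁ | C₁ | le₁
...   | zero | nil | le₁ = p₂ , suc (r₁ + r₂) , v₂ , small ,
        eq t p₂ r₁ r₂ , le , C₂
  where
  eq : ∀ t p₂ r₁ r₂ → suc (t * 0 + r₁ + (t * p₂ + r₂)) ≡ t * p₂ + suc (r₁ + r₂)
  eq = solve-∀
  le : t * v₂ + suc (r₁ + r₂) ≤ suc (w₁ + w₂ + (t * g j₁ + t * g j₂))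
  le = ≤-trans (≤-reflexive (eq2 t v₂ r₁ r₂))
       (s≤s (≤-trans (+-mono-≤ le₁ le₂) (m≤m+n _ _)))
    where eq2 : ∀ t v₂ r₁ r₂ → t * v₂ + suc (r₁ + r₂) ≡ suc (t * 0 + r₁ + (t * v₂ + r₂))
          eq2 = solve-∀
...   | suc p | C | le₁ with shorten₁ C
...     | u , u< , C′ = suc (p + p₂) , suc (r₁ + r₂) , suc (u + v₂ + G) , small ,
          eq t p p₂ r₁ r₂ , le , join C′ C₂ j₁ j₂ lt₁ lt₂ (scale-free t (≤-trans (m≤m+n _ _) le) fr)
  where
  G : ℕ
  G = g j₁ + g j₂
  eq : ∀ t p p₂ r₁ r₂ → suc (t * suc p + r₁ + (t * p₂ + r₂)) ≡ t * suc (p + p₂) + suc (r₁ + r₂)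
  eq = solve-∀
  le : t * suc (u + v₂ + G) + suc (r₁ + r₂) ≤ suc (w₁ + w₂ + (t * g j₁ + t * g j₂))
  le = ≤-trans (≤-reflexive (eq2 t u v₂ (g j₁) (g j₂) r₁ r₂))
       (s≤s (+-monoˡ-≤ (t * g j₁ + t * g j₂) (+-mono-≤ (≤-trans (+-monoˡ-≤ r₁ (*-monoʳ-≤ t u<)) le₁) le₂)))
    where eq2 : ∀ t u v x y r s → t * suc (u + v + (x + y)) + suc (r + s) ≡
                  suc (t * suc u + r + (t * v + s) + (t * x + t * y))
          eq2 = solve-∀

-- Monotone and truncated costs

suffix-min : (ℕ → ℕ) → ℕ → ℕ → ℕ
suffix-min g zero    j = g j
suffix-min g (suc d) j = g j ⊓ suffix-min g d (suc j)

suffix-min-attained : ∀ g d j → ∃ λ j′ → j ≤ j′ × j′ ≤ j + d × g j′ ≡ suffix-min g d j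
suffix-min-attained g zero j = j , ≤-refl , ≤-reflexive (sym (+-identityʳ j)) , refl
suffix-min-attained g (suc d) j with ⊓-sel (g j) (suffix-min g d (suc j))
... | inj₁ e = j , ≤-refl , m≤m+n j _ , sym e
... | inj₂ e with suffix-min-attained g d (suc j)
...   | j′ , j≤ , ≤d , eq = j′ , <⇒≤ j≤ , ≤-trans ≤d (≤-reflexive (sym (+-suc j d))) , trans eq (sym e)

suffix-min-≤ : ∀ g d j j′ → j ≤ j′ → j′ ≤ j + d → suffix-min g d j ≤ g j′
suffix-min-≤ g zero j j′ le le′ = ≤-reflexive (cong g (≤-antisym le (≤-trans le′ (≤-reflexive (+-identityʳ j)))))
suffix-min-≤ g (suc d) j j′ le le′ with m≤n⇒m<n∨m≡n le
... | inj₂ refl = m⊓n≤m (g j) _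
... | inj₁ lt = ≤-trans (m⊓n≤n (g j) _) (suffix-min-≤ g d (suc j) j′ lt (≤-trans le′ (≤-reflexive (+-suc j d))))

-- Replacing g by its envelope shows that nondecreasing costs suffice.
lower-envelope : ℕ → (ℕ → ℕ) → ℕ → ℕ
lower-envelope c g j = suffix-min g (c ∸ suc j) j

private
  span : ∀ {c j} → j < c → suc (j + (c ∸ suc j)) ≡ c
  span j<c = m+[n∸m]≡n j<c

lower-envelope-attained : ∀ c g j → j < c → ∃ λ j′ → j ≤ j′ × j′ < c × g j′ ≡ lower-envelope c g j
lower-envelope-attained c g j j<c with suffix-min-attained g (c ∸ suc j) j
... | j′ , le , le′ , e = j′ , le , ≤-trans (s≤s le′) (≤-reflexive (span j<c)) , e

lower-envelope-≤ : ∀ c g j j′ → j ≤ j′ → j′ < c → lower-envelope c g j ≤ g j′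
lower-envelope-≤ c g j j′ le lt =
  suffix-min-≤ g _ j j′ le (s≤s⁻¹ (≤-trans lt (≤-reflexive (sym (span (≤-<-trans le lt))))))

lower-envelope-mono : ∀ c g j j′ → j ≤ j′ → j′ < c → lower-envelope c g j ≤ lower-envelope c g j′
lower-envelope-mono c g j j′ le lt with lower-envelope-attained c g j′ lt
... | k , le′ , k< , e = ≤-trans (lower-envelope-≤ c g j k (≤-trans le le′) k<) (≤-reflexive e)

-- Each colour-2 arm is replaced by the possibly longer one at which the minimum is attained. The
-- weight is unchanged and the new colour-2 path does not get shorter; at its length `g` is at least
-- the envelope value at the original length.
from-envelope : ∀ {c g n w} → Build c (lower-envelope c g) n w → Build c g n w
from-envelope nil = nil
from-envelope {c} {g} (join {i₁} {i₂} {w₁} {w₂} B₁ B₂ j₁ j₂ lt₁ lt₂ fr)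
  with lower-envelope-attained c g j₁ lt₁ | lower-envelope-attained c g j₂ lt₂
... | k₁ , le₁ , k₁< , e₁ | k₂ , le₂ , k₂< , e₂ =
  subst (Build c g _) eq (join (from-envelope B₁) (from-envelope B₂) k₁ k₂ k₁< k₂< (free fr))
  where
  eq : suc (w₁ + w₂ + (g k₁ + g k₂)) ≡ suc (w₁ + w₂ + (lower-envelope c g j₁ + lower-envelope c g j₂))
  eq = cong (λ x → suc (w₁ + w₂ + x)) (cong₂ _+_ e₁ e₂)
  b≤ : suc (j₁ + j₂) ≤ suc (k₁ + k₂)
  b≤ = s≤s (+-mono-≤ le₁ le₂)
  free : Free c (suc (j₁ + j₂)) (lower-envelope c g (suc (j₁ + j₂))) _ → Free c (suc (k₁ + k₂)) (g (suc (k₁ + k₂))) _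
  free (inj₁ c≤) = inj₁ (≤-trans c≤ b≤)
  free (inj₂ S<) with c ≤? suc (k₁ + k₂)
  ... | yes c≤ = inj₁ c≤
  ... | no c≰ = inj₂ (≤-trans (s≤s (≤-reflexive eq)) (≤-trans S< (lower-envelope-≤ c g _ _ b≤ (≰⇒> c≰))))

-- Entries of `h` that differ from `g` exceed `U`, so a tree of weight at most `U` has no such arm.
-- They occur only as thresholds, and raising a threshold keeps a join admissible.
uncap : ∀ {c g h n w} U → (∀ j → j < c → h j ≤ g j) → (∀ j → j < c → h j ≤ U → g j ≡ h j) →
        w ≤ U → Build c h n w → Build c g n w
uncap U h≤g same w≤U nil = nil
uncap {c} {g} {h} U h≤g same w≤U (join {i₁} {i₂} {w₁} {w₂} B₁ B₂ j₁ j₂ lt₁ lt₂ fr) =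
  subst (Build c g _) eq (join (uncap U h≤g same w₁≤ B₁) (uncap U h≤g same w₂≤ B₂) j₁ j₂ lt₁ lt₂ (free fr))
  where
  H : ℕ
  H = h j₁ + h j₂
  ww≤ : w₁ + w₂ ≤ U
  ww≤ = ≤-trans (≤-trans (m≤m+n (w₁ + w₂) H) (n≤1+n _)) w≤U
  w₁≤ : w₁ ≤ U
  w₁≤ = ≤-trans (m≤m+n w₁ w₂) ww≤
  w₂≤ : w₂ ≤ U
  w₂≤ = ≤-trans (m≤n+m w₂ w₁) ww≤
  H≤ : H ≤ U
  H≤ = ≤-trans (≤-trans (m≤n+m H (w₁ + w₂)) (n≤1+n _)) w≤U
  e₁ : g j₁ ≡ h j₁
  e₁ = same j₁ lt₁ (≤-trans (m≤m+n _ _) H≤)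
  e₂ : g j₂ ≡ h j₂
  e₂ = same j₂ lt₂ (≤-trans (m≤n+m _ _) H≤)
  eq : suc (w₁ + w₂ + (g j₁ + g j₂)) ≡ suc (w₁ + w₂ + H)
  eq = cong (λ x → suc (w₁ + w₂ + x)) (cong₂ _+_ e₁ e₂)
  free : Free c (suc (j₁ + j₂)) (h (suc (j₁ + j₂))) _ → Free c (suc (j₁ + j₂)) (g (suc (j₁ + j₂))) _
  free (inj₁ c≤) = inj₁ c≤
  free (inj₂ S<) with c ≤? suc (j₁ + j₂)
  ... | yes c≤ = inj₁ c≤
  ... | no c≰ = inj₂ (≤-trans (s≤s (≤-reflexive eq)) (≤-trans S< (h≤g _ (≰⇒> c≰))))

-- A crude bound, decidability and finite maxima

weight-bound : ℕ → ℕ → ℕ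
weight-bound c zero    = 0
weight-bound c (suc n) = c * suc (weight-bound c n)

module _ {c : ℕ} (0<c : 0 < c) {g : ℕ → ℕ} (g0 : g 0 ≡ 0) where

  -- Try the new vertex with a single colour-2 arm of length j = 0, 1, and so on. If the join is not
  -- admissible, then `g (suc j)` is at most its weight, which bounds the price of the next arm. At
  -- j = c - 1 colour 2 would complete P_c.
  lengthen₁ : ∀ {n w} → Build c g n w → ∃ λ w′ → w′ ≤ c * suc w × Build c g (suc n) w′
  lengthen₁ {n} {w} B = search (c ∸ 1) 0 (trans (+-comm (c ∸ 1) 1) (m+[n∸m]≡n 0<c)) (≤-trans (≤-reflexive g0) z≤n)
    where
    search : ∀ k j → k + suc j ≡ c → g j ≤ j * suc w → ∃ λ w′ → w′ ≤ c * suc w × Build c g (suc n) w′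
    search k j e le = go k e
      where
      S : ℕ
      S = suc (w + 0 + (g j + g 0))
      S≡ : S ≡ suc w + g j
      S≡ = cong suc (cong₂ _+_ (+-identityʳ w) (trans (cong (g j +_) g0) (+-identityʳ (g j))))
      j<c : j < c
      j<c = ≤-trans (m≤n+m (suc j) k) (≤-reflexive e)
      S≤ : S ≤ suc j * suc w
      S≤ = ≤-trans (≤-reflexive S≡) (+-monoʳ-≤ (suc w) le)
      done : Free c (suc (j + 0)) (g (suc (j + 0))) S → ∃ λ w′ → w′ ≤ c * suc w × Build c g (suc n) w′
      done fr = S , ≤-trans S≤ (*-monoˡ-≤ (suc w) j<c) ,
                subst (λ x → Build c g (suc x) S) (+-identityʳ n) (join B nil j 0 j<c 0<c fr)
      go : ∀ k → k + suc j ≡ c → ∃ λ w′ → w′ ≤ c * suc w × Build c g (suc n) w′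
      go zero e = done (inj₁ (≤-reflexive (trans (sym e) (cong suc (sym (+-identityʳ j))))))
      go (suc k) e with S <? g (suc j)
      ... | yes S< = done (inj₂ (subst (λ x → S < g (suc x)) (sym (+-identityʳ j)) S<))
      ... | no S≮ = search k (suc j) (trans (+-suc k (suc j)) e) (≤-trans (≮⇒≥ S≮) S≤)

  affordable : ∀ n → ∃ λ w → w ≤ weight-bound c n × Build c g n w
  affordable zero = 0 , z≤n , nil
  affordable (suc n) with affordable n
  ... | w , w≤ , B with lengthen₁ B
  ... | w′ , w′≤ , B′ = w′ , ≤-trans w′≤ (*-monoʳ-≤ c (s≤s w≤)) , B′

-- All parameters of a join are bounded by the length, the weight or `c`, so the search is finite.
-- Decidability makes lightest trees available constructively.
build? : ∀ c g n w → Dec (Build c g n w)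
build? c g = <-rec (λ n → ∀ w → Dec (Build c g n w)) step
  where
  Joined : ∀ m w → Fin (suc m) → Fin (suc w) → Fin (suc w) → Fin c → Fin c → Set
  Joined m w i w₁ w₂ j₁ j₂ =
    Build c g (toℕ i) (toℕ w₁) × Build c g (m ∸ toℕ i) (toℕ w₂) ×
    Free c (suc (toℕ j₁ + toℕ j₂)) (g (suc (toℕ j₁ + toℕ j₂))) w ×
    suc (toℕ w₁ + toℕ w₂ + (g (toℕ j₁) + g (toℕ j₂))) ≡ w

  AnyJoined : ℕ → ℕ → Set
  AnyJoined m w = ∃ λ i → ∃ λ w₁ → ∃ λ w₂ → ∃ λ j₁ → ∃ λ j₂ → Joined m w i w₁ w₂ j₁ j₂

  to : ∀ {m w} → AnyJoined m w → Build c g (suc m) w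
  to {m} (i , w₁ , w₂ , j₁ , j₂ , B₁ , B₂ , fr , e) =
    subst (Build c g (suc m)) e
    (subst (λ x → Build c g (suc x) _) (m+[n∸m]≡n (s≤s⁻¹ (toℕ<n i)))
      (join B₁ B₂ (toℕ j₁) (toℕ j₂) (toℕ<n j₁) (toℕ<n j₂) (free-≤ (≤-reflexive e) fr)))

  joined : ∀ m w i w₁ w₂ j₁ j₂ (i< : i < suc m) (w₁< : w₁ < suc w) (w₂< : w₂ < suc w) (j₁< : j₁ < c) (j₂< : j₂ < c) →
           Build c g i w₁ → Build c g (m ∸ i) w₂ → Free c (suc (j₁ + j₂)) (g (suc (j₁ + j₂))) w →
           suc (w₁ + w₂ + (g j₁ + g j₂)) ≡ w →
           Joined m w (fromℕ< i<) (fromℕ< w₁<) (fromℕ< w₂<) (fromℕ< j₁<) (fromℕ< j₂<)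
  joined m w i w₁ w₂ j₁ j₂ i< w₁< w₂< j₁< j₂< B₁ B₂ fr e
    rewrite toℕ-fromℕ< i< | toℕ-fromℕ< w₁< | toℕ-fromℕ< w₂< | toℕ-fromℕ< j₁< | toℕ-fromℕ< j₂< = B₁ , B₂ , fr , e

  from : ∀ {m w} → Build c g (suc m) w → AnyJoined m w
  from (join {i₁} {i₂} {w₁} {w₂} B₁ B₂ j₁ j₂ lt₁ lt₂ fr) =
    _ , _ , _ , _ , _ ,
    joined (i₁ + i₂) _ i₁ w₁ w₂ j₁ j₂ (s≤s (m≤m+n i₁ i₂))
      (s≤s (≤-trans (m≤m+n w₁ w₂) le)) (s≤s (≤-trans (m≤n+m w₂ w₁) le)) lt₁ lt₂
      B₁ (subst (λ x → Build c g x w₂) (sym (m+n∸m≡n i₁ i₂)) B₂) fr refl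
    where le : w₁ + w₂ ≤ suc (w₁ + w₂ + (g j₁ + g j₂))
          le = ≤-trans (m≤m+n _ _) (n≤1+n _)

  step : ∀ n → (∀ {m} → m < n → ∀ w → Dec (Build c g m w)) → ∀ w → Dec (Build c g n w)
  step zero _ zero = yes nil
  step zero _ (suc w) = no λ ()
  step (suc m) rec w = map′ to from
    (any? λ i → any? λ w₁ → any? λ w₂ → any? λ j₁ → any? λ j₂ →
      rec (toℕ<n i) (toℕ w₁) ×-dec rec (s≤s (m∸n≤m m (toℕ i))) (toℕ w₂) ×-dec
      ((c ≤? _) ⊎-dec (w <? _)) ×-dec (_ ≟ w))

least : ∀ (P : ℕ → Set) → (∀ n → Dec (P n)) → ∀ b → P b → ∃ λ n → P n × (∀ m → P m → n ≤ m)
least P P? zero p = 0 , p , λ _ _ → z≤n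
least P P? (suc b) p with P? 0
... | yes p₀ = 0 , p₀ , λ _ _ → z≤n
... | no ¬p₀ with least (λ n → P (suc n)) (λ n → P? (suc n)) b p
... | n , pn , min = suc n , pn , λ { zero q → ⊥-elim (¬p₀ q) ; (suc m) q → s≤s (min m q) }

argmax-Fin : ∀ {m} (F : Fin (suc m) → ℕ) → ∃ λ i → ∀ j → F j ≤ F i
argmax-Fin {zero} F = zero , λ { zero → ≤-refl }
argmax-Fin {suc m} F with argmax-Fin (λ i → F (suc i))
... | i , max with ≤-total (F zero) (F (suc i))
... | inj₁ le = suc i , λ { zero → le ; (suc j) → max j }
... | inj₂ ge = zero , λ { zero → ≤-refl ; (suc j) → ≤-trans (max j) ge }

argmax-Vec : ∀ {m} k (F : Vec (Fin (suc m)) k → ℕ) → ∃ λ v → ∀ u → F u ≤ F v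
argmax-Vec zero F = [] , λ { [] → ≤-refl }
argmax-Vec {m} (suc k) F with argmax-Fin (λ i → F (i ∷ proj₁ (argmax-Vec k (λ u → F (i ∷ u)))))
... | i , max = i ∷ proj₁ (argmax-Vec k (λ u → F (i ∷ u))) ,
  λ { (j ∷ u) → ≤-trans (proj₂ (argmax-Vec k (λ u → F (j ∷ u))) u) (max j) }

table : ∀ {m k} → Vec (Fin m) k → ℕ → ℕ
table []      _       = 0
table (i ∷ _) zero    = toℕ i
table (_ ∷ v) (suc j) = table v j

tabulated : ∀ {m} (f : ℕ → ℕ) → (∀ j → f j < m) → ∀ k → ∃ λ (v : Vec (Fin m) k) → ∀ j → j < k → table v j ≡ f j
tabulated f f< zero = [] , λ _ ()
tabulated f f< (suc k) with tabulated (λ j → f (suc j)) (λ j → f< (suc j)) k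
... | v , eq = fromℕ< (f< 0) ∷ v , λ { zero _ → toℕ-fromℕ< (f< 0) ; (suc j) (s≤s lt) → eq j lt }

cost : (ℕ → ℕ) → ℕ → ℕ
cost f zero    = 0
cost f (suc j) = f j

-- Optimal painters for a fixed length

-- The minimax of the recursion at length `n`, together with a cost function at which the maximum is
-- attained.
record Window (c n : ℕ) : Set where
  field
    value     : ℕ
    forceable : ∀ g → g 0 ≡ 0 → ∃ λ w → w ≤ value × Build c g n w
    painter   : ℕ → ℕ
    painter₀  : painter 0 ≡ 0
    necessary : ∀ w → Build c painter n w → value ≤ w

lightest : ∀ {c} → 0 < c → ∀ {g} → g 0 ≡ 0 → ∀ n →
           ∃ λ w → Build c g n w × (∀ w′ → Build c g n w′ → w ≤ w′)
lightest {c} 0<c {g} g0 n with affordable 0<c g0 n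
... | b , _ , B = least _ (build? c g n) b B

abstract
  -- Costs above `weight-bound c n` are all equally out of reach, so they may be cut off at one more
  -- than this bound. Only finitely many tables of costs remain, and the best of them exists.
  window : ∀ c n → 0 < c → Window c n
  window c n 0<c = record
    { value     = best v
    ; forceable = forceable
    ; painter   = cost (table v)
    ; painter₀  = refl
    ; necessary = proj₂ (proj₂ (lightest 0<c refl n))
    }
    where
    U : ℕ
    U = weight-bound c n
    best : Vec (Fin (suc (suc U))) c → ℕ
    best v = proj₁ (lightest 0<c {cost (table v)} refl n)
    v : Vec (Fin (suc (suc U))) c
    v = proj₁ (argmax-Vec c best)
    forceable : ∀ g → g 0 ≡ 0 → ∃ λ w → w ≤ best v × Build c g n w
    forceable g g0 with tabulated (λ j → g (suc j) ⊓ suc U) (λ j → s≤s (m⊓n≤n _ _)) c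
    ... | u , eq with lightest 0<c {cost (table u)} refl n in e
    ... | w , B , min = w , ≤-trans (≤-reflexive (cong proj₁ (sym e))) (proj₂ (argmax-Vec c best) u) ,
          uncap U below same w≤U B
      where
      w≤U : w ≤ U
      w≤U with affordable 0<c {cost (table u)} refl n
      ... | b , b≤ , Bb = ≤-trans (min b Bb) b≤
      below : ∀ j → j < c → cost (table u) j ≤ g j
      below zero _ = z≤n
      below (suc j) j< = ≤-trans (≤-reflexive (eq j (<⇒≤ j<))) (m⊓n≤m _ _)
      same : ∀ j → j < c → cost (table u) j ≤ U → g j ≡ cost (table u) j
      same zero _ _ = g0
      same (suc j) j< le with ⊓-sel (g (suc j)) (suc U)
      ... | inj₁ e = sym (trans (eq j (<⇒≤ j<)) e)
      ... | inj₂ e = ⊥-elim (1+n≰n (≤-trans (≤-reflexive (sym (trans (eq j (<⇒≤ j<)) e))) le))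

-- Coarse-graining

m<[1+m/n]*n : ∀ m n .{{_ : NonZero n}} → m < suc (m / n) * n
m<[1+m/n]*n m n = ≤-<-trans (≤-reflexive (m≡m%n+[m/n]*n m n)) (+-monoˡ-< (m / n * n) (m%n<n m n))

-- The weight only grows along the chain, so admissibility at the final weight covers every join in
-- it.
chain : ∀ {c g m w} → Build c g m w → ∀ j₁ j₂ → j₁ < c → j₂ < c → ∀ i →
        Free c (suc (j₁ + j₂)) (g (suc (j₁ + j₂))) (w + i * suc (w + (g j₁ + g j₂))) →
        Build c g (m + i * suc m) (w + i * suc (w + (g j₁ + g j₂)))
chain {c} {g} {m} {w} B j₁ j₂ lt₁ lt₂ zero fr =
  subst₂ (Build c g) (sym (+-identityʳ m)) (sym (+-identityʳ w)) B
chain {c} {g} {m} {w} B j₁ j₂ lt₁ lt₂ (suc i) fr =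
  subst₂ (Build c g) (sym (+-suc m (m + i * suc m))) e
    (join B (chain B j₁ j₂ lt₁ lt₂ i (free-≤ le fr)) j₁ j₂ lt₁ lt₂ (free-≤ (≤-reflexive e) fr))
  where
  G : ℕ
  G = g j₁ + g j₂
  e : suc (w + (w + i * suc (w + G)) + G) ≡ w + suc i * suc (w + G)
  e = eq w i G
    where eq : ∀ w i G → suc (w + (w + i * suc (w + G)) + G) ≡ w + suc i * suc (w + G)
          eq = solve-∀
  le : w + i * suc (w + G) ≤ w + suc i * suc (w + G)
  le = +-monoʳ-≤ w (m≤n+m _ _)

-- There are `suc i` blocks of `m` vertices with `i` joining vertices between them. Fixing the
-- number of blocks before their size keeps the blocks within `L` vertices in total, while the
-- joining vertices bring the chain to length at least `L`.
even-split : ∀ L m₀ → 0 < m₀ → ∃ λ i → ∃ λ m →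
             suc L ≤ suc i * suc m × suc i * m ≤ L × m < m₀ × i * m₀ ≤ suc L
even-split L m₀ 0<m₀ = i , m , upper , lower , *-cancelˡ-< (suc i) m m₀ (≤-<-trans lower short) , m/n*n≤m (suc L) m₀
  where
  instance
    _ = >-nonZero 0<m₀
  i m : ℕ
  i = suc L / m₀
  m = L / suc i
  lower : suc i * m ≤ L
  lower = ≤-trans (≤-reflexive (*-comm (suc i) m)) (m/n*n≤m L (suc i))
  upper : suc L ≤ suc i * suc m
  upper = ≤-trans (m<[1+m/n]*n L (suc i)) (≤-reflexive (*-comm (suc m) (suc i)))
  short : L < suc i * m₀
  short = <-trans (n<1+n L) (m<[1+m/n]*n (suc L) m₀)

-- Cutting a path into equal blocks avoids the loss of a whole incomplete block.
blocks : ∀ {c g} D N L m₀ j₁ j₂ → 0 < m₀ → j₁ < c → j₂ < c →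
         (∀ m → m < m₀ → ∃ λ w → Build c g m w × D * w ≤ N * m) →
         (∀ W i → i * m₀ ≤ suc L → D * W ≤ N * L + D * (i * suc (g j₁ + g j₂)) →
           Free c (suc (j₁ + j₂)) (g (suc (j₁ + j₂))) W) →
         ∃ λ W → ∃ λ i → Build c g L W × i * m₀ ≤ suc L × D * W ≤ N * L + D * (i * suc (g j₁ + g j₂))
blocks {c} {g} D N L m₀ j₁ j₂ 0<m₀ lt₁ lt₂ block free with even-split L m₀ 0<m₀
... | i , m , upper , lower , m<m₀ , i≤ with block m m<m₀
... | w , B , Dw≤ = assemble (shorten (s≤s⁻¹ upper) (chain B j₁ j₂ lt₁ lt₂ i (free W i i≤ W≤)))
  where
  G W : ℕ
  G = g j₁ + g j₂
  W = w + i * suc (w + G)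
  W≤ : D * W ≤ N * L + D * (i * suc G)
  W≤ = ≤-trans (≤-reflexive (eq D w i G))
       (+-monoˡ-≤ (D * (i * suc G))
         (≤-trans (*-monoʳ-≤ (suc i) Dw≤)
         (≤-trans (≤-reflexive (eq₂ i N m)) (*-monoʳ-≤ N lower))))
    where eq : ∀ D w i G → D * (w + i * suc (w + G)) ≡ suc i * (D * w) + D * (i * suc G)
          eq = solve-∀
          eq₂ : ∀ i N m → suc i * (N * m) ≡ N * (suc i * m)
          eq₂ = solve-∀
  assemble : (∃ λ W′ → W′ ≤ W × Build c g L W′) → _
  assemble (W′ , W′≤ , B′) = W′ , i , B′ , i≤ , ≤-trans (*-monoʳ-≤ D W′≤) W≤

-- Here `g` is the painter for the long path, with the gap after `b₀`, and `o` a nearly optimal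
-- painter for the path on `suc b₀` vertices, of slope a/d up to the defect `Γ`. Lengths are
-- multiplied by Q u and weights by `ρ`, that is (Q + 1) u, a loss of the factor 1 + 1/Q.
module Coarsening
  (c b₀ : ℕ) (b₀+1<c : suc b₀ < c)
  (g : ℕ → ℕ) (g0 : g 0 ≡ 0) (g-mono : ∀ j j′ → j ≤ j′ → j′ < c → g j ≤ g j′)
  (o : ℕ → ℕ) (o0 : o 0 ≡ 0) (a d Γ Q u A m₀ : ℕ)
  (0<d : 0 < d) (0<Q : 0 < Q) (0<u : 0 < u) (0<m₀ : 0 < m₀)
  (o≤Γ : ∀ j → j < suc b₀ → o j ≤ Γ)
  (upper : ∀ m → ∃ λ w → Build (suc b₀) g m w × (4 * Q * d) * w ≤ (4 * Q + 1) * a * m)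
  (lower : ∀ {n w} → Build (suc b₀) o n w → a * n ≤ d * (w + Γ))
  where

  H ρ err Θ σ : ℕ
  H = Γ + a
  ρ = (Q + 1) * u
  err = (2 * Q + 1) * u * H
  Θ = g (suc b₀)
  σ = g b₀

  instance
    ρ-nonZero : NonZero ρ
    ρ-nonZero = m*n≢0 (Q + 1) u {{>-nonZero (≤-trans 0<Q (m≤m+n Q 1))}} {{>-nonZero 0<u}}

  0<ρ : 0 < ρ
  0<ρ = >-nonZero⁻¹ ρ

  -- The surplus A * (c ∸ j) decreases in j: an expensive colour-2 part pays A more than the
  -- threshold loses, which absorbs the error 2 * err + σ of one join.
  coarse′ : ∀ j → Dec (j ≤ b₀) → ℕ
  coarse′ j (yes _) = o j
  coarse′ j (no _)  = suc (g j / ρ + A * (c ∸ j))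

  coarse : ℕ → ℕ
  coarse j = coarse′ j (j ≤? b₀)

  coarse-small : ∀ j → j ≤ b₀ → coarse j ≡ o j
  coarse-small j le with j ≤? b₀
  ... | yes _ = refl
  ... | no nle = ⊥-elim (nle le)

  coarse-large : ∀ j → b₀ < j → coarse j ≡ suc (g j / ρ + A * (c ∸ j))
  coarse-large j lt with j ≤? b₀
  ... | yes le = ⊥-elim (<⇒≱ lt le)
  ... | no _ = refl

  module _
    -- In turn: one step of surplus covers the errors of a join; the surplus exceeds every entry of
    -- `o`; the costs above the gap dwarf all error terms; blocks shorter than `m₀` weigh less than
    -- `Θ`; a join between blocks costs at most a fraction 1/(4Q) of a m₀/d.
    (hA : 2 * err + σ ≤ ρ * A) (H≤A : H ≤ A)
    (hΘ : (2 * Q + 1) * (ρ * (c * A + H)) < Θ)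
    (hm : 2 * a * m₀ < d * Θ) (hσ : 4 * Q * d * (1 + 2 * σ) ≤ a * m₀)
    where

    private
      instance
        d-nonZero : NonZero d
        d-nonZero = >-nonZero 0<d

      b₀<c : b₀ < c
      b₀<c = <⇒≤ b₀+1<c

      0<c : 0 < c
      0<c = ≤-trans (s≤s z≤n) b₀<c

      Γ≤A : Γ ≤ A
      Γ≤A = ≤-trans (m≤m+n Γ a) H≤A

    A≤coarse : ∀ j → b₀ < j → j < c → A ≤ coarse j
    A≤coarse j lt j<c = ≤-trans (≤-trans (≤-trans (≤-reflexive (sym (*-identityʳ A))) (*-monoʳ-≤ A (m<n⇒0<n∸m j<c)))
      (≤-trans (m≤n+m _ (g j / ρ)) (n≤1+n _))) (≤-reflexive (sym (coarse-large j lt)))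

    -- An arm above the gap costs at least `A`, hence no less than an arm on `b₀` vertices does
    -- under `o`, and the latter already completes the path of the base game. A coarse tree is
    -- therefore no lighter than some base tree of the same length, and `lower` applies to it.
    to-base : ∀ {n w} → Build c coarse n w → ∃ λ v → v ≤ w × Build (suc b₀) o n v
    to-base nil = 0 , z≤n , nil
    to-base {suc n} {w} (join {i₁} {i₂} {w₁} {w₂} B₁ B₂ j₁ j₂ lt₁ lt₂ fr) =
      choose (to-base B₁) (to-base B₂) (j₁ ≤? b₀) (j₂ ≤? b₀)
      where
      Base : ℕ → ℕ → Set
      Base n w = ∃ λ v → v ≤ w × Build (suc b₀) o n v

      cheapest : ∀ j → b₀ < j → j < c → o b₀ + o 0 ≤ coarse j
      cheapest j l j<c = ≤-trans (≤-reflexive (trans (cong (o b₀ +_) o0) (+-identityʳ _)))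
        (≤-trans (o≤Γ b₀ ≤-refl) (≤-trans Γ≤A (A≤coarse j l j<c)))

      replace : o b₀ + o 0 ≤ coarse j₁ + coarse j₂ → Base i₁ w₁ → Base i₂ w₂ → Base (suc n) w
      replace le (_ , le₁ , C₁) (_ , le₂ , C₂) =
        _ , s≤s (+-mono-≤ (+-mono-≤ le₁ le₂) le) ,
        join C₁ C₂ b₀ 0 ≤-refl (s≤s z≤n) (inj₁ (s≤s (m≤m+n b₀ 0)))

      choose : Base i₁ w₁ → Base i₂ w₂ → Dec (j₁ ≤ b₀) → Dec (j₂ ≤ b₀) → Base (suc n) w
      choose C₁ C₂ (no l₁) _ = replace (≤-trans (cheapest j₁ (≰⇒> l₁) lt₁) (m≤m+n _ _)) C₁ C₂
      choose C₁ C₂ (yes _) (no l₂) = replace (≤-trans (cheapest j₂ (≰⇒> l₂) lt₂) (m≤n+m _ _)) C₁ C₂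
      choose (v₁ , le₁ , C₁) (v₂ , le₂ , C₂) (yes s₁) (yes s₂) =
        _ , S≤ , join C₁ C₂ j₁ j₂ (s≤s s₁) (s≤s s₂) (free (suc (j₁ + j₂) ≤? b₀) fr)
        where
        S≤ : suc (v₁ + v₂ + (o j₁ + o j₂)) ≤ w
        S≤ = s≤s (+-mono-≤ (+-mono-≤ le₁ le₂) (≤-reflexive (sym (cong₂ _+_ (coarse-small j₁ s₁) (coarse-small j₂ s₂)))))
        free : Dec (suc (j₁ + j₂) ≤ b₀) → Free c (suc (j₁ + j₂)) (coarse (suc (j₁ + j₂))) w →
               Free (suc b₀) (suc (j₁ + j₂)) (o (suc (j₁ + j₂))) (suc (v₁ + v₂ + (o j₁ + o j₂)))
        free (no big) _ = inj₁ (≰⇒> big)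
        free (yes small) (inj₁ c≤) = ⊥-elim (<⇒≱ (≤-<-trans small b₀<c) c≤)
        free (yes small) (inj₂ S<) = inj₂ (≤-<-trans S≤ (<-≤-trans S< (≤-reflexive (coarse-small _ small))))

    -- Below weight `Θ` every colour-2 path on more than `b₀` vertices is lighter than the
    -- nondecreasing `g` announces, so what completes the path in the base game is still admissible
    -- here.
    from-base : ∀ {n w} → w < Θ → Build (suc b₀) g n w → Build c g n w
    from-base w<Θ nil = nil
    from-base w<Θ (join {i₁} {i₂} {w₁} {w₂} B₁ B₂ j₁ j₂ lt₁ lt₂ fr) =
      join (from-base (≤-<-trans le₁ w<Θ) B₁) (from-base (≤-<-trans le₂ w<Θ) B₂) j₁ j₂
        (<-trans lt₁ b₀+1<c) (<-trans lt₂ b₀+1<c) (free fr)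
      where
      le : w₁ + w₂ ≤ suc (w₁ + w₂ + (g j₁ + g j₂))
      le = ≤-trans (m≤m+n _ _) (n≤1+n _)
      le₁ : w₁ ≤ suc (w₁ + w₂ + (g j₁ + g j₂))
      le₁ = ≤-trans (m≤m+n _ _) le
      le₂ : w₂ ≤ suc (w₁ + w₂ + (g j₁ + g j₂))
      le₂ = ≤-trans (m≤n+m _ _) le
      free : Free (suc b₀) (suc (j₁ + j₂)) (g (suc (j₁ + j₂))) _ → Free c (suc (j₁ + j₂)) (g (suc (j₁ + j₂))) _
      free (inj₂ S<) = inj₂ S<
      free (inj₁ b₀<) with c ≤? suc (j₁ + j₂)
      ... | yes c≤ = inj₁ c≤
      ... | no c≰ = inj₂ (≤-trans w<Θ (g-mono _ _ b₀< (≰⇒> c≰)))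

    short-block : ∀ m → m < m₀ → ∃ λ w → Build c g m w × (4 * Q * d) * w ≤ (4 * Q + 1) * a * m
    short-block m m<m₀ with upper m
    ... | w , B , le = w , from-base w<Θ B , le
      where
      w<Θ : w < Θ
      w<Θ = *-cancelˡ-< (4 * Q * d) w Θ
        (≤-<-trans le (≤-<-trans (*-monoʳ-≤ ((4 * Q + 1) * a) (<⇒≤ m<m₀))
          (≤-<-trans (≤-trans (*-monoˡ-≤ m₀ (*-monoˡ-≤ a (+-monoʳ-≤ (4 * Q) (≤-trans 0<Q (m≤n*m Q 4)))))
             (≤-reflexive (eq Q a m₀)))
          (<-≤-trans (*-monoʳ-< (4 * Q) {{m*n≢0 4 Q {{_}} {{>-nonZero 0<Q}}}} hm) (≤-reflexive (eq₂ Q d Θ))))))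
        where
        eq : ∀ Q a m → (4 * Q + 4 * Q) * a * m ≡ 4 * Q * (2 * a * m)
        eq = solve-∀
        eq₂ : ∀ Q d Θ → 4 * Q * (d * Θ) ≡ 4 * Q * d * Θ
        eq₂ = solve-∀

    -- The blocks lose the factor 1 + 1/(4Q) on the slope a/d and the joins another 1/(4Q). With L +
    -- 1 = Q u (n + 1) this makes (Q + 1/2) u per unit of coarse weight; the half missing to `ρ` is
    -- spent in `roomy`.
    density : ∀ {n W v i L G} → G ≤ 2 * σ → suc L ≡ Q * u * suc n → i * m₀ ≤ suc L →
              a * n ≤ d * (v + Γ) →
              (4 * Q * d) * W ≤ (4 * Q + 1) * a * L + (4 * Q * d) * (i * suc G) →
              2 * W ≤ (2 * Q + 1) * u * (v + H)
    density {n} {W} {v} {i} {L} {G} G≤ eL i≤ an≤ le = *-cancelˡ-≤ (2 * Q * d) {{nz}} (begin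
      2 * Q * d * (2 * W)                              ≡⟨ e₁ Q d W ⟩
      4 * Q * d * W                                    ≤⟨ le ⟩
      (4 * Q + 1) * a * L + 4 * Q * d * (i * suc G)    ≤⟨ +-mono-≤ (*-monoʳ-≤ ((4 * Q + 1) * a) (n≤1+n L)) joins ⟩
      (4 * Q + 1) * a * suc L + a * suc L              ≡⟨ cong (λ x → (4 * Q + 1) * a * x + a * x) eL ⟩
      (4 * Q + 1) * a * (Q * u * suc n) + a * (Q * u * suc n) ≡⟨ e₂ Q a u n ⟩
      2 * Q * ((2 * Q + 1) * u) * (a * n + 1 * a)      ≤⟨ *-monoʳ-≤ (2 * Q * ((2 * Q + 1) * u)) (+-mono-≤ an≤ (*-monoˡ-≤ a 0<d)) ⟩
      2 * Q * ((2 * Q + 1) * u) * (d * (v + Γ) + d * a) ≡⟨ e₃ Q u d v Γ a ⟩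
      2 * Q * d * ((2 * Q + 1) * u * (v + (Γ + a)))    ∎)
      where
      open ≤-Reasoning
      nz : NonZero (2 * Q * d)
      nz = m*n≢0 (2 * Q) d {{m*n≢0 2 Q {{_}} {{>-nonZero 0<Q}}}}
      e₁ : ∀ Q d W → 2 * Q * d * (2 * W) ≡ 4 * Q * d * W
      e₁ = solve-∀
      e₂ : ∀ Q a u n → (4 * Q + 1) * a * (Q * u * suc n) + a * (Q * u * suc n) ≡ 2 * Q * ((2 * Q + 1) * u) * (a * n + 1 * a)
      e₂ = solve-∀
      e₃ : ∀ Q u d v Γ a → 2 * Q * ((2 * Q + 1) * u) * (d * (v + Γ) + d * a) ≡ 2 * Q * d * ((2 * Q + 1) * u * (v + (Γ + a)))
      e₃ = solve-∀
      e₄ : ∀ Q d i x → 4 * Q * d * (i * x) ≡ i * (4 * Q * d * x)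
      e₄ = solve-∀
      e₅ : ∀ i a m → i * (a * m) ≡ a * (i * m)
      e₅ = solve-∀
      joins : 4 * Q * d * (i * suc G) ≤ a * suc L
      joins = begin
        4 * Q * d * (i * suc G)         ≡⟨ e₄ Q d i (suc G) ⟩
        i * (4 * Q * d * suc G)         ≤⟨ *-monoʳ-≤ i (*-monoʳ-≤ (4 * Q * d) (s≤s G≤)) ⟩
        i * (4 * Q * d * (1 + 2 * σ))   ≤⟨ *-monoʳ-≤ i hσ ⟩
        i * (a * m₀)                    ≡⟨ e₅ i a m₀ ⟩
        a * (i * m₀)                    ≤⟨ *-monoʳ-≤ a i≤ ⟩
        a * suc L                       ∎

    -- A join with two cheap colour-2 parts is too cheap to absorb the errors made in its
    -- subtrees, so here the path is rebuilt from equal blocks.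
    rebuild : ∀ {n v L} j₁ j₂ → j₁ ≤ b₀ → j₂ ≤ b₀ → suc L ≡ Q * u * suc n → Build c coarse n v →
              c ≤ suc (j₁ + j₂) ⊎ (2 * Q + 1) * (ρ * v + ρ * H) < 2 * (Q + 1) * g (suc (j₁ + j₂)) →
              ∃ λ w → w ≤ ρ * v + err × Build c g L w
    rebuild {n} {v} {L} j₁ j₂ s₁ s₂ eL B room =
      finish (blocks (4 * Q * d) ((4 * Q + 1) * a) L m₀ j₁ j₂ 0<m₀ (≤-<-trans s₁ b₀<c) (≤-<-trans s₂ b₀<c) short-block
             (λ W i i≤ le → free W room (light W i i≤ le)))
      where
      an≤′ : (∃ λ v′ → v′ ≤ v × Build (suc b₀) o n v′) → a * n ≤ d * (v + Γ)
      an≤′ (v′ , v′≤ , B′) = ≤-trans (lower B′) (*-monoʳ-≤ d (+-monoˡ-≤ Γ v′≤))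
      G≤ : g j₁ + g j₂ ≤ 2 * σ
      G≤ = +-mono-≤ (g-mono j₁ b₀ s₁ b₀<c) (≤-trans (g-mono j₂ b₀ s₂ b₀<c) (≤-reflexive (sym (+-identityʳ _))))
      light : ∀ W i → i * m₀ ≤ suc L → (4 * Q * d) * W ≤ (4 * Q + 1) * a * L + (4 * Q * d) * (i * suc (g j₁ + g j₂)) →
              2 * W ≤ (2 * Q + 1) * u * (v + H)
      light W i i≤ le = density {n} {W} {v} {i} G≤ eL i≤ (an≤′ (to-base B)) le
      free : ∀ W → c ≤ suc (j₁ + j₂) ⊎ (2 * Q + 1) * (ρ * v + ρ * H) < 2 * (Q + 1) * g (suc (j₁ + j₂)) →
             2 * W ≤ (2 * Q + 1) * u * (v + H) → Free c (suc (j₁ + j₂)) (g (suc (j₁ + j₂))) W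
      free W (inj₁ c≤) le = inj₁ c≤
      free W (inj₂ lt) le = inj₂ (*-cancelˡ-< (2 * (Q + 1)) W _ (≤-<-trans (≤-trans (≤-reflexive (e₁ Q W))
         (≤-trans (*-monoʳ-≤ (Q + 1) le) (≤-reflexive (e₂ Q u v H)))) lt))
        where
        e₁ : ∀ Q W → 2 * (Q + 1) * W ≡ (Q + 1) * (2 * W)
        e₁ = solve-∀
        e₂ : ∀ Q u v H → (Q + 1) * ((2 * Q + 1) * u * (v + H)) ≡ (2 * Q + 1) * ((Q + 1) * u * v + (Q + 1) * u * H)
        e₂ = solve-∀
      W≤ : ∀ W → 2 * W ≤ (2 * Q + 1) * u * (v + H) → W ≤ ρ * v + err
      W≤ W le = *-cancelˡ-≤ 2 (≤-trans le (≤-trans (m≤m+n _ (u * v + (2 * Q + 1) * u * H)) (≤-reflexive (e Q u v H))))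
        where
        e : ∀ Q u v H → (2 * Q + 1) * u * (v + H) + (u * v + (2 * Q + 1) * u * H) ≡ 2 * ((Q + 1) * u * v + (2 * Q + 1) * u * H)
        e = solve-∀
      finish : (∃ λ W → ∃ λ i → Build c g L W × i * m₀ ≤ suc L ×
                 (4 * Q * d) * W ≤ (4 * Q + 1) * a * L + (4 * Q * d) * (i * suc (g j₁ + g j₂))) →
               ∃ λ w → w ≤ ρ * v + err × Build c g L w
      finish (W , i , C , i≤ , le) = W , W≤ W (light W i i≤ le) , C

    -- The `suc` in `coarse′` rounds up when the cost is paid as an arm. As a threshold it is taken
    -- off by the strict inequality, see `coarse-threshold`, so both directions carry the same
    -- surplus.
    coarse-cost-large : ∀ j → b₀ < j → g j + ρ * (A * (c ∸ j)) < ρ * coarse j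
    coarse-cost-large j l = <-≤-trans (+-monoˡ-< (ρ * (A * (c ∸ j))) (m<[1+m/n]*n (g j) ρ))
      (≤-reflexive (trans (e (g j / ρ) ρ (A * (c ∸ j))) (cong (ρ *_) (sym (coarse-large j l)))))
      where
      e : ∀ x ρ y → suc x * ρ + ρ * y ≡ ρ * suc (x + y)
      e = solve-∀

    coarse-cost : ∀ j → j < c → g j ≤ ρ * coarse j + σ
    coarse-cost j j<c = case (j ≤? b₀)
      where
      case : Dec (j ≤ b₀) → g j ≤ ρ * coarse j + σ
      case (yes s) = ≤-trans (g-mono j b₀ s b₀<c) (m≤n+m σ _)
      case (no l) = ≤-trans (m≤m+n (g j) _) (≤-trans (<⇒≤ (coarse-cost-large j (≰⇒> l))) (m≤m+n _ σ))

    coarse-threshold : ∀ b v → b₀ < b → v < coarse b → ρ * v ≤ g b + ρ * (A * (c ∸ b))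
    coarse-threshold b v l v< = ≤-trans (*-monoʳ-≤ ρ (s≤s⁻¹ (≤-trans v< (≤-reflexive (coarse-large b l)))))
      (≤-trans (≤-reflexive (*-distribˡ-+ ρ (g b / ρ) _)) (+-monoˡ-≤ _ (≤-trans (≤-reflexive (*-comm ρ (g b / ρ))) (m/n*n≤m (g b) ρ))))

    private
      -- Passing from `j` to `suc j` releases one `A` of surplus. By `hA` it covers `err` from each
      -- subtree and `σ` from the other arm.
      expensive : ∀ {w₁ w₂ v₁ v₂ G G′ j} → j < c → w₁ ≤ ρ * v₁ + err → w₂ ≤ ρ * v₂ + err →
                  G + ρ * (A * (c ∸ j)) < ρ * G′ + σ →
                  suc (w₁ + w₂ + G) + ρ * (A * (c ∸ suc j)) < ρ * suc (v₁ + v₂ + G′)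
      expensive {w₁} {w₂} {v₁} {v₂} {G} {G′} {j} j<c le₁ le₂ lt = +-cancelʳ-< (ρ * A) _ _ (begin-strict
        suc (w₁ + w₂ + G) + ρ * (A * x) + ρ * A      ≡⟨ e₁ w₁ w₂ G ρ A x ⟩
        suc (w₁ + w₂) + (G + ρ * (A * suc x))        ≡⟨ cong (λ y → suc (w₁ + w₂) + (G + ρ * (A * y))) (sym (+-∸-assoc 1 j<c)) ⟩
        suc (w₁ + w₂) + (G + ρ * (A * (c ∸ j)))      <⟨ +-monoʳ-< (suc (w₁ + w₂)) lt ⟩
        suc (w₁ + w₂) + (ρ * G′ + σ)                 ≤⟨ +-monoˡ-≤ (ρ * G′ + σ) (+-mono-≤ 0<ρ (+-mono-≤ le₁ le₂)) ⟩
        ρ + (ρ * v₁ + err + (ρ * v₂ + err)) + (ρ * G′ + σ) ≡⟨ e₂ ρ v₁ v₂ err G′ σ ⟩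
        ρ * suc (v₁ + v₂ + G′) + (2 * err + σ)       ≤⟨ +-monoʳ-≤ _ hA ⟩
        ρ * suc (v₁ + v₂ + G′) + ρ * A               ∎)
        where
        open ≤-Reasoning
        x : ℕ
        x = c ∸ suc j
        e₁ : ∀ w₁ w₂ G ρ A x → suc (w₁ + w₂ + G) + ρ * (A * x) + ρ * A ≡ suc (w₁ + w₂) + (G + ρ * (A * suc x))
        e₁ = solve-∀
        e₂ : ∀ ρ v₁ v₂ e G σ → ρ + (ρ * v₁ + e + (ρ * v₂ + e)) + (ρ * G + σ) ≡ ρ * suc (v₁ + v₂ + G) + (2 * e + σ)
        e₂ = solve-∀

      split-length : ∀ s i → 0 < s → ∃ λ L → suc L ≡ s * suc i
      split-length (suc s) i _ = _ , refl

      0<s : 0 < Q * u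
      0<s = *-mono-< 0<Q 0<u

    -- A join with an arm above the gap is kept and its subtrees are refined: their values of
    -- `suc L` add up to that of the whole. All other joins are rebuilt from blocks, without
    -- recursion, so their errors do not accumulate.
    refine : ∀ {n v} → Build c coarse n v → ∀ L → suc L ≡ Q * u * suc n → ∃ λ w → w ≤ ρ * v + err × Build c g L w
    refine′ : ∀ {n v} → Build c coarse n v → v ≤ A → ∀ L → suc L ≡ Q * u * suc n → ∃ λ w → w ≤ ρ * v + err × Build c g L w
    -- Light trees are rebuilt with a single colour-2 arm on `b₀` vertices; the threshold is then
    -- `Θ`, and `hΘ` leaves enough room below it.
    refine′ {n} {v} B v≤A L eL = rebuild b₀ 0 ≤-refl z≤n eL B (inj₂ (begin-strict
        (2 * Q + 1) * (ρ * v + ρ * H)       ≡⟨ cong ((2 * Q + 1) *_) (sym (*-distribˡ-+ ρ v H)) ⟩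
        (2 * Q + 1) * (ρ * (v + H))         ≤⟨ *-monoʳ-≤ (2 * Q + 1) (*-monoʳ-≤ ρ (+-monoˡ-≤ H (≤-trans v≤A (m≤n*m A c {{>-nonZero 0<c}})))) ⟩
        (2 * Q + 1) * (ρ * (c * A + H))     <⟨ hΘ ⟩
        Θ                                   ≡⟨ cong (λ x → g (suc x)) (sym (+-identityʳ b₀)) ⟩
        g (suc (b₀ + 0))                    ≤⟨ m≤n*m _ (2 * (Q + 1)) {{m*n≢0 2 (Q + 1) {{_}} {{>-nonZero (≤-trans 0<Q (m≤m+n Q 1))}}}} ⟩
        2 * (Q + 1) * g (suc (b₀ + 0))      ∎))
      where open ≤-Reasoning
    refine nil L eL = refine′ nil z≤n L eL
    refine {n} (join {i₁} {i₂} {v₁} {v₂} B₁ B₂ j₁ j₂ lt₁ lt₂ fr) L eL =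
      choose (j₁ ≤? b₀) (j₂ ≤? b₀) (suc (j₁ + j₂) ≤? b₀) fr
      where
      b : ℕ
      b = suc (j₁ + j₂)
      v : ℕ
      v = suc (v₁ + v₂ + (coarse j₁ + coarse j₂))
      B : Build c coarse n v
      B = join B₁ B₂ j₁ j₂ lt₁ lt₂ fr
      Refined : Set
      Refined = ∃ λ w → w ≤ ρ * v + err × Build c g L w

      keep : ∀ j → b₀ < j → j < c → j < b → g j₁ + g j₂ + ρ * (A * (c ∸ j)) < ρ * (coarse j₁ + coarse j₂) + σ → Refined
      keep j l j<c j<b lt with split-length (Q * u) i₁ 0<s | split-length (Q * u) i₂ 0<s
      ... | L₁ , e₁ | L₂ , e₂ with refine B₁ L₁ e₁ | refine B₂ L₂ e₂
      ... | w₁ , w₁≤ , C₁ | w₂ , w₂≤ , C₂ =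
          _ , ≤-trans (≤-trans (m≤m+n S _) (<⇒≤ bound)) (m≤m+n _ err) ,
          subst (λ x → Build c g x S) eq (join C₁ C₂ j₁ j₂ lt₁ lt₂ (free fr))
        where
        S : ℕ
        S = suc (w₁ + w₂ + (g j₁ + g j₂))
        bound : S + ρ * (A * (c ∸ suc j)) < ρ * v
        bound = expensive {w₁} {w₂} {v₁} {v₂} j<c w₁≤ w₂≤ lt
        eq : suc (L₁ + L₂) ≡ L
        eq = suc-injective (begin
          suc (suc (L₁ + L₂))                     ≡⟨ cong suc (sym (+-suc L₁ L₂)) ⟩
          suc L₁ + suc L₂                         ≡⟨ cong₂ _+_ e₁ e₂ ⟩
          Q * u * suc i₁ + Q * u * suc i₂         ≡⟨ ring (Q * u) i₁ i₂ ⟩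
          Q * u * suc (suc (i₁ + i₂))             ≡⟨ sym eL ⟩
          suc L                                   ∎)
          where
          open ≡-Reasoning
          ring : ∀ s i j → s * suc i + s * suc j ≡ s * suc (suc (i + j))
          ring = solve-∀
        free : Free c b (coarse b) v → Free c b (g b) S
        free (inj₁ c≤) = inj₁ c≤
        -- Since `b` is larger than `j`, the threshold carries no more surplus than is left over in
        -- `bound`.
        free (inj₂ v<) = inj₂ (+-cancelʳ-< (ρ * (A * (c ∸ suc j))) S (g b)
          (<-≤-trans bound (≤-trans (coarse-threshold b v (<-trans l j<b) v<)
            (+-monoʳ-≤ (g b) (*-monoʳ-≤ ρ (*-monoʳ-≤ A (∸-monoʳ-≤ c j<b)))))))

      roomy : b₀ < b → Free c b (coarse b) v → c ≤ b ⊎ (2 * Q + 1) * (ρ * v + ρ * H) < 2 * (Q + 1) * g b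
      roomy l (inj₁ c≤) = inj₁ c≤
      roomy l (inj₂ v<) with c ≤? b
      ... | yes c≤ = inj₁ c≤
      ... | no c≰ = inj₂ (begin-strict
          (2 * Q + 1) * (ρ * v + ρ * H)                          ≤⟨ *-monoʳ-≤ (2 * Q + 1) (+-monoˡ-≤ (ρ * H) (coarse-threshold b v l v<)) ⟩
          (2 * Q + 1) * (g b + ρ * (A * (c ∸ b)) + ρ * H)        ≤⟨ *-monoʳ-≤ (2 * Q + 1) (+-monoˡ-≤ (ρ * H) (+-monoʳ-≤ (g b) (*-monoʳ-≤ ρ (≤-trans (*-monoʳ-≤ A (m∸n≤m c b)) (≤-reflexive (*-comm A c)))))) ⟩
          (2 * Q + 1) * (g b + ρ * (c * A) + ρ * H)              ≡⟨ e Q (g b) ρ (c * A) H ⟩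
          (2 * Q + 1) * g b + (2 * Q + 1) * (ρ * (c * A + H))    <⟨ +-monoʳ-< ((2 * Q + 1) * g b) (<-≤-trans hΘ (g-mono (suc b₀) b l (≰⇒> c≰))) ⟩
          (2 * Q + 1) * g b + g b                                ≡⟨ e₂ Q (g b) ⟩
          2 * (Q + 1) * g b                                      ∎)
        where
        open ≤-Reasoning
        e : ∀ Q g ρ x H → (2 * Q + 1) * (g + ρ * x + ρ * H) ≡ (2 * Q + 1) * g + (2 * Q + 1) * (ρ * (x + H))
        e = solve-∀
        e₂ : ∀ Q g → (2 * Q + 1) * g + g ≡ 2 * (Q + 1) * g
        e₂ = solve-∀

      choose : Dec (j₁ ≤ b₀) → Dec (j₂ ≤ b₀) → Dec (b ≤ b₀) → Free c b (coarse b) v → Refined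
      choose (no l₁) _ _ _ = keep j₁ (≰⇒> l₁) lt₁ (s≤s (m≤m+n _ _))
        (subst₂ _<_ (e₁ (g j₁) (ρ * (A * (c ∸ j₁))) (g j₂)) (e₂ ρ (coarse j₁) (coarse j₂) σ)
          (+-mono-<-≤ (coarse-cost-large j₁ (≰⇒> l₁)) (coarse-cost j₂ lt₂)))
        where
        e₁ : ∀ x y z → x + y + z ≡ x + z + y
        e₁ = solve-∀
        e₂ : ∀ ρ x y σ → ρ * x + (ρ * y + σ) ≡ ρ * (x + y) + σ
        e₂ = solve-∀
      choose (yes _) (no l₂) _ _ = keep j₂ (≰⇒> l₂) lt₂ (s≤s (m≤n+m _ _))
        (subst₂ _<_ (e₁ (g j₁) (ρ * (A * (c ∸ j₂))) (g j₂)) (e₂ ρ (coarse j₁) (coarse j₂) σ)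
          (+-mono-≤-< (coarse-cost j₁ lt₁) (coarse-cost-large j₂ (≰⇒> l₂))))
        where
        e₁ : ∀ x y z → x + (z + y) ≡ x + z + y
        e₁ = solve-∀
        e₂ : ∀ ρ x y σ → ρ * x + σ + ρ * y ≡ ρ * (x + y) + σ
        e₂ = solve-∀
      choose (yes s₁) (yes s₂) (no l) fr = rebuild j₁ j₂ s₁ s₂ eL B (roomy (≰⇒> l) fr)
      choose (yes s₁) (yes s₂) (yes s) (inj₁ c≤) = ⊥-elim (<⇒≱ (≤-<-trans s b₀<c) c≤)
      -- The coarse weight lies below an entry of `o`, hence below `Γ`, so the tree counts as light.
      choose (yes s₁) (yes s₂) (yes s) (inj₂ v<) = refine′ B
        (≤-trans (<⇒≤ (<-≤-trans v< (≤-trans (≤-reflexive (coarse-small b s)) (o≤Γ b (s≤s s))))) Γ≤A) L eL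

    conclude : ∀ {ℓ k} → (∀ h → h 0 ≡ 0 → ∃ λ v → v ≤ k × Build c h ℓ v) → ∀ L → suc L ≡ Q * u * suc ℓ →
               ∃ λ w → w ≤ ρ * k + err × Build c g L w
    conclude {ℓ} {k} force L eL = forced (force coarse (trans (coarse-small 0 z≤n) o0))
      where
      forced : (∃ λ v → v ≤ k × Build c coarse ℓ v) → ∃ λ w → w ≤ ρ * k + err × Build c g L w
      forced (v , v≤ , B) with refine B L eL
      ... | w , w≤ , C = w , ≤-trans w≤ (+-monoˡ-≤ err (*-monoʳ-≤ ρ v≤)) , C

-- Two-sided linear bounds from a single window

-- K(n)/n lies between a/d - Γ/n and (1 + 1/q) a/d.
record Rate (c q : ℕ) : Set where
  field
    a d Γ   : ℕ
    painter : ℕ → ℕ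
    0<a     : 0 < a
    0<d     : 0 < d
    painter₀ : painter 0 ≡ 0
    painter≤ : ∀ j → j < c → painter j ≤ Γ
    upper   : ∀ g → g 0 ≡ 0 → ∀ n → ∃ λ w → Build c g n w × (q * d) * w ≤ (q + 1) * a * n
    lower   : ∀ {n w} → Build c painter n w → a * n ≤ d * (w + Γ)

length≤value : ∀ {c ℓ} (W : Window c ℓ) → ℓ ≤ Window.value W
length≤value W with Window.forceable W (λ _ → 0) refl
... | w , w≤ , B = ≤-trans (length≤weight B) w≤

module _ {c ℓ : ℕ} (0<c : 0 < c) (0<ℓ : 0 < ℓ) (W : Window c ℓ) (e : ℕ)
  (upper : ∀ g → g 0 ≡ 0 → ∀ n → ∃ λ w → Build c g n w × suc e * ℓ * w ≤ (suc e + 1) * Window.value W * n)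
  where

  private
    k : ℕ
    k = Window.value W

    -- A tree lighter than `k` cannot tell the truncated painter from the original, so optimality at
    -- `ℓ` survives. From weight `k` on no threshold is left, and only joins that complete P_c
    -- remain admissible.
    capped : ℕ → ℕ
    capped j = Window.painter W j ⊓ k

    capped₀ : capped 0 ≡ 0
    capped₀ = cong (_⊓ k) (Window.painter₀ W)

    necessary : ∀ {w} → Build c capped ℓ w → k ≤ w
    necessary {w} B with k ≤? w
    ... | yes le = le
    ... | no k≰w = Window.necessary W w (uncap w (λ j _ → m⊓n≤m _ k) same ≤-refl B)
      where
      same : ∀ j → j < c → capped j ≤ w → Window.painter W j ≡ capped j
      same j _ le with ⊓-sel (Window.painter W j) k
      ... | inj₁ eq = sym eq
      ... | inj₂ eq = ⊥-elim (k≰w (≤-trans (≤-reflexive (sym eq)) le))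

    FreePair : ℕ → Set
    FreePair x = ∃ λ j₁ → j₁ < c × ∃ λ j₂ → j₂ < c × c ≤ suc (j₁ + j₂) × capped j₁ + capped j₂ ≡ x

    free-pair : ∃ λ γ → FreePair γ × (∀ x → FreePair x → γ ≤ x)
    free-pair = least FreePair
      (λ x → anyUpTo? (λ j₁ → anyUpTo? (λ j₂ → (c ≤? suc (j₁ + j₂)) ×-dec (capped j₁ + capped j₂ ≟ x)) c) c) _
      (c ∸ 1 , c-1< , 0 , 0<c , ≤-reflexive (trans (sym (m+[n∸m]≡n 0<c)) (cong suc (sym (+-identityʳ (c ∸ 1))))) , refl)
      where
      c-1< : c ∸ 1 < c
      c-1< = ≤-reflexive (m+[n∸m]≡n 0<c)

    γ : ℕ
    γ = proj₁ free-pair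

    -- Filling a path of length ℓ with copies of a cheap short one contradicts optimality at ℓ.
    dense-short : ∀ {n w} → n < ℓ → Build c capped n w → e * k * suc n ≤ suc e * ℓ * suc (w + γ)
    dense-short {n} {w} n<ℓ B with proj₁ (proj₂ free-pair) | ℓ / suc n in eqi | m≥n⇒m/n>0 {ℓ} {suc n} n<ℓ
    ... | j₁ , lt₁ , j₂ , lt₂ , c≤ , eqγ | suc i | _ with upper capped capped₀ (ℓ % suc n)
    ... | wr , Br , le = *-cancelʳ-≤ _ _ (suc i) (+-cancelʳ-≤ ((suc e + 1) * k * r) _ _ (begin
        e * k * suc n * suc i + (suc e + 1) * k * r    ≡⟨ e₁ e k (suc n) (suc i) r ⟩
        e * k * (suc i * suc n) + k * r + suc e * k * r ≤⟨ +-monoˡ-≤ (suc e * k * r) (+-monoʳ-≤ (e * k * (suc i * suc n)) (*-monoʳ-≤ k r≤)) ⟩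
        e * k * (suc i * suc n) + k * (suc i * suc n) + suc e * k * r ≡⟨ e₂ e k r (suc i * suc n) ⟩
        suc e * (r + suc i * suc n) * k                ≡⟨ cong (λ x → suc e * x * k) (sym ℓ≡) ⟩
        suc e * ℓ * k                                  ≤⟨ *-monoʳ-≤ (suc e * ℓ) (necessary B′) ⟩
        suc e * ℓ * (suc i * suc (w + γ) + wr)         ≡⟨ e₃ (suc e * ℓ) (suc i) (suc (w + γ)) wr ⟩
        suc e * ℓ * suc (w + γ) * suc i + suc e * ℓ * wr ≤⟨ +-monoʳ-≤ (suc e * ℓ * suc (w + γ) * suc i) le ⟩
        suc e * ℓ * suc (w + γ) * suc i + (suc e + 1) * k * r ∎))
      where
      open ≤-Reasoning
      r : ℕ
      r = ℓ % suc n
      ℓ≡ : ℓ ≡ r + suc i * suc n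
      ℓ≡ = trans (m≡m%n+[m/n]*n ℓ (suc n)) (cong (λ x → r + x * suc n) eqi)
      r≤ : r ≤ suc i * suc n
      r≤ = ≤-trans (<⇒≤ (m%n<n ℓ (suc n))) (m≤m+n (suc n) _)
      G : ℕ
      G = capped j₁ + capped j₂
      B′ : Build c capped ℓ (suc i * suc (w + γ) + wr)
      B′ = subst₂ (Build c capped)
        (trans (f₁ n i r) (sym ℓ≡))
        (trans (f₂ w i G wr) (cong (λ x → suc i * suc (w + x) + wr) eqγ))
        (join (chain B j₁ j₂ lt₁ lt₂ i (inj₁ c≤)) Br j₁ j₂ lt₁ lt₂ (inj₁ c≤))
        where
        f₁ : ∀ n i r → suc (n + i * suc n + r) ≡ r + suc i * suc n
        f₁ = solve-∀
        f₂ : ∀ w i G x → suc (w + i * suc (w + G) + x + G) ≡ suc i * suc (w + G) + x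
        f₂ = solve-∀
      e₁ : ∀ e k n i r → e * k * n * i + (suc e + 1) * k * r ≡ e * k * (i * n) + k * r + suc e * k * r
      e₁ = solve-∀
      e₂ : ∀ e k r x → e * k * x + k * x + suc e * k * r ≡ suc e * (r + x) * k
      e₂ = solve-∀
      e₃ : ∀ y i x w → y * (i * x + w) ≡ y * x * i + y * w
      e₃ = solve-∀

    -- Over joins whose colour-2 arms cost at least `γ`, length plus one is additive and weight plus
    -- `suc γ` is superadditive. A tree of length at least `ℓ` weighs at least `k`, so its last join
    -- must complete P_c and is of this kind; shorter trees are covered by `dense-short`.
    dense : ∀ {n w} → Build c capped n w → e * k * suc n ≤ suc e * ℓ * suc (w + γ)
    dense {n} B with n <? ℓ
    ... | yes n<ℓ = dense-short n<ℓ B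
    dense nil | no n≮ℓ = ⊥-elim (n≮ℓ 0<ℓ)
    dense {n} {w} (join {i₁} {i₂} {w₁} {w₂} B₁ B₂ j₁ j₂ lt₁ lt₂ fr) | no n≮ℓ = begin
      e * k * suc n                                          ≡⟨ e₁ (e * k) i₁ i₂ ⟩
      e * k * suc i₁ + e * k * suc i₂                        ≤⟨ +-mono-≤ (dense B₁) (dense B₂) ⟩
      suc e * ℓ * suc (w₁ + γ) + suc e * ℓ * suc (w₂ + γ)    ≡⟨ e₂ (suc e * ℓ) w₁ w₂ γ ⟩
      suc e * ℓ * suc (suc (w₁ + w₂ + γ) + γ)                ≤⟨ *-monoʳ-≤ (suc e * ℓ) (s≤s (s≤s (+-monoˡ-≤ γ (+-monoʳ-≤ (w₁ + w₂) (γ≤ fr))))) ⟩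
      suc e * ℓ * suc (w + γ)                                ∎
      where
      open ≤-Reasoning
      k≤w : k ≤ w
      k≤w with shorten (≮⇒≥ n≮ℓ) (join B₁ B₂ j₁ j₂ lt₁ lt₂ fr)
      ... | w′ , w′≤ , B′ = ≤-trans (necessary B′) w′≤
      γ≤ : Free c (suc (j₁ + j₂)) (capped (suc (j₁ + j₂))) w → γ ≤ capped j₁ + capped j₂
      γ≤ (inj₁ c≤) = proj₂ (proj₂ free-pair) _ (j₁ , lt₁ , j₂ , lt₂ , c≤ , refl)
      γ≤ (inj₂ w<) = ⊥-elim (<⇒≱ (<-≤-trans w< (m⊓n≤n _ k)) k≤w)
      e₁ : ∀ x i j → x * suc (suc (i + j)) ≡ x * suc i + x * suc j
      e₁ = solve-∀
      e₂ : ∀ x v w γ → x * suc (v + γ) + x * suc (w + γ) ≡ x * suc (suc (v + w + γ) + γ)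
      e₂ = solve-∀

  -- The factors e/(e + 1) from `dense` and (e + 2)/(e + 1) from `upper` have ratio (e + 2)/e, which
  -- is (q + 1)/q for e = 2q. In `Γ` the term `γ` comes from `dense`, and `k` bounds the entries of
  -- the painter.
  rate : ∀ q → 0 < q → e ≡ 2 * q → Rate c q
  rate q 0<q refl = record
    { a = e * k ; d = suc e * ℓ ; Γ = suc (γ + k)
    ; painter = capped
    ; 0<a = *-mono-< (≤-trans 0<q (m≤n*m q 2)) (≤-trans 0<ℓ (length≤value W))
    ; 0<d = *-mono-< {0} {suc e} (s≤s z≤n) 0<ℓ
    ; painter₀ = capped₀
    ; painter≤ = λ j _ → ≤-trans (m⊓n≤n _ k) (≤-trans (m≤n+m k γ) (n≤1+n _))
    ; upper = λ g g0 n → let (w , B , le) = upper g g0 n in w , B ,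
        ≤-trans (≤-reflexive (*-assoc q (suc e * ℓ) w)) (≤-trans (*-monoʳ-≤ q le) (≤-reflexive (e₁ q k n)))
    ; lower = λ {n} {w} B → ≤-trans (*-monoʳ-≤ (e * k) (n≤1+n n)) (≤-trans (dense B)
        (*-monoʳ-≤ (suc e * ℓ) (≤-trans (≤-reflexive (sym (+-suc w γ))) (+-monoʳ-≤ w (s≤s (m≤m+n γ k))))))
    }
    where
    e₁ : ∀ q k n → q * ((suc (2 * q) + 1) * k * n) ≡ (q + 1) * (2 * q * k) * n
    e₁ = solve-∀

-- The gap, the constants and the induction on `c`

-- Walk down from `b` while consecutive costs stay within the factor `R`; as `g 0` vanishes, the
-- walk stops at a gap. Each step before it loses at most a factor `R`.
gap : ∀ (g : ℕ → ℕ) → g 0 ≡ 0 → ∀ R → 0 < R → ∀ b → 0 < g b →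
      ∃ λ b₀ → suc b₀ ≤ b × R * g b₀ ≤ g (suc b₀) × 0 < g (suc b₀) × g b ≤ R ^ b * g (suc b₀)
gap g g0 R 0<R zero 0<gb = ⊥-elim (<⇒≢ 0<gb (sym g0))
gap g g0 R 0<R (suc b) 0<gb with R * g b ≤? g (suc b)
... | yes le = b , ≤-refl , le , 0<gb , m≤n*m (g (suc b)) (R ^ suc b) {{m^n≢0 R (suc b) {{>-nonZero 0<R}}}}
... | no nle with gap g g0 R 0<R b (n≢0⇒n>0 (λ z → n≮0 (subst (g (suc b) <_) (trans (cong (R *_) z) (*-zeroʳ R)) (≰⇒> nle))))
... | b₀ , le , r , pos , bound = b₀ , m≤n⇒m≤1+n le , r , pos ,
      ≤-trans (<⇒≤ (≰⇒> nle)) (≤-trans (*-monoʳ-≤ R bound) (≤-reflexive (sym (*-assoc R (R ^ b) (g (suc b₀))))))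

straight : ∀ {c g} → g 0 ≡ 0 → g c ≡ 0 → ∀ n → Build (suc c) g n n
straight g0 gc zero = nil
straight {c} {g} g0 gc (suc n) =
  subst₂ (Build (suc c) g) (cong suc (+-identityʳ n)) (cong suc (trans (cong (n + 0 +_) (cong₂ _+_ gc g0)) (trans (+-identityʳ (n + 0)) (+-identityʳ n))))
    (join (straight g0 gc n) nil c 0 ≤-refl (s≤s z≤n) (inj₁ (s≤s (m≤m+n c 0))))

-- The gap selects which smaller game is used, but the reference length is fixed earlier, so one
-- bound has to serve all of them.
bounded-rates : ∀ c q → (∀ {c′} → c′ < c → 0 < c′ → Rate c′ q) →
                ∃ λ H → ∀ c′ → c′ < c → 0 < c′ → Σ (Rate c′ q) λ r → Rate.Γ r + Rate.a r ≤ H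
bounded-rates zero q rates = 0 , λ _ ()
bounded-rates (suc zero) q rates = 0 , λ { zero _ () ; (suc _) (s≤s ()) }
bounded-rates (suc (suc c)) q rates with bounded-rates (suc c) q (λ lt → rates (m≤n⇒m≤1+n lt))
... | H , all = H′ + H , pick
  where
  r : Rate (suc c) q
  r = rates ≤-refl (s≤s z≤n)
  H′ : ℕ
  H′ = Rate.Γ r + Rate.a r
  pick : ∀ c′ → c′ < suc (suc c) → 0 < c′ → Σ (Rate c′ q) λ r → Rate.Γ r + Rate.a r ≤ H′ + H
  pick c′ lt pos with m≤n⇒m<n∨m≡n (s≤s⁻¹ lt)
  ... | inj₂ refl = r , m≤m+n H′ H
  ... | inj₁ lt′ with all c′ lt′ pos
  ... | r′ , le = r′ , ≤-trans le (m≤n+m H H′)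

-- A painter for length `m` is multiplied by t = Q ℓ and, above the gap, divided by (Q + 1) m. The
-- net factor is about ℓ/m, which turns it into a painter for length `ℓ`; multiplying before
-- dividing keeps the costs above the gap large against the rounding. The tree obtained from `force`
-- is refined, cut to length t m and unscaled.
module Scaled
  (c Q R′ T Z ℓ k H* : ℕ) (0<Q : 0 < Q) (0<ℓ : 0 < ℓ)
  (hR : 2 * (2 * Q + 1) * c ≤ R′) (hR′ : 64 * Q ≤ R′)
  (hZ : (2 * Q + 1) * (c * (2 * ((2 * Q + 1) * H*) + (Q + 1) + (Q + 1) * H*) + (Q + 1) * H*) ≤ Z)
  (hℓ : 2 * Z * T < ℓ) (hℓ′ : 32 * Q + 8 * H* ≤ ℓ) (hk : (2 * Q + 1) * H* ≤ k)
  (force : ∀ g → g 0 ≡ 0 → ∃ λ w → w ≤ k × Build c g ℓ w)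
  (g : ℕ → ℕ) (g0 : g 0 ≡ 0) (mono : ∀ j j′ → j ≤ j′ → j′ < c → g j ≤ g j′)
  (m : ℕ) (0<m : 0 < m)
  (b₀ : ℕ) (b₀< : suc b₀ < c) (r : Rate (suc b₀) (4 * Q)) (H≤ : Rate.Γ r + Rate.a r ≤ H*)
  (gap≤ : R′ * g b₀ ≤ g (suc b₀)) (Θ₀>0 : 0 < g (suc b₀)) (m≤T : m ≤ T * g (suc b₀))
  where

  private
    t : ℕ
    t = Q * ℓ
    instance
      t-nonZero : NonZero t
      t-nonZero = m*n≢0 Q ℓ {{>-nonZero 0<Q}} {{>-nonZero 0<ℓ}}
    open Rate r
    Θ σ H ρ err : ℕ
    Θ = t * g (suc b₀)
    σ = t * g b₀
    H = Γ + a
    ρ = (Q + 1) * m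
    err = (2 * Q + 1) * m * H

    R′σ≤Θ : R′ * σ ≤ Θ
    R′σ≤Θ = ≤-trans (≤-reflexive (x R′ t (g b₀))) (*-monoʳ-≤ t gap≤)
      where x : ∀ R t g → R * (t * g) ≡ t * (R * g)
            x = solve-∀
    ℓ≤Θ : ℓ ≤ Θ
    ℓ≤Θ = ≤-trans (m≤n*m ℓ Q {{>-nonZero 0<Q}}) (m≤m*n t (g (suc b₀)) {{>-nonZero Θ₀>0}})
    0<Θ : 0 < Θ
    0<Θ = ≤-trans 0<ℓ ℓ≤Θ

    offset : ∃ λ A → 2 * err + σ ≤ ρ * A × H ≤ A × ρ * A ≤ 2 * err + σ + ρ + ρ * H*
    offset = suc ((2 * err + σ) / ρ) + H* ,
      ≤-trans (<⇒≤ (m<[1+m/n]*n (2 * err + σ) ρ)) (≤-trans (≤-reflexive (*-comm _ ρ)) (*-monoʳ-≤ ρ (m≤m+n _ H*))) ,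
      ≤-trans H≤ (m≤n+m H* _) ,
      ≤-trans (≤-reflexive (*-distribˡ-+ ρ _ H*)) (+-monoˡ-≤ (ρ * H*)
        (≤-trans (≤-reflexive (x ρ _)) (+-monoˡ-≤ ρ (m/n*n≤m (2 * err + σ) ρ))))
      where
      instance
        ρ≢0 : NonZero ρ
        ρ≢0 = m*n≢0 (Q + 1) m {{>-nonZero (≤-trans 0<Q (m≤m+n Q 1))}} {{>-nonZero 0<m}}
      x : ∀ ρ y → ρ * suc y ≡ y * ρ + ρ
      x = solve-∀

    err≤ : err ≤ (2 * Q + 1) * m * H*
    err≤ = *-monoʳ-≤ ((2 * Q + 1) * m) H≤
    -- Of `2 * Θ`, one half absorbs the terms in `σ` by the gap ratio `R′`. The other absorbs the
    -- terms in `m`, whose coefficients are collected in `Z`, because `m` is at most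
    -- `T * g (suc b₀)` and `ℓ` exceeds `2 * Z * T`.
    threshold-room : ∀ A → ρ * A ≤ 2 * err + σ + ρ + ρ * H* → (2 * Q + 1) * (ρ * (c * A + H)) < Θ
    threshold-room A ρA≤ = *-cancelˡ-< 2 _ _ (begin-strict
      2 * ((2 * Q + 1) * (ρ * (c * A + H)))                   ≡⟨ x₁ Q ρ c A H ⟩
      2 * (2 * Q + 1) * (c * (ρ * A) + ρ * H)                 ≤⟨ *-monoʳ-≤ (2 * (2 * Q + 1)) (+-mono-≤
           (*-monoʳ-≤ c (≤-trans ρA≤ (+-monoˡ-≤ (ρ * H*) (+-monoˡ-≤ ρ (+-monoˡ-≤ σ (*-monoʳ-≤ 2 err≤))))))
           (*-monoʳ-≤ ρ H≤)) ⟩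
      2 * (2 * Q + 1) * (c * (2 * ((2 * Q + 1) * m * H*) + σ + ρ + ρ * H*) + ρ * H*) ≡⟨ x₂ Q c m H* σ ⟩
      2 * (2 * Q + 1) * c * σ + 2 * Z₀ * m                    ≤⟨ +-monoʳ-≤ (2 * (2 * Q + 1) * c * σ) (*-monoˡ-≤ m (*-monoʳ-≤ 2 hZ)) ⟩
      2 * (2 * Q + 1) * c * σ + 2 * Z * m                     <⟨ +-mono-≤-< cσ≤ Zm< ⟩
      Θ + Θ                                                   ≡⟨ x₃ Θ ⟩
      2 * Θ                                                   ∎)
      where
      open ≤-Reasoning
      Z₀ : ℕ
      Z₀ = (2 * Q + 1) * (c * (2 * ((2 * Q + 1) * H*) + (Q + 1) + (Q + 1) * H*) + (Q + 1) * H*)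
      x₁ : ∀ Q ρ c A H → 2 * ((2 * Q + 1) * (ρ * (c * A + H))) ≡ 2 * (2 * Q + 1) * (c * (ρ * A) + ρ * H)
      x₁ = solve-∀
      x₂ : ∀ Q c m H σ → 2 * (2 * Q + 1) * (c * (2 * ((2 * Q + 1) * m * H) + σ + (Q + 1) * m + (Q + 1) * m * H) + (Q + 1) * m * H)
           ≡ 2 * (2 * Q + 1) * c * σ + 2 * ((2 * Q + 1) * (c * (2 * ((2 * Q + 1) * H) + (Q + 1) + (Q + 1) * H) + (Q + 1) * H)) * m
      x₂ = solve-∀
      x₃ : ∀ x → x + x ≡ 2 * x
      x₃ = solve-∀
      cσ≤ : 2 * (2 * Q + 1) * c * σ ≤ Θ
      cσ≤ = ≤-trans (*-monoˡ-≤ σ hR) R′σ≤Θ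
      Zm< : 2 * Z * m < Θ
      Zm< = begin-strict
        2 * Z * m                    ≤⟨ *-monoʳ-≤ (2 * Z) m≤T ⟩
        2 * Z * (T * g (suc b₀))     ≡⟨ sym (*-assoc (2 * Z) T (g (suc b₀))) ⟩
        2 * Z * T * g (suc b₀)       <⟨ *-monoˡ-< (g (suc b₀)) {{>-nonZero Θ₀>0}} hℓ ⟩
        ℓ * g (suc b₀)               ≤⟨ *-monoˡ-≤ (g (suc b₀)) (m≤n*m ℓ Q {{>-nonZero 0<Q}}) ⟩
        Θ                            ∎

    -- A quarter of d Θ/a keeps the blocks below `Θ` with room to spare. It is long enough for the
    -- joins because `Θ` is at least 64 Q σ, by the gap, and at least 32 Q + 8 a, through `ℓ`.
    block-length : ∃ λ m₀ → 0 < m₀ × 2 * a * m₀ < d * Θ × 4 * Q * d * (1 + 2 * σ) ≤ a * m₀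
    block-length = m₀ , 0<m₀ , hm , hσ
      where
      instance
        a4≢0 : NonZero (4 * a)
        a4≢0 = m*n≢0 4 a {{_}} {{>-nonZero 0<a}}
      m₀ : ℕ
      m₀ = d * Θ / (4 * a)
      hm : 2 * a * m₀ < d * Θ
      hm = *-cancelˡ-< 2 _ _ (≤-<-trans (≤-trans (≤-reflexive (x a m₀)) (m/n*n≤m (d * Θ) (4 * a)))
             dΘ<)
        where x : ∀ a m → 2 * (2 * a * m) ≡ m * (4 * a)
              x = solve-∀
              dΘ< : d * Θ < 2 * (d * Θ)
              dΘ< = ≤-trans (≤-reflexive (+-comm 1 (d * Θ))) (+-monoʳ-≤ (d * Θ)
                      (≤-trans (*-mono-< 0<d 0<Θ) (m≤m+n (d * Θ) 0)))
      hσ : 4 * Q * d * (1 + 2 * σ) ≤ a * m₀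
      hσ = *-cancelˡ-≤ 4 (+-cancelʳ-≤ (4 * a) _ _ (begin
        4 * (4 * Q * d * (1 + 2 * σ)) + 4 * a             ≤⟨ +-monoʳ-≤ _ (m≤n*m (4 * a) d {{>-nonZero 0<d}}) ⟩
        4 * (4 * Q * d * (1 + 2 * σ)) + d * (4 * a)       ≡⟨ x₁ Q d σ a ⟩
        d * (32 * Q * σ + (16 * Q + 4 * a))               ≤⟨ *-monoʳ-≤ d half ⟩
        d * Θ                                             ≤⟨ <⇒≤ (m<[1+m/n]*n (d * Θ) (4 * a)) ⟩
        suc m₀ * (4 * a)                                  ≡⟨ x₂ m₀ a ⟩
        4 * (a * m₀) + 4 * a                              ∎))
        where
        open ≤-Reasoning
        x₁ : ∀ Q d σ a → 4 * (4 * Q * d * (1 + 2 * σ)) + d * (4 * a) ≡ d * (32 * Q * σ + (16 * Q + 4 * a))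
        x₁ = solve-∀
        x₂ : ∀ m a → suc m * (4 * a) ≡ 4 * (a * m) + 4 * a
        x₂ = solve-∀
        x₃ : ∀ Q σ a → 2 * (32 * Q * σ + (16 * Q + 4 * a)) ≡ 64 * Q * σ + (32 * Q + 8 * a)
        x₃ = solve-∀
        x₄ : ∀ x → x + x ≡ 2 * x
        x₄ = solve-∀
        half : 32 * Q * σ + (16 * Q + 4 * a) ≤ Θ
        half = *-cancelˡ-≤ 2 (begin
          2 * (32 * Q * σ + (16 * Q + 4 * a))   ≡⟨ x₃ Q σ a ⟩
          64 * Q * σ + (32 * Q + 8 * a)         ≤⟨ +-mono-≤
             (≤-trans (*-monoˡ-≤ σ hR′) R′σ≤Θ)
             (≤-trans (+-monoʳ-≤ (32 * Q) (*-monoʳ-≤ 8 (≤-trans (m≤n+m a Γ) H≤)))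
               (≤-trans hℓ′ ℓ≤Θ)) ⟩
          Θ + Θ                                 ≡⟨ x₄ Θ ⟩
          2 * Θ                                 ∎)
      0<m₀ : 0 < m₀
      0<m₀ = n≢0⇒n>0 (λ z → n≮0 (≤-trans (≤-trans pos hσ) (≤-reflexive (trans (cong (a *_) z) (*-zeroʳ a)))))
        where
        pos : 0 < 4 * Q * d * (1 + 2 * σ)
        pos = *-mono-< (*-mono-< (≤-trans 0<Q (m≤n*m Q 4)) 0<d) (s≤s z≤n)
    err≤mk : err ≤ m * k
    err≤mk = ≤-trans err≤ (≤-trans (≤-reflexive (x Q m H*)) (*-monoʳ-≤ m hk))
      where x : ∀ Q m H → (2 * Q + 1) * m * H ≡ m * ((2 * Q + 1) * H)
            x = solve-∀
    lengths : ∃ λ L → suc L ≡ Q * m * suc ℓ × t * m ≤ L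
    lengths = L , eL , tm≤L
      where
      L : ℕ
      L = pred (Q * m * suc ℓ)
      eL : suc L ≡ Q * m * suc ℓ
      eL = suc-pred (Q * m * suc ℓ) {{m*n≢0 (Q * m) (suc ℓ) {{m*n≢0 Q m {{>-nonZero 0<Q}} {{>-nonZero 0<m}}}}}}
      tm≤L : t * m ≤ L
      tm≤L = s≤s⁻¹ (≤-trans (≤-trans (≤-reflexive (+-comm 1 (t * m))) (+-monoʳ-≤ (t * m) (*-mono-< 0<Q 0<m)))
        (≤-reflexive (trans (x Q ℓ m) (sym eL))))
        where x : ∀ Q ℓ m → Q * ℓ * m + Q * m ≡ Q * m * suc ℓ
              x = solve-∀
    rescale : ∀ L → t * m ≤ L → (∃ λ w → w ≤ ρ * k + err × Build c (scale-cost t g) L w) →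
              ∃ λ v → Build c g m v × t * v ≤ (Q + 2) * m * k
    rescale L tm≤L (w , w≤ , B) = via (shorten tm≤L B)
      where
      Rescaled : Set
      Rescaled = ∃ λ v → Build c g m v × t * v ≤ (Q + 2) * m * k
      m≤ : ∀ {p r} → r < t → t * m ≡ t * p + r → m ≤ p
      m≤ {p} r< eq = s≤s⁻¹ (*-cancelˡ-< t m (suc p) (≤-<-trans (≤-reflexive eq)
             (<-≤-trans (+-monoʳ-< (t * p) r<) (≤-reflexive (trans (+-comm (t * p) t) (sym (*-suc t p)))))))
      last : ∀ {p v} → m ≤ p → t * v ≤ w → Build c g p v → Rescaled
      last {p} {v} m≤p tv≤ B with shorten m≤p B
      ... | v′ , v′≤ , B′ = v′ , B′ , (begin
        t * v′                        ≤⟨ *-monoʳ-≤ t v′≤ ⟩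
        t * v                         ≤⟨ tv≤ ⟩
        w                             ≤⟨ w≤ ⟩
        ρ * k + err        ≤⟨ +-monoʳ-≤ (ρ * k) err≤mk ⟩
        ρ * k + m * k                 ≡⟨ x Q m k ⟩
        (Q + 2) * m * k               ∎)
        where
        open ≤-Reasoning
        x : ∀ Q m k → (Q + 1) * m * k + m * k ≡ (Q + 2) * m * k
        x = solve-∀
      via : (∃ λ w′ → w′ ≤ w × Build c (scale-cost t g) (t * m) w′) → Rescaled
      via (w′ , w′≤ , B′) with unscale t B′
      ... | p , r , v , r< , eq , tv≤ , B″ = last (m≤ r< eq) (≤-trans (≤-trans (m≤m+n _ r) tv≤) w′≤) B″

  comparable : ∃ λ v → Build c g m v × t * v ≤ (Q + 2) * m * k
  comparable = combine offset block-length lengths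
    where
    combine : (∃ λ A → 2 * err + σ ≤ ρ * A × H ≤ A × ρ * A ≤ 2 * err + σ + ρ + ρ * H*) →
              (∃ λ m₀ → 0 < m₀ × 2 * a * m₀ < d * Θ × 4 * Q * d * (1 + 2 * σ) ≤ a * m₀) →
              (∃ λ L → suc L ≡ Q * m * suc ℓ × t * m ≤ L) →
              ∃ λ v → Build c g m v × t * v ≤ (Q + 2) * m * k
    combine (A , hA , H≤A , ρA≤) (m₀ , 0<m₀ , hm , hσ) (L , eL , tm≤L) = rescale L tm≤L
      (Coarsening.conclude c b₀ b₀< (scale-cost t g) (scaled-zero) scaled-mono painter painter₀ a d Γ Q m A m₀
        0<d 0<Q 0<m 0<m₀ painter≤ (upper (scale-cost t g) scaled-zero) lower
        hA H≤A (threshold-room A ρA≤) hm hσ force L eL)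
      where
      scaled-zero : t * g 0 ≡ 0
      scaled-zero = trans (cong (t *_) g0) (*-zeroʳ t)
      scaled-mono : ∀ j j′ → j ≤ j′ → j′ < c → t * g j ≤ t * g j′
      scaled-mono j j′ le lt = *-monoʳ-≤ t (mono j j′ le lt)

-- The constants depend on one another in the order `Q` and `R`, the gap ratio `R′`, the bound `T`
-- on a block length relative to the first cost above the gap, `Z`, and last `ℓ`. None of them
-- refers to `g`.
record Scale (c₁ e H* : ℕ) : Set where
  field
    Q R R′ T Z ℓ : ℕ
    Q≡ : Q ≡ 4 * e
    R≡ : R ≡ 8 * e
    0<ℓ : 0 < ℓ
    hR  : 2 * (2 * Q + 1) * suc c₁ ≤ R′
    hR′ : 64 * Q ≤ R′
    hT  : R * R′ ^ c₁ ≤ T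
    hZ  : (2 * Q + 1) * (suc c₁ * (2 * ((2 * Q + 1) * H*) + (Q + 1) + (Q + 1) * H*) + (Q + 1) * H*) ≤ Z
    hℓ  : 2 * Z * T < ℓ
    hℓ′ : 32 * Q + 8 * H* ≤ ℓ
    hℓ″ : (2 * Q + 1) * H* ≤ ℓ

scale : ∀ c₁ e H* → Scale c₁ e H*
scale c₁ e H* = choose (4 * e) (8 * e) _ _ _ refl refl ≤-refl ≤-refl ≤-refl
  where
  choose : ∀ Q R R′ T Z → Q ≡ 4 * e → R ≡ 8 * e → 2 * (2 * Q + 1) * suc c₁ + 64 * Q ≤ R′ → R * R′ ^ c₁ ≤ T →
           (2 * Q + 1) * (suc c₁ * (2 * ((2 * Q + 1) * H*) + (Q + 1) + (Q + 1) * H*) + (Q + 1) * H*) ≤ Z → Scale c₁ e H*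
  choose Q R R′ T Z Q≡ R≡ h hT hZ = record
    { Q = Q ; R = R ; R′ = R′ ; T = T ; Z = Z ; ℓ = suc (x + y + z)
    ; Q≡ = Q≡ ; R≡ = R≡ ; 0<ℓ = s≤s z≤n
    ; hR = m+n≤o⇒m≤o (2 * (2 * Q + 1) * suc c₁) h
    ; hR′ = m+n≤o⇒n≤o (2 * (2 * Q + 1) * suc c₁) h
    ; hT = hT ; hZ = hZ
    ; hℓ = s≤s (≤-trans (m≤m+n x y) (m≤m+n (x + y) z))
    ; hℓ′ = ≤-trans (m≤n+m y x) (≤-trans (m≤m+n (x + y) z) (n≤1+n _))
    ; hℓ″ = ≤-trans (m≤n+m z (x + y)) (n≤1+n _)
    }
    where
    x y z : ℕ
    x = 2 * Z * T
    y = 32 * Q + 8 * H*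
    z = (2 * Q + 1) * H*

module Step (c₁ e : ℕ) (0<e : 0 < e)
  (H* : ℕ) (rates : ∀ c′ → c′ < suc c₁ → 0 < c′ → Σ (Rate c′ (4 * (4 * e))) λ r → Rate.Γ r + Rate.a r ≤ H*)
  (S : Scale c₁ e H*) (W : Window (suc c₁) (Scale.ℓ S)) where

  open Scale S

  private
    c k : ℕ
    c = suc c₁
    k = Window.value W

    0<Q : 0 < Q
    0<Q = subst (0 <_) (sym Q≡) (≤-trans 0<e (m≤n*m e 4))

    0<R : 0 < R
    0<R = subst (0 <_) (sym R≡) (≤-trans 0<e (m≤n*m e 8))

    0<R′ : 0 < R′
    0<R′ = ≤-trans (≤-trans 0<Q (m≤n*m Q 64)) hR′

  -- Since `m` is within a factor `R` of the largest cost, `gap` puts it within a factor `T` of the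
  -- first cost above the gap. For Q = 4e the loss (Q + 2)/Q is 1 + 1/(2e).
  comparable : ∀ (g : ℕ → ℕ) (g0 : g 0 ≡ 0) (mono : ∀ j j′ → j ≤ j′ → j′ < c → g j ≤ g j′)
    m → 0 < m → m ≤ R * g c₁ → 0 < g c₁ → ∃ λ w → Build c g m w × 2 * e * ℓ * w ≤ (2 * e + 1) * k * m
  comparable g g0 mono m 0<m m≤ 0<y = found (gap g g0 R′ 0<R′ c₁ 0<y)
    where
    found : (∃ λ b₀ → suc b₀ ≤ c₁ × R′ * g b₀ ≤ g (suc b₀) × 0 < g (suc b₀) × g c₁ ≤ R′ ^ c₁ * g (suc b₀)) →
            ∃ λ w → Build c g m w × 2 * e * ℓ * w ≤ (2 * e + 1) * k * m
    found (b₀ , b₀< , le , pos , bound) = finish (Scaled.comparable c Q R′ T Z ℓ k H* 0<Q 0<ℓ hR hR′ hZ hℓ hℓ′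
        (≤-trans hℓ″ (length≤value W)) (Window.forceable W) g g0 mono m 0<m b₀ (s≤s b₀<) (proj₁ rb) (proj₂ rb) le pos
        (≤-trans m≤ (≤-trans (*-monoʳ-≤ R bound) (≤-trans (≤-reflexive (sym (*-assoc R (R′ ^ c₁) (g (suc b₀))))) (*-monoˡ-≤ (g (suc b₀)) hT)))))
      where
      rb : Σ (Rate (suc b₀) (4 * Q)) λ r → Rate.Γ r + Rate.a r ≤ H*
      rb = subst (λ x → Σ (Rate (suc b₀) (4 * x)) λ r → Rate.Γ r + Rate.a r ≤ H*) (sym Q≡) (rates (suc b₀) (s≤s b₀<) (s≤s z≤n))
      finish : (∃ λ v → Build c g m v × Q * ℓ * v ≤ (Q + 2) * m * k) → ∃ λ w → Build c g m w × 2 * e * ℓ * w ≤ (2 * e + 1) * k * m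
      finish (v , B , le) = v , B , *-cancelˡ-≤ 2 (≤-trans (≤-reflexive (x₁ e ℓ v)) (≤-trans (subst (λ x → x * ℓ * v ≤ (x + 2) * m * k) Q≡ le) (≤-reflexive (x₂ e m k))))
        where
        x₁ : ∀ e ℓ v → 2 * (2 * e * ℓ * v) ≡ 4 * e * ℓ * v
        x₁ = solve-∀
        x₂ : ∀ e m k → (4 * e + 2) * m * k ≡ 2 * ((2 * e + 1) * k * m)
        x₂ = solve-∀

  -- Long paths are cut into blocks shorter than R y, where y is the largest cost, and joined by
  -- completing P_c at cost at most 2y each. For R = 8e the joins add at most n/(2e), the half of
  -- the error that `comparable` left over.
  monotone-upper : ∀ g → g 0 ≡ 0 → (∀ j j′ → j ≤ j′ → j′ < c → g j ≤ g j′) → ∀ n →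
          ∃ λ w → Build c g n w × e * ℓ * w ≤ (e + 1) * k * n
  monotone-upper g g0 mono zero = 0 , nil , ≤-trans (≤-reflexive (*-zeroʳ (e * ℓ))) z≤n
  monotone-upper g g0 mono n@(suc n′) with g c₁ ≟ 0
  ... | yes y≡0 = n , straight g0 y≡0 n , *-monoˡ-≤ n (*-mono-≤ (m≤m+n e 1) (length≤value W))
  ... | no y≢0 = finish (blocks (2 * e * ℓ) ((2 * e + 1) * k) n (R * y) c₁ 0 (*-mono-< 0<R 0<y) ≤-refl (s≤s z≤n) block
                   (λ _ _ _ _ → inj₁ (s≤s (m≤m+n c₁ 0))))
    where
    y : ℕ
    y = g c₁
    0<y : 0 < y
    0<y = n≢0⇒n>0 y≢0
    block : ∀ m → m < R * y → ∃ λ w → Build c g m w × 2 * e * ℓ * w ≤ (2 * e + 1) * k * m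
    block zero _ = 0 , nil , ≤-trans (≤-reflexive (*-zeroʳ (2 * e * ℓ))) z≤n
    block m@(suc _) m< = comparable g g0 mono m (s≤s z≤n) (<⇒≤ m<) 0<y
    finish : (∃ λ w → ∃ λ i → Build c g n w × i * (R * y) ≤ suc n ×
               2 * e * ℓ * w ≤ (2 * e + 1) * k * n + 2 * e * ℓ * (i * suc (g c₁ + g 0))) →
             ∃ λ w → Build c g n w × e * ℓ * w ≤ (e + 1) * k * n
    finish (w , i , B , i≤ , le) = w , B , *-cancelˡ-≤ 2 (begin
      2 * (e * ℓ * w)                                          ≡⟨ x₁ e ℓ w ⟩
      2 * e * ℓ * w                                            ≤⟨ le ⟩
      (2 * e + 1) * k * n + 2 * e * ℓ * (i * suc (y + g 0))    ≤⟨ +-monoʳ-≤ ((2 * e + 1) * k * n) joins ⟩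
      (2 * e + 1) * k * n + k * n                              ≡⟨ x₂ e k n ⟩
      2 * ((e + 1) * k * n)                                    ∎)
      where
      open ≤-Reasoning
      x₁ : ∀ e ℓ w → 2 * (e * ℓ * w) ≡ 2 * e * ℓ * w
      x₁ = solve-∀
      x₂ : ∀ e k n → (2 * e + 1) * k * n + k * n ≡ 2 * ((e + 1) * k * n)
      x₂ = solve-∀
      x₃ : ∀ e ℓ i y → 2 * (2 * e * ℓ * (i * (y + y))) ≡ ℓ * (i * (8 * e * y))
      x₃ = solve-∀
      x₄ : ∀ ℓ n → ℓ * (n + n) ≡ 2 * (ℓ * n)
      x₄ = solve-∀
      G≤ : suc (y + g 0) ≤ y + y
      G≤ = ≤-trans (≤-reflexive (cong suc (trans (cong (y +_) g0) (+-identityʳ y)))) (+-monoˡ-≤ y 0<y)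
      joins : 2 * e * ℓ * (i * suc (y + g 0)) ≤ k * n
      joins = *-cancelˡ-≤ 2 (begin
        2 * (2 * e * ℓ * (i * suc (y + g 0)))   ≤⟨ *-monoʳ-≤ 2 (*-monoʳ-≤ (2 * e * ℓ) (*-monoʳ-≤ i G≤)) ⟩
        2 * (2 * e * ℓ * (i * (y + y)))         ≡⟨ x₃ e ℓ i y ⟩
        ℓ * (i * (8 * e * y))                   ≡⟨ cong (λ x → ℓ * (i * (x * y))) (sym R≡) ⟩
        ℓ * (i * (R * y))                       ≤⟨ *-monoʳ-≤ ℓ (≤-trans i≤ (+-monoˡ-≤ n (s≤s {0} {n′} z≤n))) ⟩
        ℓ * (n + n)                             ≡⟨ x₄ ℓ n ⟩
        2 * (ℓ * n)                             ≤⟨ *-monoʳ-≤ 2 (*-monoˡ-≤ n (length≤value W)) ⟩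
        2 * (k * n)                             ∎)

  upper-bound : ∀ g → g 0 ≡ 0 → ∀ n → ∃ λ w → Build c g n w × e * ℓ * w ≤ (e + 1) * k * n
  upper-bound g g0 n with monotone-upper (lower-envelope c g)
      (n≤0⇒n≡0 (≤-trans (lower-envelope-≤ c g 0 0 z≤n (s≤s z≤n)) (≤-reflexive g0))) (lower-envelope-mono c g) n
  ... | w , B , le = w , from-envelope B , le

abstract
  rates : ∀ c → 0 < c → ∀ q → 0 < q → Rate c q
  rates = <-rec (λ c → 0 < c → ∀ q → 0 < q → Rate c q) step
    where
    step : ∀ c → (∀ {c′} → c′ < c → 0 < c′ → ∀ q → 0 < q → Rate c′ q) → 0 < c → ∀ q → 0 < q → Rate c q
    step (suc c₁) rec 0<c q 0<q =
      -- The smaller games are needed to accuracy 4Q with Q = 4e. The value e = 2q + 1 is the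
      -- accuracy from which `rate` derives q.
      from-bounds (bounded-rates (suc c₁) (4 * (4 * suc (2 * q))) (λ lt pos → rec lt pos _ (s≤s z≤n)))
      where
      e : ℕ
      e = suc (2 * q)
      from-bounds : (∃ λ H* → ∀ c′ → c′ < suc c₁ → 0 < c′ → Σ (Rate c′ (4 * (4 * e))) λ r → Rate.Γ r + Rate.a r ≤ H*) → Rate (suc c₁) q
      from-bounds (H* , all) = from-scale (scale c₁ e H*)
        where
        from-scale : Scale c₁ e H* → Rate (suc c₁) q
        from-scale S = rate 0<c (Scale.0<ℓ S) W (2 * q) (Step.upper-bound c₁ e (s≤s z≤n) H* all S W) q 0<q refl
          where
          W : Window (suc c₁) (Scale.ℓ S)
          W = window (suc c₁) (Scale.ℓ S) 0<c

-- Boards and paths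

Vertex : Graph → Set
Vertex G = Fin (size G)

Adj : (G : Graph) → Vertex G → Vertex G → Set
Adj G x y = adj G x y ≡ true

Symmetric : Graph → Set
Symmetric G = ∀ x y → Adj G x y → Adj G y x

reach-trans : ∀ {G x y z} → Reach G x y → Reach G y z → Reach G x z
reach-trans here q = q
reach-trans (there e p) q = there e (reach-trans p q)

reach-sym : ∀ {G} → Symmetric G → ∀ {x y} → Reach G x y → Reach G y x
reach-sym s here = here
reach-sym s (there {u} {w} e p) = reach-trans (reach-sym s p) (there (s u w e) here)

extend-symmetric : ∀ {G} S → Symmetric G → Symmetric (extendGraph G S)
extend-symmetric S s zero    zero    ()
extend-symmetric S s zero    (suc y) e = e
extend-symmetric S s (suc x) zero    e = e
extend-symmetric S s (suc x) (suc y) e = s x y e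

reach-extend : ∀ {G} S {x y} → Reach G x y → Reach (extendGraph G S) (suc x) (suc y)
reach-extend S here = here
reach-extend S (there e p) = there e (reach-extend S p)

lookup-injective : ∀ {A : Set} {xs : List A} → Unique xs → ∀ i j → lookup xs i ≡ lookup xs j → i ≡ j
lookup-injective (_ ∷ _) zero zero _ = refl
lookup-injective {xs = _ ∷ xs} (x∉ ∷ _) zero (suc j) e = ⊥-elim (All.lookup x∉ (∈-lookup {xs = xs} j) e)
lookup-injective {xs = _ ∷ xs} (x∉ ∷ _) (suc i) zero e = ⊥-elim (All.lookup x∉ (∈-lookup {xs = xs} i) (sym e))
lookup-injective (_ ∷ u) (suc i) (suc j) e = cong suc (lookup-injective u i j e)

-- Lower bounds on a component are witnessed by one list and upper bounds, `ComponentSize≤`,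
-- quantify over all lists; the component itself is never computed.
ComponentSize≥ : (G : Graph) → Vertex G → ℕ → Set
ComponentSize≥ G u m = ∃ λ L → Unique L × (∀ {x} → x ∈ L → Reach G u x) × m ≤ length L

component-bound : ∀ {G k} → ComponentsAtMost k G → ∀ {u m} → ComponentSize≥ G u m → m ≤ k
component-bound at-most {u} (L , uniq , reach , m≤) =
  ≤-trans m≤ (at-most u (length L) (lookup L) (λ {i} {j} → lookup-injective uniq i j) (λ i → reach (∈-lookup {xs = L} i)))

component-≤ : ∀ {G u m m′} → m′ ≤ m → ComponentSize≥ G u m → ComponentSize≥ G u m′
component-≤ le (L , uniq , reach , m≤) = L , uniq , reach , ≤-trans le m≤

component-move : ∀ {G u v m} → Reach G v u → ComponentSize≥ G u m → ComponentSize≥ G v m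
component-move r (L , uniq , reach , m≤) = L , uniq , (λ x∈ → reach-trans r (reach x∈)) , m≤

component-extend : ∀ {G} S {u m} → ComponentSize≥ G u m → ComponentSize≥ (extendGraph G S) (suc u) m
component-extend {G} S {u} (L , uniq , reach , m≤) =
  map suc L , UniqueP.map⁺ FinP.suc-injective uniq , reach′ , ≤-trans m≤ (≤-reflexive (sym (ListP.length-map suc L)))
  where
  reach′ : ∀ {x} → x ∈ map suc L → Reach (extendGraph G S) (suc u) x
  reach′ x∈ with ∈-map⁻ suc x∈
  ... | y , y∈ , refl = reach-extend S (reach y∈)

data Ends {A : Set} : List A → A → Set where
  one  : ∀ {x} → Ends (x ∷ []) x
  more : ∀ {x y ys z} → Ends (y ∷ ys) z → Ends (x ∷ y ∷ ys) z

ends-∈ : ∀ {A : Set} {xs : List A} {z} → Ends xs z → z ∈ xs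
ends-∈ one = here refl
ends-∈ (more e) = there (ends-∈ e)

ends-map : ∀ {A B : Set} (f : A → B) {xs z} → Ends xs z → Ends (map f xs) (f z)
ends-map f one = one
ends-map f (more e) = more (ends-map f e)

ends-lookup : ∀ {A : Set} {x : A} {xs z} → Ends (x ∷ xs) z → lookup (x ∷ xs) (fromℕ (length xs)) ≡ z
ends-lookup one = refl
ends-lookup (more e) = ends-lookup e

linked-lookup : ∀ {A : Set} {R : A → A → Set} {x xs} → Linked R (x ∷ xs) →
                ∀ (i : Fin (length xs)) → R (lookup (x ∷ xs) (inject₁ i)) (lookup xs i)
linked-lookup (r ∷ l) zero = r
linked-lookup (r ∷ l) (suc i) = linked-lookup l i

SimplePath : (G : Graph) → Vertex G → Vertex G → List (Vertex G) → Set
SimplePath G u v xs = Linked (Adj G) (u ∷ xs) × Unique (u ∷ xs) × Ends (u ∷ xs) v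

private
  suffix : ∀ {G u v x xs} → u ∈ (x ∷ xs) → SimplePath G x v xs → ∃ λ ys → SimplePath G u v ys
  suffix (here refl) p = _ , p
  suffix {xs = _ ∷ _} (there u∈) (_ ∷ l , _ ∷ uniq , more e) = suffix u∈ (l , uniq , e)

-- Loop erasure: if the start recurs on the rest of the path, only the suffix from there is kept.
simple-path : ∀ {G u v} → Reach G u v → ∃ λ xs → SimplePath G u v xs
simple-path here = [] , [-] , [] ∷ [] , one
simple-path {G} {u} (there {w = w} a r) with simple-path r
... | xs , p@(l , uniq , e) with DecMembership._∈?_ FinP._≟_ u (w ∷ xs)
... | yes u∈ = suffix u∈ p
... | no u∉ = w ∷ xs , a ∷ l , All.tabulate (λ {y} y∈ u≡y → u∉ (subst (_∈ (w ∷ xs)) (sym u≡y) y∈)) ∷ uniq , more e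

-- Otherwise a simple path between the two neighbours would close a cycle through the new vertex. On
-- Painter's side this is how acyclicity enters: what hangs at different neighbours is disjoint.
neighbours-apart : ∀ {G} S → IsForest (extendGraph G S) → ∀ {u v} → S u ≡ true → S v ≡ true → Reach G u v → u ≡ v
neighbours-apart {G} S forest {u} {v} Su Sv r = close (simple-path r)
  where
  close : (∃ λ xs → SimplePath G u v xs) → u ≡ v
  close ([] , _ , _ , one) = refl
  close (y ∷ ys , l , uniq , e) = ⊥-elim (forest record
    { m = length (map Fin.suc ys)
    ; v = lookup cyc
    ; v-inj = λ {i} {j} → lookup-injective (All.tabulate zero≢ ∷ UniqueP.map⁺ FinP.suc-injective uniq) i j
    ; v-con = linked-lookup {R = Adj (extendGraph G S)} (Su ∷ LinkedP.map⁺ l)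
    ; v-cls = subst (λ x → Adj (extendGraph G S) x zero) (sym (ends-lookup (more {x = zero} (ends-map suc e)))) Sv
    })
    where
    cyc : List (Vertex (extendGraph G S))
    cyc = zero ∷ map suc (u ∷ y ∷ ys)
    zero≢ : ∀ {x} → x ∈ map Fin.suc (u ∷ y ∷ ys) → zero ≢ x
    zero≢ x∈ refl with ∈-map⁻ suc x∈
    ... | _ , _ , ()

-- Monochromatic paths and their splitting at the new vertex

record ColouredPath (B : Board) (c : Colour) (p : List (Vertex (graph B))) : Set where
  constructor coloured
  field
    linked : Linked (Adj (graph B)) p
    unique : Unique p
    colour : All (λ x → col B x ≡ c) p
open ColouredPath public

≡ᵇ-refl : ∀ n → (n ≡ᵇ n) ≡ true
≡ᵇ-refl zero = refl
≡ᵇ-refl (suc n) = ≡ᵇ-refl n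

≡ᵇ-sound : ∀ m n → (m ≡ᵇ n) ≡ true → m ≡ n
≡ᵇ-sound zero zero _ = refl
≡ᵇ-sound (suc m) (suc n) e = cong suc (≡ᵇ-sound m n e)

linked-tabulate : ∀ {A : Set} {R : A → A → Set} {n} (f : Fin n → A) →
                  (∀ i j → suc (toℕ i) ≡ toℕ j → R (f i) (f j)) → Linked R (tabulate f)
linked-tabulate {n = zero} f r = []
linked-tabulate {n = suc zero} f r = [-]
linked-tabulate {n = suc (suc n)} f r =
  r zero (suc zero) refl ∷ linked-tabulate (λ i → f (suc i)) (λ i j e → r (suc i) (suc j) (cong suc e))

copy→path : ∀ {B n c} → CopyWith (Path n) (graph B) (λ x → col B x ≡ c) → ∃ λ p → length p ≡ n × ColouredPath B c p
copy→path {B} {n} copy = tabulate φ , ListP.length-tabulate φ , coloured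
  (linked-tabulate {R = Adj (graph B)} φ (λ i j e → φ-edge i j
    (subst (λ x → (suc (toℕ i) ≡ᵇ x) ∨ (suc x ≡ᵇ toℕ i) ≡ true) e (cong (_∨ (suc (suc (toℕ i)) ≡ᵇ toℕ i)) (≡ᵇ-refl (suc (toℕ i)))))))
  (UniqueP.tabulate⁺ φ-inj) (AllP.tabulate⁺ φ-prop)
  where open CopyWith copy

linked-consecutive : ∀ {A : Set} {R : A → A → Set} {xs : List A} → Linked R xs →
                     ∀ i j → suc (toℕ i) ≡ toℕ j → R (lookup xs i) (lookup xs j)
linked-consecutive (r ∷ l) zero (suc zero) e = r
linked-consecutive (r ∷ l) (suc i) (suc j) e = linked-consecutive l i j (cong pred e)

path→copy : ∀ {B c p} n → Symmetric (graph B) → n ≤ length p → ColouredPath B c p →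
            CopyWith (Path n) (graph B) (λ x → col B x ≡ c)
path→copy {B} {c} {p} n s n≤ (coloured l u a) = record
  { φ = φ
  ; φ-inj = λ {i} {j} e → FinP.toℕ-injective (trans (sym (FinP.toℕ-inject≤ i n≤))
      (trans (cong toℕ (lookup-injective u _ _ e)) (FinP.toℕ-inject≤ j n≤)))
  ; φ-edge = edge
  ; φ-prop = λ i → All.lookup a (∈-lookup {xs = p} (inject≤ i n≤))
  }
  where
  φ : Fin n → Vertex (graph B)
  φ i = lookup p (inject≤ i n≤)
  consecutive : ∀ i j → suc (toℕ i) ≡ toℕ j → Adj (graph B) (φ i) (φ j)
  consecutive i j e = linked-consecutive l _ _
    (trans (cong suc (FinP.toℕ-inject≤ i n≤)) (trans e (sym (FinP.toℕ-inject≤ j n≤))))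
  edge : ∀ i j → (suc (toℕ i) ≡ᵇ toℕ j) ∨ (suc (toℕ j) ≡ᵇ toℕ i) ≡ true → Adj (graph B) (φ i) (φ j)
  edge i j e with suc (toℕ i) ≡ᵇ toℕ j in eq
  ... | true = consecutive i j (≡ᵇ-sound _ _ eq)
  ... | false = s _ _ (consecutive j i (≡ᵇ-sound _ _ e))

-- The new vertex has index zero and occurs at most once in a list without repetition, so everything
-- around it is old.
data ZeroSplit {n : ℕ} : List (Fin (suc n)) → Set where
  avoids : ∀ p → ZeroSplit (map suc p)
  passes : ∀ p q → ZeroSplit (map suc p ++ zero ∷ map suc q)

unsuc : ∀ {n} (p : List (Fin (suc n))) → (∀ {x} → x ∈ p → x ≢ zero) → ∃ λ q → p ≡ map suc q
unsuc [] _ = [] , refl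
unsuc (zero ∷ p) nz = ⊥-elim (nz (here refl) refl)
unsuc (suc x ∷ p) nz with unsuc p (λ y∈ → nz (there y∈))
... | q , refl = x ∷ q , refl

zero-split : ∀ {n} (p : List (Fin (suc n))) → Unique p → ZeroSplit p
zero-split [] _ = avoids []
zero-split (zero ∷ p) (z∉ ∷ _) with unsuc p (λ x∈ x≡0 → All.lookup z∉ x∈ (sym x≡0))
... | q , refl = passes [] q
zero-split (suc x ∷ p) (_ ∷ u) with zero-split p u
... | avoids q = avoids (x ∷ q)
... | passes q r = passes (x ∷ q) r

linked-drop : ∀ {A : Set} {R : A → A → Set} (xs : List A) {ys} → Linked R (xs ++ ys) → Linked R ys
linked-drop [] l = l
linked-drop (x ∷ xs) l = linked-drop xs (Linked.tail l)

unique-drop : ∀ {A : Set} (xs : List A) {ys} → Unique (xs ++ ys) → Unique ys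
unique-drop [] u = u
unique-drop (x ∷ xs) (_ ∷ u) = unique-drop xs u

unique-take : ∀ {A : Set} (xs : List A) {ys} → Unique (xs ++ ys) → Unique xs
unique-take [] u = []
unique-take (x ∷ xs) (x∉ ∷ u) = AllP.++⁻ˡ xs x∉ ∷ unique-take xs u

unique-apart : ∀ {A : Set} (xs : List A) {ys} → Unique (xs ++ ys) → ∀ {x} → x ∈ xs → x ∉ ys
unique-apart (x ∷ xs) (x∉ ∷ u) (here refl) y∈ = All.lookup x∉ (∈-++⁺ʳ xs y∈) refl
unique-apart (x ∷ xs) (_ ∷ u) (there x∈) y∈ = unique-apart xs u x∈ y∈

connected : ∀ {G} → Symmetric G → ∀ {xs x y} → Linked (Adj G) xs → x ∈ xs → y ∈ xs → Reach G x y
connected {G} sym {_ ∷ _} l x∈ y∈ = reach-trans (reach-sym sym (from-head l x∈)) (from-head l y∈)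
  where
  from-head : ∀ {x y xs} → Linked (Adj G) (x ∷ xs) → y ∈ x ∷ xs → Reach G x y
  from-head l (here refl) = here
  from-head (a ∷ l) (there y∈) = there a (from-head l y∈)

module _ (G : Graph) (S : Vertex G → Bool) where
  private
    G′ : Graph
    G′ = extendGraph G S
    V : Set
    V = Vertex G

  Touches : List V → Set
  Touches p = p ≡ [] ⊎ ∃ λ u → u ∈ p × S u ≡ true

  linked-right : ∀ q → Linked (Adj G′) (zero ∷ map suc q) → Linked (Adj G) q × Touches q
  linked-right [] _ = [] , inj₁ refl
  linked-right (y ∷ q) (a ∷ l) = LinkedP.map⁻ l , inj₂ (y , here refl , a)

  linked-left : ∀ p q → Linked (Adj G′) (map suc p ++ zero ∷ map suc q) → Linked (Adj G) p × Touches p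
  linked-left [] q _ = [] , inj₁ refl
  linked-left (x ∷ []) q (a ∷ _) = [-] , inj₂ (x , here refl , a)
  linked-left (x ∷ y ∷ p) q (a ∷ l) with linked-left (y ∷ p) q l
  ... | l′ , inj₂ (u , u∈ , Su) = a ∷ l′ , inj₂ (u , there u∈ , Su)

-- Painter's side

module Arms (B : Board) (S : Vertex (graph B) → Bool) (c : Colour) where
  private
    G G′ : Graph
    G = graph B
    G′ = extendGraph G S
    V : Set
    V = Vertex G

  record Arm (d : Colour) (p : List V) : Set where
    field
      path    : ColouredPath B d p
      touches : Touches G S p

  avoiding : ∀ {d} p → ColouredPath (extend B S c) d (map suc p) → ColouredPath B d p
  avoiding p (coloured l u a) = coloured (LinkedP.map⁻ l) (UniqueP.map⁻ u) (AllP.map⁻ a)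

  record Through (d : Colour) (p q : List V) : Set where
    field
      left     : Arm d p
      right    : Arm d q
      disjoint : ∀ {x} → x ∈ p → x ∉ q
      new      : d ≡ c

  through : ∀ {d} p q → ColouredPath (extend B S c) d (map suc p ++ zero ∷ map suc q) → Through d p q
  through p q (coloured l u a) = record
    { left  = record { path = coloured (proj₁ left) (UniqueP.map⁻ (unique-take (map suc p) u)) (AllP.map⁻ (AllP.++⁻ˡ (map suc p) a)) ; touches = proj₂ left }
    ; right = record { path = coloured (proj₁ right) (UniqueP.map⁻ (unique-drop (map suc p ++ zero ∷ []) u′)) (AllP.map⁻ (All.tail (AllP.++⁻ʳ (map suc p) a))) ; touches = proj₂ right }
    ; disjoint = λ x∈ x∈′ → unique-apart (map suc p) u (∈-map⁺ suc x∈) (there (∈-map⁺ suc x∈′))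
    ; new = sym (All.head (AllP.++⁻ʳ (map suc p) a))
    }
    where
    left : Linked (Adj G) p × Touches G S p
    left = linked-left G S p q l
    right : Linked (Adj G) q × Touches G S q
    right = linked-right G S q (linked-drop (map suc p) l)
    u′ : Unique ((map suc p ++ zero ∷ []) ++ map suc q)
    u′ = subst Unique (sym (ListP.++-assoc (map suc p) (zero ∷ []) (map suc q))) u

module Invariant (k c : ℕ) (g : ℕ → ℕ) (g0 : g 0 ≡ 0) (0<c : 0 < c) where

  -- No path lies in a component lighter than the calculus predicts. The double negations allow a
  -- case split on whether an answer is bad without deciding it; this suffices, since survival is
  -- itself a negation.
  record Safe (B : Board) : Set where
    field
      symmetric : Symmetric (graph B)
      bounded   : ComponentsAtMost k (graph B)
      colour₁   : ∀ p u → ColouredPath B c1 p → u ∈ p →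
                  ¬ ¬ (∃ λ w → Build c g (length p) w × ComponentSize≥ (graph B) u w)
      colour₂   : ∀ p u → ColouredPath B c2 p → u ∈ p →
                  ¬ ¬ (length p < c × ComponentSize≥ (graph B) u (g (length p)))

  module Answer {B : Board} (safe : Safe B) (S : Vertex (graph B) → Bool) (forest : IsForest (extendGraph (graph B) S)) where
    open Safe safe
    private
      G G′ : Graph
      G = graph B
      G′ = extendGraph G S
      V : Set
      V = Vertex G

    -- The share of the new component that enters through neighbours on `p`. Shares of disjoint arms
    -- are disjoint by `neighbours-apart`, so `both` may add them.
    Hanging : List V → ℕ → Set
    Hanging p m = ∃ λ L → Unique L × (∀ {x} → x ∈ L → ∃ λ u → u ∈ p × S u ≡ true × Reach G u x) × m ≤ length L

    nothing-hangs : ∀ p → Hanging p 0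
    nothing-hangs p = [] , [] , (λ ()) , z≤n

    hang : ∀ {p u m} → u ∈ p → S u ≡ true → ComponentSize≥ G u m → Hanging p m
    hang {u = u} u∈ Su (L , uniq , reach , m≤) = L , uniq , (λ x∈ → u , u∈ , Su , reach x∈) , m≤

    arm₁ : ∀ {c′ p} → Arms.Arm B S c′ c1 p → ¬ ¬ (∃ λ w → Build c g (length p) w × Hanging p w)
    arm₁ {p = p} a k with Arms.Arm.touches a
    ... | inj₁ refl = k (0 , nil , nothing-hangs [])
    ... | inj₂ (u , u∈ , Su) = colour₁ p u (Arms.Arm.path a) u∈ λ { (w , b , s) → k (w , b , hang u∈ Su s) }

    arm₂ : ∀ {c′ p} → Arms.Arm B S c′ c2 p → ¬ ¬ (length p < c × Hanging p (g (length p)))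
    arm₂ {p = p} a k with Arms.Arm.touches a
    ... | inj₁ refl = k (0<c , subst (Hanging []) (sym g0) (nothing-hangs []))
    ... | inj₂ (u , u∈ , Su) = colour₂ p u (Arms.Arm.path a) u∈ λ { (lt , s) → k (lt , hang u∈ Su s) }

    both : ∀ {p q m n} → (∀ {x} → x ∈ p → x ∉ q) → Hanging p m → Hanging q n → Hanging (p ++ q) (m + n)
    both {p} {q} apart (L , uL , rL , m≤) (M , uM , rM , n≤) =
      L ++ M , UniqueP.++⁺ uL uM (λ (x∈L , x∈M) → disjoint x∈L x∈M) , reach ,
      ≤-trans (+-mono-≤ m≤ n≤) (≤-reflexive (sym (ListP.length-++ L)))
      where
      disjoint : ∀ {x} → x ∈ L → x ∉ M
      disjoint x∈L x∈M with rL x∈L | rM x∈M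
      ... | u , u∈ , Su , ru | v , v∈ , Sv , rv =
        apart u∈ (subst (_∈ q) (sym (neighbours-apart S forest Su Sv (reach-trans ru (reach-sym symmetric rv)))) v∈)
      reach : ∀ {x} → x ∈ L ++ M → ∃ λ u → u ∈ p ++ q × S u ≡ true × Reach G u x
      reach x∈ with ∈-++⁻ L x∈
      ... | inj₁ x∈L with rL x∈L
      ...   | u , u∈ , rest = u , ∈-++⁺ˡ u∈ , rest
      reach x∈ | inj₂ x∈M with rM x∈M
      ...   | u , u∈ , rest = u , ∈-++⁺ʳ p u∈ , rest

    attach : ∀ {p m} → Hanging p m → ComponentSize≥ G′ zero (suc m)
    attach {p} {m} (L , uniq , reach , m≤) =
      zero ∷ map suc L , All.tabulate zero≢ ∷ UniqueP.map⁺ FinP.suc-injective uniq , reach′ ,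
      s≤s (≤-trans m≤ (≤-reflexive (sym (ListP.length-map suc L))))
      where
      zero≢ : ∀ {x} → x ∈ map Fin.suc L → zero ≢ x
      zero≢ x∈ refl with ∈-map⁻ suc x∈
      ... | _ , _ , ()
      reach′ : ∀ {x} → x ∈ zero ∷ map suc L → Reach G′ zero x
      reach′ (here refl) = here
      reach′ (there x∈) with ∈-map⁻ suc x∈
      ... | y , y∈ , refl with reach y∈
      ... | u , _ , Su , r = there Su (reach-extend S r)

    same-component : ∀ {p q : List V} {d c′ x} → ColouredPath (extend B S c′) d (map suc p ++ zero ∷ map suc q) →
                     x ∈ map suc p ++ zero ∷ map suc q → Reach G′ x zero
    same-component {p} (coloured l u a) x∈ = connected (extend-symmetric {G} S symmetric) l x∈ (∈-++⁺ʳ (map suc p) (here refl))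

    module _ (bounded′ : ComponentsAtMost k G′) where
      private
        Path₁ Path₂ : Set
        Path₁ = ∃ λ p → ∃ λ q → ColouredPath (extend B S c1) c1 (map suc p ++ zero ∷ map suc q) ×
                ¬ (∃ λ w → Build c g (length (map Fin.suc p ++ zero ∷ map suc q)) w × ComponentSize≥ G′ zero w)
        Path₂ = ∃ λ p → ∃ λ q → ColouredPath (extend B S c2) c2 (map suc p ++ zero ∷ map suc q) ×
                ¬ (length (map Fin.suc p ++ zero ∷ map suc q) < c × ComponentSize≥ G′ zero (g (length (map Fin.suc p ++ zero ∷ map suc q))))

        length-split : ∀ (p q : List V) → suc (length p + length q) ≡ length (map Fin.suc p ++ zero ∷ map suc q)
        length-split p q = sym (trans (ListP.length-++ (map Fin.suc p)) (trans (cong₂ _+_ (ListP.length-map Fin.suc p) (cong suc (ListP.length-map Fin.suc q))) (+-suc _ _)))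

        colours-apart : ∀ {p q} → ColouredPath B c1 p → ColouredPath B c2 q → ∀ {x} → x ∈ p → x ∉ q
        colours-apart P Q x∈p x∈q with trans (sym (All.lookup (colour P) x∈p)) (All.lookup (colour Q) x∈q)
        ... | ()

        -- If both answers were bad, the arms of the two new paths would form an admissible join.
        not-both : Path₁ → Path₂ → ⊥
        not-both (p₁ , q₁ , P , bad₁) (p₂ , q₂ , Q , bad₂) =
          arm₁ {c1} left₁ λ { (w₁ , b₁ , h₁) → arm₁ {c1} right₁ λ { (w₂ , b₂ , h₂) →
          arm₂ {c2} left₂ λ { (lt₁ , h₃) → arm₂ {c2} right₂ λ { (lt₂ , h₄) → clash b₁ b₂ lt₁ lt₂ h₁ h₂ h₃ h₄ } } } }
          where
          open Arms.Through (Arms.through B S c1 p₁ q₁ P) renaming (left to left₁; right to right₁; disjoint to disjoint₁) hiding (new)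
          open Arms.Through (Arms.through B S c2 p₂ q₂ Q) renaming (left to left₂; right to right₂; disjoint to disjoint₂) hiding (new)
          apart : ∀ {x} → x ∈ p₁ ++ q₁ → x ∉ p₂ ++ q₂
          apart x∈ y∈ with ∈-++⁻ p₁ x∈ | ∈-++⁻ p₂ y∈
          ... | inj₁ a | inj₁ b = colours-apart (Arms.Arm.path left₁) (Arms.Arm.path left₂) a b
          ... | inj₁ a | inj₂ b = colours-apart (Arms.Arm.path left₁) (Arms.Arm.path right₂) a b
          ... | inj₂ a | inj₁ b = colours-apart (Arms.Arm.path right₁) (Arms.Arm.path left₂) a b
          ... | inj₂ a | inj₂ b = colours-apart (Arms.Arm.path right₁) (Arms.Arm.path right₂) a b
          clash : ∀ {w₁ w₂} → Build c g (length p₁) w₁ → Build c g (length q₁) w₂ → length p₂ < c → length q₂ < c →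
                  Hanging p₁ w₁ → Hanging q₁ w₂ → Hanging p₂ (g (length p₂)) → Hanging q₂ (g (length q₂)) → ⊥
          clash {w₁} {w₂} b₁ b₂ lt₁ lt₂ h₁ h₂ h₃ h₄ =
            bad₁ (S′ , subst (λ n → Build c g n S′) (length-split p₁ q₁) (join b₁ b₂ (length p₂) (length q₂) lt₁ lt₂ free) , large)
            where
            S′ : ℕ
            S′ = suc (w₁ + w₂ + (g (length p₂) + g (length q₂)))
            large : ComponentSize≥ G′ zero S′
            large = attach (both apart (both disjoint₁ h₁ h₂) (both disjoint₂ h₃ h₄))
            free : Free c (suc (length p₂ + length q₂)) (g (suc (length p₂ + length q₂))) S′
            free with c ≤? suc (length p₂ + length q₂) | S′ <? g (suc (length p₂ + length q₂))
            ... | yes c≤ | _ = inj₁ c≤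
            ... | no _ | yes S< = inj₂ S<
            ... | no c≰ | no S≮ = ⊥-elim (bad₂ (subst (λ n → n < c × ComponentSize≥ G′ zero (g n)) (length-split p₂ q₂)
                                     (≰⇒> c≰ , component-≤ (≮⇒≥ S≮) large)))

        old₁ : ∀ {c′} p u → ColouredPath (extend B S c′) c1 (map suc p) → u ∈ map suc p →
               ¬ ¬ (∃ λ w → Build c g (length (map Fin.suc p)) w × ComponentSize≥ G′ u w)
        old₁ {c′} p u P u∈ k with ∈-map⁻ suc u∈
        ... | v , v∈ , refl = colour₁ p v (Arms.avoiding B S c′ p P) v∈
          λ { (w , b , s) → k (w , subst (λ n → Build c g n w) (sym (ListP.length-map Fin.suc p)) b , component-extend S s) }

        old₂ : ∀ {c′} p u → ColouredPath (extend B S c′) c2 (map suc p) → u ∈ map suc p →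
               ¬ ¬ (length (map Fin.suc p) < c × ComponentSize≥ G′ u (g (length (map Fin.suc p))))
        old₂ {c′} p u P u∈ k with ∈-map⁻ suc u∈
        ... | v , v∈ , refl = colour₂ p v (Arms.avoiding B S c′ p P) v∈
          λ { (lt , s) → k (subst (λ n → n < c × ComponentSize≥ G′ (suc v) (g n)) (sym (ListP.length-map Fin.suc p)) (lt , component-extend S s)) }

        safe₂ : Path₁ → Safe (extend B S c2)
        safe₂ path₁ = record { symmetric = extend-symmetric {G} S symmetric ; bounded = bounded′ ; colour₁ = col₁ ; colour₂ = col₂ }
          where
          col₁ : ∀ p u → ColouredPath (extend B S c2) c1 p → u ∈ p → ¬ ¬ (∃ λ w → Build c g (length p) w × ComponentSize≥ G′ u w)
          col₁ p u P u∈ with zero-split p (unique P)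
          ... | avoids p′ = old₁ {c2} p′ u P u∈
          ... | passes p′ q′ with Arms.Through.new (Arms.through B S c2 p′ q′ P)
          ...   | ()
          col₂ : ∀ p u → ColouredPath (extend B S c2) c2 p → u ∈ p → ¬ ¬ (length p < c × ComponentSize≥ G′ u (g (length p)))
          col₂ p u P u∈ bad with zero-split p (unique P)
          ... | avoids p′ = old₂ {c2} p′ u P u∈ bad
          ... | passes p′ q′ = not-both path₁ (p′ , q′ , P , λ { (lt , s) → bad (lt , component-move (same-component {d = c2} {c′ = c2} P u∈) s) })

        -- A bad colour-1 path through the new vertex would make answer 2 safe by `safe₂`, contrary
        -- to the assumption.
        safe₁ : (Safe (extend B S c2) → ⊥) → Safe (extend B S c1)
        safe₁ unsafe₂ = record { symmetric = extend-symmetric {G} S symmetric ; bounded = bounded′ ; colour₁ = col₁ ; colour₂ = col₂ }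
          where
          col₁ : ∀ p u → ColouredPath (extend B S c1) c1 p → u ∈ p → ¬ ¬ (∃ λ w → Build c g (length p) w × ComponentSize≥ G′ u w)
          col₁ p u P u∈ bad with zero-split p (unique P)
          ... | avoids p′ = old₁ {c1} p′ u P u∈ bad
          ... | passes p′ q′ = unsafe₂ (safe₂ (p′ , q′ , P , λ { (w , b , s) → bad (w , b , component-move (same-component {d = c1} {c′ = c1} P u∈) s) }))
          col₂ : ∀ p u → ColouredPath (extend B S c1) c2 p → u ∈ p → ¬ ¬ (length p < c × ComponentSize≥ G′ u (g (length p)))
          col₂ p u P u∈ with zero-split p (unique P)
          ... | avoids p′ = old₂ {c1} p′ u P u∈
          ... | passes p′ q′ with Arms.Through.new (Arms.through B S c1 p′ q′ P)
          ...   | ()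

      one-answer-safe : (∀ c′ → Safe (extend B S c′) → ⊥) → ⊥
      one-answer-safe unsafe = unsafe c1 (safe₁ (unsafe c2))

  -- Induction on Builder's strategy, following a safe answer at each move. On a safe board a
  -- colour-1 path on `ℓ` vertices would need a component larger than `k`, and colour-2 paths stay
  -- shorter than `c`.
  survives : ∀ {ℓ} → 0 < ℓ → (∀ w → Build c g ℓ w → k < w) → ∀ {B} → Safe B → ¬ BuilderWins k (Path ℓ) (Path c) B
  survives 0<ℓ heavy {B} safe (lost (inj₁ copy)) with copy→path {B} copy
  ... | [] , refl , _ = <⇒≱ 0<ℓ z≤n
  ... | p@(u ∷ _) , refl , P = Safe.colour₁ safe p u P (here refl)
        λ { (w , b , s) → <⇒≱ (heavy w b) (component-bound (Safe.bounded safe) s) }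
  survives 0<ℓ heavy {B} safe (lost (inj₂ copy)) with copy→path {B} copy
  ... | [] , refl , _ = <⇒≱ 0<c z≤n
  ... | p@(u ∷ _) , len , P = Safe.colour₂ safe p u P (here refl) λ { (lt , _) → <⇒≢ lt len }
  survives 0<ℓ heavy safe (move S (forest , bounded′) answer) =
    Answer.one-answer-safe safe S forest bounded′ (λ c′ safe′ → survives 0<ℓ heavy safe′ (answer c′))

  empty-safe : Safe emptyBoard
  empty-safe = record
    { symmetric = λ ()
    ; bounded = λ ()
    ; colour₁ = λ { _ () }
    ; colour₂ = λ { _ () }
    }

-- Builder's side

data Starts {A : Set} : List A → A → Set where
  start : ∀ {x xs} → Starts (x ∷ xs) x

-- Cycles as lists, so that `ZeroSplit` can locate the new vertex in them.
record Round (H : Graph) (l : List (Vertex H)) : Set where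
  constructor round
  field
    {first final} : Vertex H
    linked : Linked (Adj H) l
    unique : Unique l
    starts : Starts l first
    ends   : Ends l final
    closed : Adj H final first
    long   : 3 ≤ length l

round→cycle : ∀ {H l} → Round H l → Cycle H
round→cycle {H} {x ∷ y ∷ z ∷ zs} (round l u start e a _) = record
  { m = length zs
  ; v = lookup (x ∷ y ∷ z ∷ zs)
  ; v-inj = λ {i} {j} → lookup-injective u i j
  ; v-con = linked-lookup {R = Adj H} l
  ; v-cls = subst (λ t → Adj H t x) (sym (ends-lookup e)) a
  }
round→cycle {l = _ ∷ []} (round _ _ _ _ _ (s≤s ()))
round→cycle {l = _ ∷ _ ∷ []} (round _ _ _ _ _ (s≤s (s≤s ())))

ends-tabulate : ∀ {A : Set} n (f : Fin (suc n) → A) → Ends (tabulate f) (f (fromℕ n))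
ends-tabulate zero f = one
ends-tabulate (suc n) f = more (ends-tabulate n (λ i → f (suc i)))

linked-tabulate₁ : ∀ {A : Set} {R : A → A → Set} n (f : Fin (suc n) → A) →
                   (∀ (i : Fin n) → R (f (inject₁ i)) (f (suc i))) → Linked R (tabulate f)
linked-tabulate₁ zero f r = [-]
linked-tabulate₁ (suc n) f r = r zero ∷ linked-tabulate₁ n (λ i → f (suc i)) (λ i → r (suc i))

cycle→round : ∀ {H} → Cycle H → ∃ λ l → Round H l
cycle→round {H} c = _ , round (linked-tabulate₁ {R = Adj H} _ v v-con) (UniqueP.tabulate⁺ v-inj) start (ends-tabulate _ v) v-cls
  (s≤s (s≤s (s≤s z≤n)))
  where open Cycle c

ends-drop : ∀ {A : Set} (xs : List A) {y ys w} → Ends (xs ++ y ∷ ys) w → Ends (y ∷ ys) w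
ends-drop [] e = e
ends-drop (x ∷ []) (more e) = e
ends-drop (x ∷ x′ ∷ xs) (more e) = ends-drop (x′ ∷ xs) e

ends-exists : ∀ {A : Set} (x : A) xs → ∃ λ z → Ends (x ∷ xs) z
ends-exists x [] = x , one
ends-exists x (y ∷ ys) with ends-exists y ys
... | z , e = z , more e

ends-unmap : ∀ {n} (q : List (Fin n)) {w} → Ends (map Fin.suc q) w → ∃ λ w′ → w ≡ suc w′ × Ends q w′
ends-unmap (x ∷ []) one = x , refl , one
ends-unmap (x ∷ y ∷ q) (more e) with ends-unmap (y ∷ q) e
... | w′ , eq , e′ = w′ , eq , more e′

ends-unique : ∀ {A : Set} {x y : A} {ys w} → Unique (x ∷ y ∷ ys) → Ends (x ∷ y ∷ ys) w → x ≢ w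
ends-unique (x∉ ∷ _) (more e) = All.lookup x∉ (ends-∈ e)

-- A cycle through the new vertex leaves an old path between two of its neighbours, which would have
-- to coincide. Since the list may start anywhere on the cycle, the new vertex can be first, last or
-- in between.
extend-forest : ∀ {G} → Symmetric G → IsForest G → (S : Vertex G → Bool) →
                (∀ {u v} → S u ≡ true → S v ≡ true → Reach G u v → u ≡ v) → IsForest (extendGraph G S)
extend-forest {G} symG forest S apart cycle = no-round _ (zero-split _ (Round.unique (proj₂ (cycle→round cycle)))) (proj₂ (cycle→round cycle))
  where
  G′ : Graph
  G′ = extendGraph G S
  end-touches : ∀ p q {u} → Linked (Adj G′) (map suc p ++ zero ∷ map suc q) → Ends p u → S u ≡ true
  end-touches (u ∷ []) q (a ∷ _) one = a
  end-touches (x ∷ y ∷ p) q (_ ∷ l) (more e) = end-touches (y ∷ p) q l e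

  no-round : ∀ l → ZeroSplit l → Round G′ l → ⊥
  no-round _ (avoids []) (round l u () e a long)
  no-round _ (avoids p@(_ ∷ _)) (round l u start e a long) with ends-unmap p e
  ... | w , refl , e′ = forest (round→cycle (round (LinkedP.map⁻ l) (UniqueP.map⁻ u) start e′ a
                          (≤-trans long (≤-reflexive (ListP.length-map Fin.suc p)))))
  no-round _ (passes [] []) (round l u s e a (s≤s ()))
  no-round _ (passes [] (y ∷ [])) (round l u s e a (s≤s (s≤s ())))
  no-round _ (passes [] q@(y ∷ _ ∷ _)) (round (Sy ∷ l) (_ ∷ u) start (more e) a long) with ends-unmap q e
  ... | w , refl , e′ = ends-unique (UniqueP.map⁻ u) e′ (apart Sy a (connected symG (LinkedP.map⁻ l) (here refl) (ends-∈ e′)))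
  no-round _ (passes p@(x ∷ _) []) (round l u start e a long) with ends-drop (map suc p) e
  no-round _ (passes (x ∷ []) []) (round l u start e a (s≤s (s≤s ()))) | one
  no-round _ (passes p@(x ∷ y ∷ p′) []) (round l u start e a long) | one with ends-exists x (y ∷ p′)
  ... | w , e′ = ends-unique (UniqueP.map⁻ (unique-take (map suc p) u)) e′
        (apart a (end-touches p [] l e′) (connected symG (proj₁ (linked-left G S p [] l)) (here refl) (ends-∈ e′)))
  no-round _ (passes p@(x ∷ p′) q@(y ∷ _)) (round l u start e a long) with ends-drop (map suc p) e
  ... | more e₁ with ends-unmap q e₁ | ends-exists x p′
  ... | w , refl , e₂ | v , e₃ = unique-apart (map suc p) u (∈-map⁺ suc (ends-∈ e₃)) (there (∈-map⁺ suc (subst (_∈ q) y≡v (here refl))))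
    where
    y≡v : y ≡ v
    y≡v = apart (Linked.head (linked-drop (map suc p) l)) (end-touches p q l e₃)
      (reach-trans (connected symG (proj₁ (linked-right G S q (linked-drop (map suc p) l))) (here refl) (ends-∈ e₂))
        (there a (connected symG (proj₁ (linked-left G S p q l)) (here refl) (ends-∈ e₃))))

ComponentSize≤ : (G : Graph) → Vertex G → ℕ → Set
ComponentSize≤ G u w = ∀ L → Unique L → (∀ {x} → x ∈ L → Reach G u x) → length L ≤ w

partition : ∀ {A : Set} {P Q : A → Set} (L : List A) → Unique L → (∀ {x} → x ∈ L → P x ⊎ Q x) →
            ∃ λ L₁ → ∃ λ L₂ → length L ≡ length L₁ + length L₂ × (Unique L₁ × (∀ {x} → x ∈ L₁ → x ∈ L × P x)) ×
            (Unique L₂ × (∀ {x} → x ∈ L₂ → x ∈ L × Q x))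
partition [] u f = [] , [] , refl , ([] , λ ()) , ([] , λ ())
partition {P = P} {Q} (x ∷ L) (x∉ ∷ u) f with partition L u (λ y∈ → f (there y∈)) | f (here refl)
... | L₁ , L₂ , eq , (u₁ , s₁) , (u₂ , s₂) | inj₁ px = x ∷ L₁ , L₂ , cong suc eq ,
      (All.tabulate (λ y∈ → All.lookup x∉ (proj₁ (s₁ y∈))) ∷ u₁ , λ { (here refl) → here refl , px ; (there y∈) → there (proj₁ (s₁ y∈)) , proj₂ (s₁ y∈) }) ,
      (u₂ , λ y∈ → there (proj₁ (s₂ y∈)) , proj₂ (s₂ y∈))
... | L₁ , L₂ , eq , (u₁ , s₁) , (u₂ , s₂) | inj₂ qx = L₁ , x ∷ L₂ , trans (cong suc eq) (sym (+-suc _ _)) ,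
      (u₁ , λ y∈ → there (proj₁ (s₁ y∈)) , proj₂ (s₁ y∈)) ,
      (All.tabulate (λ y∈ → All.lookup x∉ (proj₁ (s₂ y∈))) ∷ u₂ , λ { (here refl) → here refl , qx ; (there y∈) → there (proj₁ (s₂ y∈)) , proj₂ (s₂ y∈) })

olds : ∀ {n} (L : List (Fin (suc n))) → Unique L →
       ∃ λ M → Unique M × (∀ {x} → x ∈ M → suc x ∈ L) × length L ≤ suc (length M)
olds L u with zero-split L u
... | avoids M = M , UniqueP.map⁻ u , ∈-map⁺ suc , ≤-trans (≤-reflexive (ListP.length-map suc M)) (n≤1+n _)
... | passes M N = M ++ N ,
      UniqueP.++⁺ (UniqueP.map⁻ (unique-take (map suc M) u)) (UniqueP.map⁻ (unique-drop (map suc M ++ zero ∷ []) (subst Unique (sym (ListP.++-assoc (map suc M) (zero ∷ []) (map suc N))) u)))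
        (λ (x∈ , y∈) → unique-apart (map suc M) u (∈-map⁺ suc x∈) (there (∈-map⁺ suc y∈))) ,
      mem , ≤-reflexive (trans (ListP.length-++ (map suc M)) (trans (cong₂ _+_ (ListP.length-map suc M) (cong suc (ListP.length-map suc N)))
        (trans (+-suc _ _) (cong suc (sym (ListP.length-++ M))))))
  where
  mem : ∀ {x} → x ∈ M ++ N → suc x ∈ map suc M ++ zero ∷ map suc N
  mem x∈ with ∈-++⁻ M x∈
  ... | inj₁ a = ∈-++⁺ˡ (∈-map⁺ suc a)
  ... | inj₂ b = ∈-++⁺ʳ (map suc M) (there (∈-map⁺ suc b))

module Attach {G : Graph} (symG : Symmetric G) (S : Vertex G → Bool) (us : List (Vertex G))
  (S-sound : ∀ {x} → S x ≡ true → x ∈ us) (S-complete : ∀ {x} → x ∈ us → S x ≡ true) where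

  private
    G′ : Graph
    G′ = extendGraph G S

  -- A walk may visit the new vertex several times; only the first entry and the last exit matter.
  from-new : ∀ {y} → Reach G′ zero (suc y) → ∃ λ u → u ∈ us × Reach G u y
  from-old : ∀ {x y} → Reach G′ (suc x) (suc y) → Reach G x y ⊎ ((∃ λ u → u ∈ us × Reach G x u) × ∃ λ u → u ∈ us × Reach G u y)
  from-new (there {w = suc w} Sw r) with from-old r
  ... | inj₁ old = w , S-sound Sw , old
  ... | inj₂ (_ , new) = new
  from-old here = inj₁ here
  from-old (there {w = zero} Sx r) = inj₂ ((_ , S-sound Sx , here) , from-new r)
  from-old (there {w = suc w} a r) with from-old r
  ... | inj₁ old = inj₁ (there a old)
  ... | inj₂ ((u , u∈ , old) , new) = inj₂ ((u , u∈ , there a old) , new)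

  to-new : ∀ {x} → Reach G′ (suc x) zero → ∃ λ u → u ∈ us × Reach G x u
  to-new (there {w = zero} Sx r) = _ , S-sound Sx , here
  to-new (there {w = suc w} a r) with to-new r
  ... | u , u∈ , old = u , u∈ , there a old

  count : ∀ vs ws → Pointwise (ComponentSize≤ G) vs ws → ∀ L → Unique L →
          (∀ {x} → x ∈ L → ∃ λ u → u ∈ vs × Reach G u x) → length L ≤ sum ws
  count [] [] [] [] u f = z≤n
  count [] [] [] (x ∷ L) u f with f (here refl)
  ... | _ , () , _
  count (v ∷ vs) (w ∷ ws) (b ∷ bs) L u f with partition {P = Reach G v} {Q = λ x → ∃ λ u → u ∈ vs × Reach G u x} L u split
    where
    split : ∀ {x} → x ∈ L → Reach G v x ⊎ ∃ λ u → u ∈ vs × Reach G u x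
    split x∈ with f x∈
    ... | _ , here refl , r = inj₁ r
    ... | u , there u∈ , r = inj₂ (u , u∈ , r)
  ... | L₁ , L₂ , eq , (u₁ , s₁) , (u₂ , s₂) = ≤-trans (≤-reflexive eq)
        (+-mono-≤ (b L₁ u₁ (λ x∈ → proj₂ (s₁ x∈))) (count vs ws bs L₂ u₂ (λ x∈ → proj₂ (s₂ x∈))))

  new-component : ∀ {ws} → Pointwise (ComponentSize≤ G) us ws → ComponentSize≤ G′ zero (suc (sum ws))
  new-component {ws} bs L u f with olds L u
  ... | M , uM , mem , le = ≤-trans le (s≤s (count us ws bs M uM (λ x∈ → from-new (f (mem x∈)))))

  Away : Vertex G → Set
  Away x = ∀ {u} → u ∈ us → ¬ Reach G x u

  old-component : ∀ {x w} → Away x → ComponentSize≤ G x w → ComponentSize≤ G′ (suc x) w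
  old-component {x} {w} away b L u f = bound L refl u f
    where
    bound : ∀ L′ → L′ ≡ L → Unique L′ → (∀ {y} → y ∈ L′ → Reach G′ (suc x) y) → length L′ ≤ w
    bound L′ _ u f with zero-split L′ u
    ... | passes p q = ⊥-elim (away (proj₁ (proj₂ hit)) (proj₂ (proj₂ hit)))
      where hit = to-new (f (∈-++⁺ʳ (map suc p) (here refl)))
    ... | avoids p = ≤-trans (≤-reflexive (ListP.length-map suc p)) (b p (UniqueP.map⁻ u) reach)
      where
      reach : ∀ {y} → y ∈ p → Reach G x y
      reach y∈ with from-old (f (∈-map⁺ suc y∈))
      ... | inj₁ old = old
      ... | inj₂ ((u , u∈ , r) , _) = ⊥-elim (away u∈ r)

  components : ∀ {k ws} → ComponentsAtMost k G → Pointwise (ComponentSize≤ G) us ws → suc (sum ws) ≤ k → ComponentsAtMost k G′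
  components {k} {ws} at-most bs ≤k u m f inj reach =
    ≤-trans (≤-reflexive (sym (ListP.length-tabulate f))) (bounded u (tabulate f) (UniqueP.tabulate⁺ inj) reach′)
    where
    sym′ : Symmetric G′
    sym′ = extend-symmetric {G} S symG
    reach′ : ∀ {x} → x ∈ tabulate f → Reach G′ u x
    reach′ x∈ with ∈-tabulate⁻ x∈
    ... | i , refl = reach i
    through-new : ∀ {u} → Reach G′ u zero → ∀ L → Unique L → (∀ {x} → x ∈ L → Reach G′ u x) → length L ≤ k
    through-new r L uL f = ≤-trans (new-component bs L uL (λ x∈ → reach-trans (reach-sym sym′ r) (f x∈))) ≤k
    joins-new : ∀ {x u} → u ∈ us → Reach G x u → Reach G′ (suc x) zero
    joins-new u∈ r = reach-trans (reach-extend S r) (there (S-complete u∈) here)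
    all-or-any : ∀ {P Q : Vertex G → Set} (L : List (Vertex G)) → (∀ {x} → x ∈ L → P x ⊎ Q x) → (∀ {x} → x ∈ L → P x) ⊎ ∃ Q
    all-or-any [] f = inj₁ λ ()
    all-or-any (x ∷ L) f with f (here refl) | all-or-any L (λ y∈ → f (there y∈))
    ... | inj₂ q | _ = inj₂ (x , q)
    ... | inj₁ _ | inj₂ q = inj₂ q
    ... | inj₁ p | inj₁ ps = inj₁ λ { (here refl) → p ; (there y∈) → ps y∈ }
    bounded : ∀ u L → Unique L → (∀ {x} → x ∈ L → Reach G′ u x) → length L ≤ k
    bounded zero L uL f = through-new here L uL f
    bounded (suc x) L uL f with zero-split L uL
    ... | passes p q = through-new (f (∈-++⁺ʳ (map suc p) (here refl))) _ uL f
    ... | avoids p with all-or-any {P = Reach G x} p (λ y∈ → from-old (f (∈-map⁺ suc y∈)))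
    ...   | inj₁ old = component-bound at-most (p , UniqueP.map⁻ uL , old , ≤-reflexive (ListP.length-map suc p))
    ...   | inj₂ (_ , (u , u∈ , r) , _) = through-new (joins-new u∈ r) _ uL f

-- Stocks of pieces and a single move

-- A component with at most weight vertices and a monochromatic path on reach vertices
-- that ends at a known vertex.
record Capability : Set where
  constructor cap
  field
    hue    : Colour
    reach  : ℕ
    weight : ℕ
open Capability

Piece : (B : Board) → Capability → Vertex (graph B) → Set
Piece B X u = ∃ λ p → length (u ∷ p) ≡ reach X × ColouredPath B (hue X) (u ∷ p) × ComponentSize≤ (graph B) u (weight X)

record Good (k : ℕ) (B : Board) : Set where
  field
    symmetric : Symmetric (graph B)
    forest    : IsForest (graph B)
    bounded   : ComponentsAtMost k (graph B)

-- Different indices lie in different components, so a new vertex may be joined to any selection of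
-- pieces without closing a cycle.
record Stock (B : Board) (I : Set) (κ : I → Capability) : Set where
  field
    endpoint : I → Vertex (graph B)
    piece    : ∀ i → Piece B (κ i) (endpoint i)
    apart    : ∀ i j → Reach (graph B) (endpoint i) (endpoint j) → i ≡ j

reindex : ∀ {B I J κ} (ι : J → I) → (∀ i j → ι i ≡ ι j → i ≡ j) → Stock B I κ → Stock B J (λ j → κ (ι j))
reindex ι inj stock = record
  { endpoint = λ j → endpoint (ι j) ; piece = λ j → piece (ι j) ; apart = λ i j r → inj i j (apart (ι i) (ι j) r) }
  where open Stock stock

recap : ∀ {B I κ κ′} → (∀ i → κ i ≡ κ′ i) → Stock B I κ → Stock B I κ′
recap {B} eq stock = record
  { endpoint = endpoint ; piece = λ i → subst (λ X → Piece B X (endpoint i)) (eq i) (piece i) ; apart = apart }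
  where open Stock stock

data Side (A : Set) : Set where
  none : Side A
  one  : A → Side A
  two  : A → A → Side A

members : ∀ {A} → Side A → List A
members none      = []
members (one x)   = x ∷ []
members (two x y) = x ∷ y ∷ []

total : ∀ {A : Set} → (A → ℕ) → Side A → ℕ
total f s = sum (map f (members s))

-- The first path is reversed onto the second, so that its free end becomes the head, the endpoint
-- at which later moves attach.
glue : ∀ {B d x y} xs ys → Symmetric (graph B) → Adj (graph B) x y →
       ColouredPath B d (x ∷ xs) → ColouredPath B d (y ∷ ys) → (∀ {z} → z ∈ x ∷ xs → z ∉ y ∷ ys) →
       ∃ λ u → ∃ λ p → u ∈ x ∷ xs × length (u ∷ p) ≡ length (x ∷ xs) + length (y ∷ ys) × ColouredPath B d (u ∷ p)
glue {B} {d} {x} {y} [] ys s a (coloured _ _ (cx ∷ [])) (coloured l u c) dis =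
  x , y ∷ ys , here refl , refl ,
  coloured (a ∷ l) (All.tabulate (λ z∈ x≡z → dis (here refl) (subst (_∈ y ∷ ys) (sym x≡z) z∈)) ∷ u) (cx ∷ c)
glue {B} {d} {x} {y} (x′ ∷ xs) ys s a (coloured (e ∷ l) (x∉ ∷ u) (cx ∷ cs)) Q dis
  with glue xs (y ∷ ys) s (s _ _ e) (coloured l u cs)
         (coloured (a ∷ linked Q) (All.tabulate (λ z∈ x≡z → dis (here refl) (subst (_∈ y ∷ ys) (sym x≡z) z∈)) ∷ unique Q) (cx ∷ colour Q))
         (λ { z∈ (here refl) → All.lookup x∉ z∈ refl ; z∈ (there z∈′) → dis (there z∈) z∈′ })
... | v , p , v∈ , len , P = v , p , there v∈ , trans len (+-suc (suc (length xs)) (suc (length ys))) , P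

-- The new vertex is attached to arms of both hues at once. The answer decides which of them form
-- the new path, but all of them count towards the component weight `T`.
module Advance {k : ℕ} {B : Board} (good : Good k B) {I : Set} {κ : I → Capability} (stock : Stock B I κ)
  (sides : Colour → Side I) (right-hue : ∀ d {i} → i ∈ members (sides d) → hue (κ i) ≡ d)
  (distinct : ∀ d → Unique (members (sides d)))
  (T : ℕ) (T≡ : suc (total (λ i → weight (κ i)) (sides c1) + total (λ i → weight (κ i)) (sides c2)) ≡ T) (T≤k : T ≤ k) where

  open Good good
  open Stock stock

  private
    G : Graph
    G = graph B

    used : List I
    used = members (sides c1) ++ members (sides c2)

    us : List (Vertex G)
    us = map endpoint used

    open DecMembership (FinP._≟_ {size G}) using (_∈?_)

  S : Vertex G → Bool
  S x = ⌊ x ∈? us ⌋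

  private
    G′ : Graph
    G′ = extendGraph G S

    S-sound : ∀ {x} → S x ≡ true → x ∈ us
    S-sound {x} e with x ∈? us
    ... | yes x∈ = x∈
    S-sound {x} () | no _

    S-complete : ∀ {x} → x ∈ us → S x ≡ true
    S-complete {x} x∈ with x ∈? us
    ... | yes _ = refl
    ... | no x∉ = ⊥-elim (x∉ x∈)

    open Attach symmetric S us S-sound S-complete

    us-apart : ∀ {u v} → S u ≡ true → S v ≡ true → Reach G u v → u ≡ v
    us-apart {u} {v} Su Sv r with ∈-map⁻ endpoint (S-sound {u} Su) | ∈-map⁻ endpoint (S-sound {v} Sv)
    ... | i , _ , refl | j , _ , refl = cong endpoint (apart i j r)

    weights : ∀ is → Pointwise (ComponentSize≤ G) (map endpoint is) (map (λ i → weight (κ i)) is)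
    weights [] = []
    weights (i ∷ is) = proj₂ (proj₂ (proj₂ (piece i))) ∷ weights is

    ws : List ℕ
    ws = map (λ i → weight (κ i)) used

    sum-ws : suc (sum ws) ≡ T
    sum-ws = trans (cong suc (trans (cong sum (ListP.map-++ (λ i → weight (κ i)) (members (sides c1)) (members (sides c2))))
               (sum-++ (map (λ i → weight (κ i)) (members (sides c1))) _))) T≡

    sym′ : Symmetric G′
    sym′ = extend-symmetric {G} S symmetric

    forest′ : IsForest G′
    forest′ = extend-forest symmetric forest S us-apart

    bounded′ : ComponentsAtMost k G′
    bounded′ = components bounded (weights used) (≤-trans (≤-reflexive sum-ws) T≤k)

  legal : Legal k B S
  legal = forest′ , bounded′

  good′ : ∀ d → Good k (extend B S d)
  good′ d = record { symmetric = sym′ ; forest = forest′ ; bounded = bounded′ }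

  private
    in-used : ∀ d {i} → i ∈ members (sides d) → i ∈ used
    in-used c1 i∈ = ∈-++⁺ˡ i∈
    in-used c2 i∈ = ∈-++⁺ʳ (members (sides c1)) i∈

    lifted : ∀ {d d′ p} → ColouredPath B d p → ColouredPath (extend B S d′) d (map suc p)
    lifted (coloured l u c) = coloured (LinkedP.map⁺ l) (UniqueP.map⁺ FinP.suc-injective u) (AllP.map⁺ c)

    zero∉ : ∀ {p : List (Vertex G)} → zero ∉ map Fin.suc p
    zero∉ z∈ with ∈-map⁻ suc z∈
    ... | _ , _ , ()

    from-zero : ∀ {d i} → i ∈ members (sides d) → ∀ {x} → Reach G (endpoint i) x → Reach G′ zero (suc x)
    from-zero {d} i∈ r = there (S-complete (∈-map⁺ endpoint (in-used d i∈))) (reach-extend S r)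

    with-new : ∀ d i → i ∈ members (sides d) → ∀ {p} → ColouredPath B (hue (κ i)) (endpoint i ∷ p) →
               ColouredPath (extend B S d) d (zero ∷ map suc (endpoint i ∷ p))
    with-new d i i∈ {p} P = coloured (S-complete (∈-map⁺ endpoint (in-used d i∈)) ∷ linked P′)
      (All.tabulate (λ z∈ z≡ → zero∉ {endpoint i ∷ p} (subst (_∈ map suc (endpoint i ∷ p)) (sym z≡) z∈)) ∷ unique P′) (refl ∷ colour P′)
      where
      P′ : ColouredPath (extend B S d) d (map suc (endpoint i ∷ p))
      P′ = lifted (subst (λ h → ColouredPath B h (endpoint i ∷ p)) (right-hue d i∈) P)

    new-path : ∀ d s → sides d ≡ s → ∃ λ u → ∃ λ p → length (u ∷ p) ≡ suc (total (λ i → reach (κ i)) s) ×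
               ColouredPath (extend B S d) d (u ∷ p) × Reach G′ zero u
    new-path d none eq = zero , [] , refl , coloured [-] ([] ∷ []) (refl ∷ []) , here
    new-path d (one i) eq with piece i
    ... | p , len , P , _ = zero , map suc (endpoint i ∷ p) ,
      cong suc (trans (ListP.length-map Fin.suc (endpoint i ∷ p)) (trans len (sym (+-identityʳ _)))) ,
      with-new d i (subst (λ s → i ∈ members s) (sym eq) (here refl)) P , here
    new-path d (two i j) eq with piece i | piece j
    ... | p , len , P , _ | q , len′ , Q , _ = finish
      (glue (map suc p) (map suc (endpoint j ∷ q)) sym′ (S-complete (∈-map⁺ endpoint (in-used d i∈)))
        (lifted (subst (λ h → ColouredPath B h (endpoint i ∷ p)) (right-hue d i∈) P)) (with-new d j j∈ Q) dis)
      where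
      i∈ : i ∈ members (sides d)
      i∈ = subst (λ s → i ∈ members s) (sym eq) (here refl)
      j∈ : j ∈ members (sides d)
      j∈ = subst (λ s → j ∈ members s) (sym eq) (there (here refl))
      i≢j : i ≢ j
      i≢j with subst (λ s → Unique (members s)) eq (distinct d)
      ... | (i≢j ∷ []) ∷ _ = i≢j
      dis : ∀ {z} → z ∈ map Fin.suc (endpoint i ∷ p) → z ∉ zero ∷ map suc (endpoint j ∷ q)
      dis z∈ (here refl) = zero∉ {endpoint i ∷ p} z∈
      dis z∈ (there z∈′) with ∈-map⁻ suc z∈ | ∈-map⁻ suc z∈′
      ... | a , a∈ , refl | b , b∈ , refl = i≢j (apart i j (reach-trans (connected symmetric (linked P) (here refl) a∈)
                                              (connected symmetric (linked Q) b∈ (here refl))))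
      finish : (∃ λ u → ∃ λ r → u ∈ map suc (endpoint i ∷ p) × length (u ∷ r) ≡ length (map Fin.suc (endpoint i ∷ p)) + suc (length (map Fin.suc (endpoint j ∷ q))) ×
                  ColouredPath (extend B S d) d (u ∷ r)) → _
      finish (u , r , u∈ , leng , R) = u , r ,
        trans leng (trans (cong₂ (λ a b → a + suc b) (trans (ListP.length-map Fin.suc (endpoint i ∷ p)) len) (trans (ListP.length-map Fin.suc (endpoint j ∷ q)) len′))
          (trans (+-suc _ _) (cong (λ b → suc (reach (κ i) + b)) (sym (+-identityʳ _))))) ,
        R , at u∈
        where
        at : ∀ {u} → u ∈ map suc (endpoint i ∷ p) → Reach G′ zero u
        at u∈ with ∈-map⁻ suc u∈
        ... | a , a∈ , refl = from-zero {d} i∈ (connected symmetric (linked P) (here refl) a∈)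

  produced : Colour → Capability
  produced d = cap d (suc (total (λ i → reach (κ i)) (sides d))) T

  gain : ∀ {J : Set} → (J → I) → Colour → Maybe J → Capability
  gain ι d nothing  = produced d
  gain ι d (just j) = κ (ι j)

  stock′ : ∀ {J : Set} (ι : J → I) → (∀ i j → ι i ≡ ι j → i ≡ j) → (∀ j → ι j ∉ used) →
           ∀ d → Stock (extend B S d) (Maybe J) (gain ι d)
  stock′ {J} ι inj avoid d = made (new-path d (sides d) refl)
    where
    away : ∀ j → Away (endpoint (ι j))
    away j u∈ r with ∈-map⁻ endpoint u∈
    ... | i , i∈ , refl = avoid j (subst (_∈ used) (sym (apart (ι j) i r)) i∈)

    made : (∃ λ u → ∃ λ p → length (u ∷ p) ≡ suc (total (λ i → reach (κ i)) (sides d)) ×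
             ColouredPath (extend B S d) d (u ∷ p) × Reach G′ zero u) → Stock (extend B S d) (Maybe J) (gain ι d)
    made (u , p , len , P , r₀) = record { endpoint = end ; piece = pc ; apart = ap }
      where
      end : Maybe J → Vertex G′
      end nothing  = u
      end (just j) = suc (endpoint (ι j))
      pc : ∀ i → Piece (extend B S d) (gain ι d i) (end i)
      pc nothing = p , len , P , λ L uL f → ≤-trans (new-component (weights used) L uL (λ x∈ → reach-trans r₀ (f x∈))) (≤-reflexive sum-ws)
      pc (just j) with piece (ι j)
      ... | q , len′ , Q , bound = map suc q , trans (cong suc (ListP.length-map Fin.suc q)) len′ , lifted Q , old-component (away j) bound
      not-new : ∀ j → ¬ Reach G′ zero (suc (endpoint (ι j)))
      not-new j r with from-new r
      ... | v , v∈ , r′ = away j v∈ (reach-sym symmetric r′)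
      ap : ∀ i j → Reach G′ (end i) (end j) → i ≡ j
      ap nothing nothing _ = refl
      ap nothing (just j) r = ⊥-elim (not-new j (reach-trans r₀ r))
      ap (just j) nothing r = ⊥-elim (not-new j (reach-sym sym′ (reach-trans r (reach-sym sym′ r₀))))
      ap (just i) (just j) r with from-old r
      ... | inj₁ r′ = cong just (inj i j (apart (ι i) (ι j) r′))
      ... | inj₂ ((v , v∈ , r′) , _) = ⊥-elim (away i v∈ r′)

open Capability

infixl 5 _▹_

_▹_ : {I : Set} → (I → Capability) → Capability → Maybe I → Capability
(κ ▹ X) nothing  = X
(κ ▹ X) (just i) = κ i

module Pigeonhole {I : Set} (κ : I → Capability) (X Y : Capability) where

  -- There are `M` copies of every capability at hand; `a` and `b` count the outcomes collected
  -- under the two answers.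
  Supply : ℕ → ℕ → ℕ → Set
  Supply M a b = (I × Fin M) ⊎ (Fin a ⊎ Fin b)

  worth : ∀ {M a b} → Supply M a b → Capability
  worth (inj₁ (i , _))  = κ i
  worth (inj₂ (inj₁ _)) = X
  worth (inj₂ (inj₂ _)) = Y

  -- Copies 0 and 1 are spent, so the two arms are different pieces even if they have the same
  -- capability.
  copies : ∀ {M a b} → Side I → Side (Supply (suc (suc M)) a b)
  copies none      = none
  copies (one i)   = one (inj₁ (i , zero))
  copies (two i j) = two (inj₁ (i , zero)) (inj₁ (j , suc zero))

  total-copies : ∀ {M a b} (f : Capability → ℕ) s → total (λ x → f (worth {suc (suc M)} {a} {b} x)) (copies s) ≡ total (λ i → f (κ i)) s
  total-copies f none      = refl
  total-copies f (one i)   = refl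
  total-copies f (two i j) = refl

  hue-copies : ∀ {M a b d} s → (∀ {i} → i ∈ members s → hue (κ i) ≡ d) → ∀ {x} → x ∈ members (copies {M} {a} {b} s) → hue (worth x) ≡ d
  hue-copies (one i) h (here refl) = h (here refl)
  hue-copies (two i j) h (here refl) = h (here refl)
  hue-copies (two i j) h (there (here refl)) = h (there (here refl))

  unique-copies : ∀ {M a b} s → Unique (members (copies {M} {a} {b} s))
  unique-copies none      = []
  unique-copies (one i)   = [] ∷ []
  unique-copies (two i j) = ((λ ()) ∷ []) ∷ ([] ∷ [])

  spare : ∀ {M a b} → Supply M a b → Supply (suc (suc M)) a b
  spare (inj₁ (i , n)) = inj₁ (i , suc (suc n))
  spare (inj₂ y)       = inj₂ y

  spare-injective : ∀ {M a b} (x y : Supply M a b) → spare x ≡ spare y → x ≡ y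
  spare-injective (inj₁ (i , n)) (inj₁ (.i , .n)) refl = refl
  spare-injective (inj₂ x) (inj₂ .x) refl = refl

  spare∉copies : ∀ {M a b} s (x : Supply M a b) → spare x ∉ members (copies s)
  spare∉copies (one i) (inj₁ x) (here ())
  spare∉copies (one i) (inj₂ x) (here ())
  spare∉copies (two i j) (inj₁ x) (here ())
  spare∉copies (two i j) (inj₁ x) (there (here ()))
  spare∉copies (two i j) (inj₂ x) (here ())
  spare∉copies (two i j) (inj₂ x) (there (here ()))

  store₁ : ∀ {M a b} → Supply M (suc a) b → Maybe (Supply M a b)
  store₁ (inj₁ x)              = just (inj₁ x)
  store₁ (inj₂ (inj₁ zero))    = nothing
  store₁ (inj₂ (inj₁ (suc n))) = just (inj₂ (inj₁ n))
  store₁ (inj₂ (inj₂ n))       = just (inj₂ (inj₂ n))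

  store₂ : ∀ {M a b} → Supply M a (suc b) → Maybe (Supply M a b)
  store₂ (inj₁ x)              = just (inj₁ x)
  store₂ (inj₂ (inj₁ n))       = just (inj₂ (inj₁ n))
  store₂ (inj₂ (inj₂ zero))    = nothing
  store₂ (inj₂ (inj₂ (suc n))) = just (inj₂ (inj₂ n))

  store₁-injective : ∀ {M a b} (x y : Supply M (suc a) b) → store₁ x ≡ store₁ y → x ≡ y
  store₁-injective (inj₁ x) (inj₁ .x) refl = refl
  store₁-injective (inj₂ (inj₁ zero)) (inj₂ (inj₁ zero)) refl = refl
  store₁-injective (inj₂ (inj₁ (suc n))) (inj₂ (inj₁ (suc .n))) refl = refl
  store₁-injective (inj₂ (inj₂ n)) (inj₂ (inj₂ .n)) refl = refl
  store₁-injective (inj₁ _) (inj₂ (inj₁ zero)) ()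
  store₁-injective (inj₁ _) (inj₂ (inj₁ (suc _))) ()
  store₁-injective (inj₁ _) (inj₂ (inj₂ _)) ()
  store₁-injective (inj₂ (inj₁ zero)) (inj₁ _) ()
  store₁-injective (inj₂ (inj₁ zero)) (inj₂ (inj₁ (suc _))) ()
  store₁-injective (inj₂ (inj₁ zero)) (inj₂ (inj₂ _)) ()
  store₁-injective (inj₂ (inj₁ (suc _))) (inj₁ _) ()
  store₁-injective (inj₂ (inj₁ (suc _))) (inj₂ (inj₁ zero)) ()
  store₁-injective (inj₂ (inj₁ (suc _))) (inj₂ (inj₂ _)) ()
  store₁-injective (inj₂ (inj₂ _)) (inj₁ _) ()
  store₁-injective (inj₂ (inj₂ _)) (inj₂ (inj₁ zero)) ()
  store₁-injective (inj₂ (inj₂ _)) (inj₂ (inj₁ (suc _))) ()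

  store₂-injective : ∀ {M a b} (x y : Supply M a (suc b)) → store₂ x ≡ store₂ y → x ≡ y
  store₂-injective (inj₁ x) (inj₁ .x) refl = refl
  store₂-injective (inj₂ (inj₂ zero)) (inj₂ (inj₂ zero)) refl = refl
  store₂-injective (inj₂ (inj₂ (suc n))) (inj₂ (inj₂ (suc .n))) refl = refl
  store₂-injective (inj₂ (inj₁ n)) (inj₂ (inj₁ .n)) refl = refl
  store₂-injective (inj₁ _) (inj₂ (inj₂ zero)) ()
  store₂-injective (inj₁ _) (inj₂ (inj₂ (suc _))) ()
  store₂-injective (inj₁ _) (inj₂ (inj₁ _)) ()
  store₂-injective (inj₂ (inj₂ zero)) (inj₁ _) ()
  store₂-injective (inj₂ (inj₂ zero)) (inj₂ (inj₂ (suc _))) ()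
  store₂-injective (inj₂ (inj₂ zero)) (inj₂ (inj₁ _)) ()
  store₂-injective (inj₂ (inj₂ (suc _))) (inj₁ _) ()
  store₂-injective (inj₂ (inj₂ (suc _))) (inj₂ (inj₂ zero)) ()
  store₂-injective (inj₂ (inj₂ (suc _))) (inj₂ (inj₁ _)) ()
  store₂-injective (inj₂ (inj₁ _)) (inj₁ _) ()
  store₂-injective (inj₂ (inj₁ _)) (inj₂ (inj₂ zero)) ()
  store₂-injective (inj₂ (inj₁ _)) (inj₂ (inj₂ (suc _))) ()

  deal₁ : ∀ {M a b N} → N ≤ M → N ≤ a → Maybe I × Fin N → Supply M a b
  deal₁ N≤M N≤a (just i , n)  = inj₁ (i , inject≤ n N≤M)
  deal₁ N≤M N≤a (nothing , n) = inj₂ (inj₁ (inject≤ n N≤a))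

  deal₂ : ∀ {M a b N} → N ≤ M → N ≤ b → Maybe I × Fin N → Supply M a b
  deal₂ N≤M N≤b (just i , n)  = inj₁ (i , inject≤ n N≤M)
  deal₂ N≤M N≤b (nothing , n) = inj₂ (inj₂ (inject≤ n N≤b))

  private
    inj₁-split : ∀ {A : Set} {M} {i j : I} {m n : Fin M} → _≡_ {A = (I × Fin M) ⊎ A} (inj₁ (i , m)) (inj₁ (j , n)) → i ≡ j × m ≡ n
    inj₁-split refl = refl , refl

    inj₂₁ : ∀ {A B : Set} {a} {m n : Fin a} → _≡_ {A = A ⊎ (Fin a ⊎ B)} (inj₂ (inj₁ m)) (inj₂ (inj₁ n)) → m ≡ n
    inj₂₁ refl = refl

    inj₂₂ : ∀ {A B : Set} {a} {m n : Fin a} → _≡_ {A = A ⊎ (B ⊎ Fin a)} (inj₂ (inj₂ m)) (inj₂ (inj₂ n)) → m ≡ n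
    inj₂₂ refl = refl

  deal₁-injective : ∀ {M a b N} (N≤M : N ≤ M) (N≤a : N ≤ a) x y → deal₁ {b = b} N≤M N≤a x ≡ deal₁ N≤M N≤a y → x ≡ y
  deal₁-injective N≤M N≤a (just i , m) (just j , n) e with inj₁-split e
  ... | refl , e′ = cong (just i ,_) (FinP.inject≤-injective N≤M N≤M m n e′)
  deal₁-injective N≤M N≤a (nothing , m) (nothing , n) e = cong (nothing ,_) (FinP.inject≤-injective N≤a N≤a m n (inj₂₁ e))

  deal₂-injective : ∀ {M a b N} (N≤M : N ≤ M) (N≤b : N ≤ b) x y → deal₂ {a = a} N≤M N≤b x ≡ deal₂ N≤M N≤b y → x ≡ y
  deal₂-injective N≤M N≤b (just i , m) (just j , n) e with inj₁-split e
  ... | refl , e′ = cong (just i ,_) (FinP.inject≤-injective N≤M N≤M m n e′)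
  deal₂-injective N≤M N≤b (nothing , m) (nothing , n) e = cong (nothing ,_) (FinP.inject≤-injective N≤b N≤b m n (inj₂₂ e))

-- Builder's strategy

module Strategy (k ℓ c : ℕ) where

  Win : Board → Set
  Win = BuilderWins k (Path ℓ) (Path c)

  -- The number of copies is fixed independently of the board, so a continuation can be planned as
  -- if every capability were available without limit.
  Winning : (I : Set) → (I → Capability) → Set
  Winning I κ = ∃ λ N → ∀ B → Good k B → Stock B (I × Fin N) (λ x → κ (proj₁ x)) → Win B

  module _ {I : Set} {κ : I → Capability} (s₁ s₂ : Side I)
    (h₁ : ∀ {i} → i ∈ members s₁ → hue (κ i) ≡ c1) (h₂ : ∀ {i} → i ∈ members s₂ → hue (κ i) ≡ c2)
    (T : ℕ) (T≡ : suc (total (λ i → weight (κ i)) s₁ + total (λ i → weight (κ i)) s₂) ≡ T) (T≤k : T ≤ k) where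

    private
      X Y : Capability
      X = cap c1 (suc (total (λ i → reach (κ i)) s₁)) T
      Y = cap c2 (suc (total (λ i → reach (κ i)) s₂)) T

      open Pigeonhole κ X Y

    -- Repeating one move often enough yields many copies of one of the two outcomes.
    offer : Winning (Maybe I) (κ ▹ X) → Winning (Maybe I) (κ ▹ Y) → Winning I κ
    offer (N₁ , win₁) (N₂ , win₂) = N₁ + N₂ + 2 * (N₁ + N₂) , λ B good stock →
      play N₁ N₂ _ 0 0 ≤-refl ≤-refl ≤-refl B good (recap (λ { (inj₁ _) → refl ; (inj₂ (inj₁ ())) ; (inj₂ (inj₂ ())) })
        (reindex {J = Supply (N₁ + N₂ + 2 * (N₁ + N₂)) 0 0} (λ { (inj₁ x) → x ; (inj₂ (inj₁ ())) ; (inj₂ (inj₂ ())) })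
          (λ { (inj₁ x) (inj₁ y) e → cong inj₁ e ; (inj₂ (inj₁ ())) ; (inj₂ (inj₂ ())) ; (inj₁ _) (inj₂ (inj₁ ())) ; (inj₁ _) (inj₂ (inj₂ ())) }) stock))
      where
      -- Here `r₁` and `r₂` count the outcomes still missing. Each repetition consumes at most two
      -- copies, and N₁ + N₂ copies are held back for whichever continuation is reached.
      play : ∀ r₁ r₂ M a b → N₁ ≤ a + r₁ → N₂ ≤ b + r₂ → N₁ + N₂ + 2 * (r₁ + r₂) ≤ M →
             ∀ B → Good k B → Stock B (Supply M a b) worth → Win B
      play zero r₂ M a b le₁ le₂ leM B good stock = win₁ B good
        (recap (λ { (just _ , _) → refl ; (nothing , _) → refl }) (reindex (deal₁ N≤M N≤a) (deal₁-injective N≤M N≤a) stock))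
        where
        N≤M : N₁ ≤ M
        N≤M = ≤-trans (≤-trans (m≤m+n N₁ N₂) (m≤m+n (N₁ + N₂) _)) leM
        N≤a : N₁ ≤ a
        N≤a = ≤-trans le₁ (≤-reflexive (+-identityʳ a))
      play (suc r₁) zero M a b le₁ le₂ leM B good stock = win₂ B good
        (recap (λ { (just _ , _) → refl ; (nothing , _) → refl }) (reindex (deal₂ N≤M N≤b) (deal₂-injective N≤M N≤b) stock))
        where
        N≤M : N₂ ≤ M
        N≤M = ≤-trans (≤-trans (m≤n+m N₂ N₁) (m≤m+n (N₁ + N₂) _)) leM
        N≤b : N₂ ≤ b
        N≤b = ≤-trans le₂ (≤-reflexive (+-identityʳ b))
      play (suc r₁) (suc r₂) zero a b le₁ le₂ leM = ⊥-elim (n≮0 (≤-trans (≤-reflexive (e N₁ N₂ r₁ r₂)) leM))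
        where e : ∀ N₁ N₂ r₁ r₂ → suc (N₁ + N₂ + (3 + 2 * (r₁ + r₂))) ≡ N₁ + N₂ + 2 * (suc r₁ + suc r₂)
              e = solve-∀
      play (suc r₁) (suc r₂) (suc zero) a b le₁ le₂ leM = ⊥-elim (n≮0 (s≤s⁻¹ (≤-trans (≤-reflexive (e N₁ N₂ r₁ r₂)) leM)))
        where e : ∀ N₁ N₂ r₁ r₂ → suc (suc (N₁ + N₂ + (2 + 2 * (r₁ + r₂)))) ≡ N₁ + N₂ + 2 * (suc r₁ + suc r₂)
              e = solve-∀
      play (suc r₁) (suc r₂) (suc (suc M)) a b le₁ le₂ leM B good stock = move S legal answer
        where
        sides : Colour → Side (Supply (suc (suc M)) a b)
        sides c1 = copies s₁
        sides c2 = copies s₂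
        right-hue : ∀ d {x} → x ∈ members (sides d) → hue (worth x) ≡ d
        right-hue c1 = hue-copies s₁ h₁
        right-hue c2 = hue-copies s₂ h₂
        distinct : ∀ d → Unique (members (sides d))
        distinct c1 = unique-copies s₁
        distinct c2 = unique-copies s₂
        open Advance good stock sides right-hue distinct T
          (trans (cong₂ (λ x y → suc (x + y)) (total-copies weight s₁) (total-copies weight s₂)) T≡) T≤k
        spare∉ : ∀ x → spare x ∉ members (copies s₁) ++ members (copies s₂)
        spare∉ x x∈ with ∈-++⁻ (members (copies s₁)) x∈
        ... | inj₁ y = spare∉copies s₁ x y
        ... | inj₂ y = spare∉copies s₂ x y
        leM′ : ∀ r → 2 * r + 2 ≡ 2 * (suc r₁ + suc r₂) → N₁ + N₂ + 2 * r ≤ M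
        leM′ r eq = s≤s⁻¹ (s≤s⁻¹ (≤-trans (≤-reflexive (trans (e (N₁ + N₂) (2 * r)) (cong (N₁ + N₂ +_) eq))) leM))
          where e : ∀ N r → suc (suc (N + r)) ≡ N + (r + 2)
                e = solve-∀
        answer : ∀ d → Win (extend B S d)
        answer c1 = play r₁ (suc r₂) M (suc a) b (≤-trans le₁ (≤-reflexive (+-suc a r₁))) le₂ (leM′ (r₁ + suc r₂) (e r₁ r₂)) _ (good′ c1)
          (recap (λ { (inj₁ _) → refl ; (inj₂ (inj₁ zero)) → cong (λ n → cap c1 (suc n) T) (total-copies reach s₁)
                    ; (inj₂ (inj₁ (suc _))) → refl ; (inj₂ (inj₂ _)) → refl })
            (reindex store₁ store₁-injective (stock′ spare spare-injective spare∉ c1)))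
          where e : ∀ x y → 2 * (x + suc y) + 2 ≡ 2 * (suc x + suc y)
                e = solve-∀
        answer c2 = play (suc r₁) r₂ M a (suc b) le₁ (≤-trans le₂ (≤-reflexive (+-suc b r₂))) (leM′ (suc r₁ + r₂) (e r₁ r₂)) _ (good′ c2)
          (recap (λ { (inj₁ _) → refl ; (inj₂ (inj₂ zero)) → cong (λ n → cap c2 (suc n) T) (total-copies reach s₂)
                    ; (inj₂ (inj₂ (suc _))) → refl ; (inj₂ (inj₁ _)) → refl })
            (reindex store₂ store₂-injective (stock′ spare spare-injective spare∉ c2)))
          where e : ∀ x y → 2 * (suc x + y) + 2 ≡ 2 * (suc x + suc y)
                e = solve-∀

  Has : {I : Set} → (I → Capability) → Capability → Set
  Has κ X = ∃ λ i → κ i ≡ X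

  _⊑_ : {I J : Set} → (I → Capability) → (J → Capability) → Set
  κ ⊑ κ′ = ∀ {X} → Has κ X → Has κ′ X

  ⊑-▹ : ∀ {I : Set} {κ : I → Capability} {X} → κ ⊑ (κ ▹ X)
  ⊑-▹ (i , e) = just i , e

  Inventory : (ℕ → ℕ) → {I : Set} → (I → Capability) → Set
  Inventory g κ = ∀ j → 0 < j → j < c → g j ≤ k → Has κ (cap c2 j (g j))

  won : ∀ {I : Set} {κ : I → Capability} d {n w} → Has κ (cap d n w) →
        (∀ B → Symmetric (graph B) → ∀ p → n ≤ length p → ColouredPath B d p → Lost (Path ℓ) (Path c) B) → Winning I κ
  won d (i , e) loses = 1 , λ B good stock → found B good (subst (λ X → Piece B X (Stock.endpoint stock (i , zero))) e (Stock.piece stock (i , zero)))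
    where
    found : ∀ B → Good k B → ∀ {u} → Piece B (cap d _ _) u → Win B
    found B good {u} (p , len , P , _) = lost (loses B (Good.symmetric good) (u ∷ p) (≤-reflexive (sym len)) P)

  won₁ : ∀ {I : Set} {κ : I → Capability} {n w} → Has κ (cap c1 n w) → ℓ ≤ n → Winning I κ
  won₁ has ℓ≤n = won c1 has (λ B s p n≤ P → inj₁ (path→copy {B} ℓ s (≤-trans ℓ≤n n≤) P))

  won₂ : ∀ {I : Set} {κ : I → Capability} {n w} → Has κ (cap c2 n w) → c ≤ n → Winning I κ
  won₂ has c≤n = won c2 has (λ B s p n≤ P → inj₂ (path→copy {B} c s (≤-trans c≤n n≤) P))

  pick : ∀ {I : Set} {κ : I → Capability} d n₁ w₁ n₂ w₂ → (n₁ ≡ 0 → w₁ ≡ 0) → (n₂ ≡ 0 → w₂ ≡ 0) →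
         (0 < n₁ → Has κ (cap d n₁ w₁)) → (0 < n₂ → Has κ (cap d n₂ w₂)) →
         ∃ λ s → (∀ {i} → i ∈ members s → hue (κ i) ≡ d) ×
                 total (λ i → reach (κ i)) s ≡ n₁ + n₂ × total (λ i → weight (κ i)) s ≡ w₁ + w₂
  pick d zero w₁ zero w₂ z₁ z₂ _ _ = none , (λ ()) , refl , sym (cong₂ _+_ (z₁ refl) (z₂ refl))
  pick {κ = κ} d zero w₁ n₂@(suc _) w₂ z₁ z₂ _ has with has (s≤s z≤n)
  ... | i , e = one i , (λ { (here refl) → cong hue e }) ,
        trans (+-identityʳ _) (cong reach e) , trans (+-identityʳ _) (trans (cong weight e) (cong (_+ w₂) (sym (z₁ refl))))
  pick d n₁@(suc _) w₁ zero w₂ z₁ z₂ has _ with has (s≤s z≤n)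
  ... | i , e = one i , (λ { (here refl) → cong hue e }) ,
        cong (_+ 0) (cong reach e) , cong₂ _+_ (cong weight e) (sym (z₂ refl))
  pick d n₁@(suc _) w₁ n₂@(suc _) w₂ z₁ z₂ has has′ with has (s≤s z≤n) | has′ (s≤s z≤n)
  ... | i , e | j , e′ = two i j , (λ { (here refl) → cong hue e ; (there (here refl)) → cong hue e′ }) ,
        cong₂ _+_ (cong reach e) (trans (+-identityʳ _) (cong reach e′)) , cong₂ _+_ (cong weight e) (trans (+-identityʳ _) (cong weight e′))

  weightless : ∀ {g n w} → Build c g n w → n ≡ 0 → w ≡ 0
  weightless nil _ = refl

  -- Painter either lets Builder carry out the construction or improves some entry of the cost function.
  produce : ∀ {g n w} → g 0 ≡ 0 → Build c g n w → w ≤ k → ∀ {I : Set} {κ : I → Capability} → Inventory g κ →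
            (∀ {J : Set} {κ′ : J → Capability} → κ ⊑ κ′ → ∀ b S → 0 < b → b < c → S < g b → S ≤ k → Has κ′ (cap c2 b S) → Winning J κ′) →
            (∀ {J : Set} {κ′ : J → Capability} → κ ⊑ κ′ → (0 < n → Has κ′ (cap c1 n w)) → Winning J κ′) → Winning I κ
  produce g0 nil w≤k inv improve continue = continue (λ has → has) (λ ())
  produce {g} g0 (join {i₁} {i₂} {w₁} {w₂} B₁ B₂ j₁ j₂ lt₁ lt₂ fr) w≤k inv improve continue =
    produce g0 B₁ w₁≤k inv improve (λ sub₁ has₁ →
    produce g0 B₂ w₂≤k (λ j 0<j j<c le → sub₁ (inv j 0<j j<c le)) (λ sub → improve (λ has → sub (sub₁ has))) (λ sub₂ has₂ →
    connect (λ has → sub₂ (sub₁ has)) (λ pos → sub₂ (has₁ pos)) has₂))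
    where
    w : ℕ
    w = suc (w₁ + w₂ + (g j₁ + g j₂))
    ww≤ : w₁ + w₂ ≤ k
    ww≤ = ≤-trans (≤-trans (m≤m+n (w₁ + w₂) _) (n≤1+n _)) w≤k
    w₁≤k : w₁ ≤ k
    w₁≤k = ≤-trans (m≤m+n w₁ w₂) ww≤
    w₂≤k : w₂ ≤ k
    w₂≤k = ≤-trans (m≤n+m w₂ w₁) ww≤
    gg≤ : g j₁ + g j₂ ≤ k
    gg≤ = ≤-trans (≤-trans (m≤n+m _ (w₁ + w₂)) (n≤1+n _)) w≤k
    weightless₂ : ∀ j → j ≡ 0 → g j ≡ 0
    weightless₂ _ refl = g0
    connect : ∀ {J : Set} {κ′ : J → Capability} → _ ⊑ κ′ → (0 < i₁ → Has κ′ (cap c1 i₁ w₁)) → (0 < i₂ → Has κ′ (cap c1 i₂ w₂)) → Winning J κ′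
    connect {J} {κ′} sub has₁ has₂ = joined
      (pick c1 i₁ w₁ i₂ w₂ (weightless B₁) (weightless B₂) has₁ has₂)
      (pick c2 j₁ (g j₁) j₂ (g j₂) (weightless₂ j₁) (weightless₂ j₂)
        (λ pos → sub (inv j₁ pos lt₁ (≤-trans (m≤m+n _ _) gg≤))) (λ pos → sub (inv j₂ pos lt₂ (≤-trans (m≤n+m _ _) gg≤))))
      where
      Sides : Colour → ℕ → ℕ → Set
      Sides d n v = ∃ λ s → (∀ {i} → i ∈ members s → hue (κ′ i) ≡ d) ×
                     total (λ i → reach (κ′ i)) s ≡ n × total (λ i → weight (κ′ i)) s ≡ v
      joined : Sides c1 (i₁ + i₂) (w₁ + w₂) → Sides c2 (j₁ + j₂) (g j₁ + g j₂) → Winning J κ′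
      joined (s₁ , h₁ , n₁ , v₁) (s₂ , h₂ , n₂ , v₂) =
        offer s₁ s₂ h₁ h₂ w (cong₂ (λ x y → suc (x + y)) v₁ v₂) w≤k
          (continue (λ has → ⊑-▹ (sub has)) (λ _ → nothing , cong (λ n → cap c1 (suc n) w) n₁))
          (respond fr)
        where
        new : Has (κ′ ▹ cap c2 (suc (total (λ i → reach (κ′ i)) s₂)) w) (cap c2 (suc (j₁ + j₂)) w)
        new = nothing , cong (λ n → cap c2 (suc n) w) n₂
        respond : Free c (suc (j₁ + j₂)) (g (suc (j₁ + j₂))) w → Winning (Maybe J) (κ′ ▹ cap c2 (suc (total (λ i → reach (κ′ i)) s₂)) w)
        respond (inj₁ c≤) = won₂ new c≤
        respond (inj₂ w<) with c ≤? suc (j₁ + j₂)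
        ... | yes c≤ = won₂ new c≤
        ... | no c≰ = improve (λ has → ⊑-▹ (sub has)) (suc (j₁ + j₂)) w (s≤s z≤n) (≰⇒> c≰) w< w≤k new

  update : (ℕ → ℕ) → ℕ → ℕ → ℕ → ℕ
  update g b S j with j ≟ b
  ... | yes _ = S
  ... | no _  = g j

  update-≤ : ∀ g b S → S ≤ g b → ∀ j → update g b S j ≤ g j
  update-≤ g b S le j with j ≟ b
  ... | yes refl = le
  ... | no _ = ≤-refl

  update-same : ∀ g b S → update g b S b ≡ S
  update-same g b S with b ≟ b
  ... | yes _ = refl
  ... | no b≢b = ⊥-elim (b≢b refl)

  -- Every improvement goes down to a value at most `k`, so entries truncated at k + 1 still record
  -- it, and the sum strictly decreases.
  potential : ℕ → (ℕ → ℕ) → ℕ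
  potential zero    g = 0
  potential (suc n) g = (g n ⊓ suc k) + potential n g

  potential-mono : ∀ n {g h} → (∀ j → h j ≤ g j) → potential n h ≤ potential n g
  potential-mono zero le = z≤n
  potential-mono (suc n) le = +-mono-≤ (⊓-monoˡ-≤ (suc k) (le n)) (potential-mono n le)

  potential-drop : ∀ n {g h} → (∀ j → h j ≤ g j) → ∀ b → b < n → h b < g b → h b ≤ k → potential n h < potential n g
  potential-drop (suc n) {g} {h} le b b<n lt h≤k with m≤n⇒m<n∨m≡n (s≤s⁻¹ b<n)
  ... | inj₁ b< = +-mono-≤-< (⊓-monoˡ-≤ (suc k) (le n)) (potential-drop n le b b< lt h≤k)
  ... | inj₂ refl = +-mono-<-≤ (≤-<-trans (m⊓n≤m (h b) (suc k)) (⊓-pres-m< lt (s≤s h≤k))) (potential-mono n le)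

  module _ (force : ∀ g → g 0 ≡ 0 → ∃ λ w → w ≤ k × Build c g ℓ w) (0<ℓ : 0 < ℓ) where

    -- Builder carries out a tree that is affordable against the current costs and starts afresh
    -- with the updated costs whenever an answer improves one; the potential bounds the number of
    -- restarts.
    wins-from : ∀ m g → potential c g ≡ m → g 0 ≡ 0 → ∀ {I : Set} {κ : I → Capability} → Inventory g κ → Winning I κ
    wins-from = <-rec (λ m → ∀ g → potential c g ≡ m → g 0 ≡ 0 → ∀ {I : Set} {κ : I → Capability} → Inventory g κ → Winning I κ) step
      where
      step : ∀ m → (∀ {m′} → m′ < m → ∀ g → potential c g ≡ m′ → g 0 ≡ 0 → ∀ {I : Set} {κ : I → Capability} → Inventory g κ → Winning I κ) →
             ∀ g → potential c g ≡ m → g 0 ≡ 0 → ∀ {I : Set} {κ : I → Capability} → Inventory g κ → Winning I κ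
      step m rec g refl g0 inv with force g g0
      ... | w , w≤k , B = produce g0 B w≤k inv improve (λ _ has → won₁ (has 0<ℓ) ≤-refl)
        where
        improve : ∀ {J : Set} {κ′ : J → Capability} → _ ⊑ κ′ → ∀ b S → 0 < b → b < c → S < g b → S ≤ k → Has κ′ (cap c2 b S) → Winning J κ′
        improve {κ′ = κ′} sub b S 0<b b<c S< S≤k has =
          rec (potential-drop c lower b b<c (subst (_< g b) (sym (update-same g b S)) S<) (subst (_≤ k) (sym (update-same g b S)) S≤k))
            (update g b S) refl (n≤0⇒n≡0 (≤-trans (lower 0) (≤-reflexive g0))) inv′
          where
          lower : ∀ j → update g b S j ≤ g j
          lower = update-≤ g b S (<⇒≤ S<)
          inv′ : Inventory (update g b S) κ′
          inv′ j 0<j j<c le with j ≟ b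
          ... | yes refl = has
          ... | no _ = sub (inv j 0<j j<c le)

    builder-wins : Win emptyBoard
    builder-wins with wins-from _ unavailable refl refl {⊥} {λ ()} nothing-needed
      where
      -- Costs of k + 1 demand nothing of the inventory, so the strategy starts from an empty stock.
      unavailable : ℕ → ℕ
      unavailable zero    = 0
      unavailable (suc _) = suc k
      nothing-needed : Inventory unavailable {⊥} (λ ())
      nothing-needed (suc j) _ _ le = ⊥-elim (1+n≰n le)
    ... | N , win = win emptyBoard (record { symmetric = λ () ; forest = λ cycle → no-vertex (Cycle.v cycle zero) ; bounded = λ () })
                      (record { endpoint = λ () ; piece = λ () ; apart = λ () })
      where
      no-vertex : Fin 0 → ⊥
      no-vertex ()

-- The limit

kstar : ∀ c → 0 < c → ℕ → ℕ
kstar c 0<c ℓ = Window.value (window c ℓ 0<c)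

module _ (c : ℕ) (0<c : 0 < c) where
  private
    K : ℕ → ℕ
    K = kstar c 0<c

  kstar-upper : ∀ q (r : Rate c q) n → q * Rate.d r * K n ≤ (q + 1) * Rate.a r * n
  kstar-upper q r n with Rate.upper r (Window.painter (window c n 0<c)) (Window.painter₀ (window c n 0<c)) n
  ... | w , B , le = ≤-trans (*-monoʳ-≤ (q * Rate.d r) (Window.necessary (window c n 0<c) w B)) le

  kstar-lower : ∀ q (r : Rate c q) n → Rate.a r * n ≤ Rate.d r * (K n + Rate.Γ r)
  kstar-lower q r n with Window.forceable (window c n 0<c) (Rate.painter r) (Rate.painter₀ r)
  ... | w , w≤ , B = ≤-trans (Rate.lower r B) (*-monoʳ-≤ (Rate.d r) (+-monoˡ-≤ (Rate.Γ r) w≤))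

  kstar-linear : ∃ λ Λ → ∀ n → K n ≤ Λ * n
  kstar-linear = 2 * Rate.a r , λ n → ≤-trans (m≤n*m (K n) (1 * Rate.d r) {{>-nonZero (*-mono-< {0} {1} (s≤s z≤n) (Rate.0<d r))}}) (kstar-upper 1 r n)
    where
    r : Rate c 1
    r = rates c 0<c 1 (s≤s z≤n)

  -- This is K(m)/m ≤ K(n)/n + 1/D. At accuracy q the two bounds give K(m)/m ≤ (1 + 1/q)(K(n) +
  -- Γ)/n; the excess over K(n)/n is at most Λ/q + 2Γ/n, and both terms are at most 1/(2D) once q ≥
  -- 2ΛD and n ≥ 4DΓ. Since `m` is arbitrary, the o(1) term comes out nonnegative.
  kstar-comparison : ∀ D → ∃ λ N → ∀ m n → N ≤ n → D * n * K m ≤ D * m * K n + m * n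
  kstar-comparison D = with-slope kstar-linear
    where
    with-slope : (∃ λ Λ → ∀ n → K n ≤ Λ * n) → ∃ λ N → ∀ m n → N ≤ n → D * n * K m ≤ D * m * K n + m * n
    with-slope (Λ , linear) = approximate (suc (2 * Λ * D)) (n≤1+n _) (s≤s z≤n)
      where
      approximate : ∀ q → 2 * Λ * D ≤ q → 0 < q → ∃ λ N → ∀ m n → N ≤ n → D * n * K m ≤ D * m * K n + m * n
      approximate q 2ΛD≤q 0<q = 4 * D * Γ , bound
        where
        r : Rate c q
        r = rates c 0<c q 0<q
        open Rate r
        bound : ∀ m n → 4 * D * Γ ≤ n → D * n * K m ≤ D * m * K n + m * n
        bound m n N≤n = *-cancelˡ-≤ (2 * q) {{m*n≢0 2 q {{_}} {{>-nonZero 0<q}}}} (begin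
          2 * q * (D * n * K m)                                       ≡⟨ x₃ q D n (K m) ⟩
          2 * D * (q * n * K m)                                       ≤⟨ *-monoʳ-≤ (2 * D) crossed ⟩
          2 * D * ((q + 1) * m * (K n + Γ))                           ≡⟨ x₄ q D m (K n) Γ ⟩
          2 * q * (D * m * K n) + m * (2 * D * K n + 2 * D * Γ * (q + 1)) ≤⟨ +-monoʳ-≤ _ (*-monoʳ-≤ m (+-mono-≤ small₁ small₂)) ⟩
          2 * q * (D * m * K n) + m * (q * n + q * n)                 ≡⟨ x₅ q (D * m * K n) m n ⟩
          2 * q * (D * m * K n + m * n)                               ∎)
          where
          open ≤-Reasoning
          x₁ : ∀ q d n x → d * (q * n * x) ≡ n * (q * d * x)
          x₁ = solve-∀
          x₂ : ∀ q m n a → n * ((q + 1) * a * m) ≡ (q + 1) * m * (a * n)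
          x₂ = solve-∀
          x₂′ : ∀ q m d y → (q + 1) * m * (d * y) ≡ d * ((q + 1) * m * y)
          x₂′ = solve-∀
          x₃ : ∀ q D n x → 2 * q * (D * n * x) ≡ 2 * D * (q * n * x)
          x₃ = solve-∀
          x₄ : ∀ q D m x Γ → 2 * D * ((q + 1) * m * (x + Γ)) ≡ 2 * q * (D * m * x) + m * (2 * D * x + 2 * D * Γ * (q + 1))
          x₄ = solve-∀
          x₅ : ∀ q y m n → 2 * q * y + m * (q * n + q * n) ≡ 2 * q * (y + m * n)
          x₅ = solve-∀
          x₆ : ∀ D Λ n → 2 * D * (Λ * n) ≡ 2 * Λ * D * n
          x₆ = solve-∀
          x₇ : ∀ D Γ q → 2 * D * Γ * (q + q) ≡ q * (4 * D * Γ)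
          x₇ = solve-∀
          crossed : q * n * K m ≤ (q + 1) * m * (K n + Γ)
          crossed = *-cancelˡ-≤ d {{>-nonZero 0<d}} (begin
            d * (q * n * K m)                 ≡⟨ x₁ q d n (K m) ⟩
            n * (q * d * K m)                 ≤⟨ *-monoʳ-≤ n (kstar-upper q r m) ⟩
            n * ((q + 1) * a * m)             ≡⟨ x₂ q m n a ⟩
            (q + 1) * m * (a * n)             ≤⟨ *-monoʳ-≤ ((q + 1) * m) (kstar-lower q r n) ⟩
            (q + 1) * m * (d * (K n + Γ))     ≡⟨ x₂′ q m d (K n + Γ) ⟩
            d * ((q + 1) * m * (K n + Γ))     ∎)
          small₁ : 2 * D * K n ≤ q * n
          small₁ = ≤-trans (*-monoʳ-≤ (2 * D) (linear n)) (≤-trans (≤-reflexive (x₆ D Λ n)) (*-monoˡ-≤ n 2ΛD≤q))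
          small₂ : 2 * D * Γ * (q + 1) ≤ q * n
          small₂ = ≤-trans (*-monoʳ-≤ (2 * D * Γ) (+-monoʳ-≤ q 0<q)) (≤-trans (≤-reflexive (x₇ D Γ q)) (*-monoʳ-≤ q N≤n))

-- Passage to rationals and the limit

-- A positive `ε` is at least the reciprocal of its denominator, which therefore serves as `D` in
-- `kstar-comparison`.
ratio-≤ : ∀ a b m n ε → 0ℚ ℚ.< ε → ℚ.↧ₙ ε * suc n * a ≤ ℚ.↧ₙ ε * suc m * b + suc m * suc n →
          ratio a m ℚ.≤ ratio b n ℚ.+ ε
ratio-≤ a b m n (mkℚ (ℤ.+ zero) d-1 cop) (*<* (ℤ.+<+ ())) le
ratio-≤ a b m n (mkℚ ℤ.-[1+ p ] d-1 cop) (*<* ()) le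
ratio-≤ a b m n ε@(mkℚ (ℤ.+ suc p) d-1 cop) _ le = ℚP.toℚᵘ-cancel-≤ (begin
  ℚ.toℚᵘ (ratio a m)                                     ≃⟨ ℚP.toℚᵘ-fromℚᵘ (ℚᵘ.mkℚᵘ (ℤ.+ a) m) ⟩
  ℚᵘ.mkℚᵘ (ℤ.+ a) m                                        ≤⟨ ℚᵘ.*≤* cross ⟩
  ℚᵘ.mkℚᵘ (ℤ.+ b) n ℚᵘ.+ ℚᵘ.mkℚᵘ (ℤ.+ suc p) d-1             ≃⟨ ℚᵘP.+-congˡ (ℚᵘ.mkℚᵘ (ℤ.+ suc p) d-1) (ℚᵘP.≃-sym (ℚP.toℚᵘ-fromℚᵘ (ℚᵘ.mkℚᵘ (ℤ.+ b) n))) ⟩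
  ℚ.toℚᵘ (ratio b n) ℚᵘ.+ ℚᵘ.mkℚᵘ (ℤ.+ suc p) d-1          ≃⟨ ℚᵘP.≃-sym (ℚP.toℚᵘ-homo-+ (ratio b n) ε) ⟩
  ℚ.toℚᵘ (ratio b n ℚ.+ ε)           ∎)
  where
  open ℚᵘP.≤-Reasoning
  nat : a * (suc n * suc d-1) ≤ (b * suc d-1 + suc p * suc n) * suc m
  nat = ≤-trans (≤-reflexive (x₁ a (suc n) (suc d-1))) (≤-trans le (≤-trans (m≤m+n _ (p * suc n * suc m))
          (≤-reflexive (x₂ b (suc n) (suc d-1) (suc m) p))))
    where
    x₁ : ∀ a n d → a * (n * d) ≡ d * n * a
    x₁ = solve-∀
    x₂ : ∀ b n d m p → d * m * b + m * n + p * n * m ≡ (b * d + suc p * n) * m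
    x₂ = solve-∀
  cross : ℤ.+ a ℤ.* ℤ.+ (suc n * suc d-1) ℤ.≤ (ℤ.+ b ℤ.* ℤ.+ suc d-1 ℤ.+ ℤ.+ suc p ℤ.* ℤ.+ suc n) ℤ.* ℤ.+ suc m
  cross = subst₂ ℤ._≤_ (ℤP.pos-* a (suc n * suc d-1))
    (trans (ℤP.pos-* (b * suc d-1 + suc p * suc n) (suc m))
      (cong (ℤ._* ℤ.+ suc m) (trans (ℤP.pos-+ (b * suc d-1) (suc p * suc n)) (cong₂ ℤ._+_ (ℤP.pos-* b (suc d-1)) (ℤP.pos-* (suc p) (suc n))))))
    (ℤ.+≤+ nat)

∣-∣-≤ : ∀ x y ε → x ℚ.≤ y ℚ.+ ε → y ℚ.≤ x ℚ.+ ε → ℚ.∣ x ℚ.- y ∣ ℚ.≤ ε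
∣-∣-≤ x y ε h₁ h₂ with ℚP.∣p∣≡p∨∣p∣≡-p (x ℚ.- y)
... | inj₁ e = ℚP.≤-trans (ℚP.≤-reflexive e) (ℚP.≤-trans (ℚP.+-monoˡ-≤ (ℚ.- y) h₁) (ℚP.≤-reflexive (cancel y ε)))
  where
  cancel : ∀ y ε → (y ℚ.+ ε) ℚ.- y ≡ ε
  cancel y ε = trans (cong (ℚ._- y) (ℚP.+-comm y ε)) (trans (ℚP.+-assoc ε y (ℚ.- y)) (trans (cong (ε ℚ.+_) (ℚP.+-inverseʳ y)) (ℚP.+-identityʳ ε)))
... | inj₂ e = ℚP.≤-trans (ℚP.≤-reflexive (trans e (flip x y))) (ℚP.≤-trans (ℚP.+-monoˡ-≤ (ℚ.- x) h₂) (ℚP.≤-reflexive (cancel x ε)))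
  where
  cancel : ∀ y ε → (y ℚ.+ ε) ℚ.- y ≡ ε
  cancel y ε = trans (cong (ℚ._- y) (ℚP.+-comm y ε)) (trans (ℚP.+-assoc ε y (ℚ.- y)) (trans (cong (ε ℚ.+_) (ℚP.+-inverseʳ y)) (ℚP.+-identityʳ ε)))
  flip : ∀ x y → ℚ.- (x ℚ.- y) ≡ y ℚ.- x
  flip x y = trans (ℚP.neg-distrib-+ x (ℚ.- y)) (trans (ℚP.+-comm (ℚ.- x) (ℚ.- (ℚ.- y))) (cong (ℚ._- x) (⁻¹-involutive y)))

-- Late terms nearly dominate all terms, as `m` is unrestricted. Used in both directions this is the
-- Cauchy property; for fixed `m` it puts the term below the limit.
module OneSidedCauchy (x : ℕ → ℚ)
  (x-≤ : ∀ ε → 0ℚ ℚ.< ε → ∃ λ N → ∀ m n → N ≤ n → x m ℚ.≤ x n ℚ.+ ε) where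

  close : ∀ ε → 0ℚ ℚ.< ε → ∃ λ N → ∀ m n → N ≤ m → N ≤ n → ℚ.∣ x m ℚ.- x n ∣ ℚ.≤ ε
  close ε 0<ε with x-≤ ε 0<ε
  ... | N , near = N , λ m n N≤m N≤n → ∣-∣-≤ _ _ ε (near m n N≤n) (near n m N≤m)

  limit : ℝ
  limit = record { seq = x ; cauchy = close }

  below-limit : ∀ m → x m ≤ℚℝ limit
  below-limit m ε 0<ε with x-≤ ε 0<ε
  ... | N , near = N , λ n N≤n → near m n N≤n

  converges : ConvergesTo x limit
  converges ε 0<ε with close ε 0<ε
  ... | N , near = N , λ ℓ N≤ℓ → N , λ n N≤n → near ℓ n N≤ℓ N≤n

ratio-comparison : (K : ℕ → ℕ) → (∀ D → ∃ λ N → ∀ m n → N ≤ n → D * n * K m ≤ D * m * K n + m * n) →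
  ∀ ε → 0ℚ ℚ.< ε → ∃ λ N → ∀ m n → N ≤ n → ratio (K (suc m)) m ℚ.≤ ratio (K (suc n)) n ℚ.+ ε
ratio-comparison K comparison ε 0<ε = proj₁ (comparison (ℚ.↧ₙ ε)) , λ m n N≤n →
  ratio-≤ (K (suc m)) (K (suc n)) m n ε 0<ε (proj₂ (comparison (ℚ.↧ₙ ε)) (suc m) (suc n) (m≤n⇒m≤1+n N≤n))

is-kstar : ∀ c (0<c : 0 < c) ℓ → 1 ≤ ℓ → IsKStar (Path ℓ) (Path c) (kstar c 0<c ℓ)
is-kstar c 0<c ℓ 1≤ℓ =
  ≤-trans 1≤ℓ (length≤value W) , Strategy.builder-wins K ℓ c (Window.forceable W) 1≤ℓ , minimal
  where
  W : Window c ℓ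
  W = window c ℓ 0<c
  K : ℕ
  K = Window.value W
  minimal : ∀ k → 1 ≤ k → BuilderHasWinningStrategy k (Path ℓ) (Path c) → K ≤ k
  minimal k _ wins with K ≤? k
  ... | yes K≤k = K≤k
  ... | no K≰k = ⊥-elim (Invariant.survives k c (Window.painter W) (Window.painter₀ W) 0<c 1≤ℓ
          (λ w B → <-≤-trans (≰⇒> K≰k) (Window.necessary W w B))
          (Invariant.empty-safe k c (Window.painter W) (Window.painter₀ W) 0<c) wins)

theorem5 : ∀ (c : ℕ) → 1 ≤ c →
    ∃ λ (δ : ℝ) → ∃ λ (kstar : ℕ → ℕ) →
    (∀ ℓ → 1 ≤ ℓ → IsKStar (Path ℓ) (Path c) (kstar ℓ)) ×
    (∀ m → ratio (kstar (suc m)) m ≤ℚℝ δ) ×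
    ConvergesTo (λ m → ratio (kstar (suc m)) m) δ
theorem5 c 1≤c = limit , kstar c 1≤c , is-kstar c 1≤c , below-limit , converges
  where
  open OneSidedCauchy (λ m → ratio (kstar c 1≤c (suc m)) m)
    (ratio-comparison (kstar c 1≤c) (kstar-comparison c 1≤c))
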